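{- Let $\Sigma$ be a finite alphabet, let $\varphi\colon\Sigma^*\to\Sigma^*$ be a morphism, let $a\in\Sigma$ and $\gamma\in\Sigma^*$ be such that $\varphi(a)=a\gamma$ and $\varphi^n(\gamma)$ is nonempty for every $n\ge 0$, let $\alpha=\varphi^\infty(a)=\lim_{n\to\infty}\varphi^n(a)$, and let $\psi\colon\Sigma^*\to\Sigma^*$ be a coding. Let $\beta=\psi(\alpha)$ and let $p_\beta$ be its subword complexity. Then either there exists $k\in\mathbb{N}=\{1,2,3,\dots\}$ such that $p_\beta(n)=\Theta(n^{1+1/k})$, or $p_\beta(n)=O(n\log n)$.
   Context: A morphism $\varphi\colon\Sigma^*\to\Sigma^*$ is a map with $\varphi(uv)=\varphi(u)\varphi(v)$ for all words $u,v$; it is a coding if $|\varphi(b)|=1$ for every letter $b\in\Sigma$. If $\varphi(a)=a\gamma$ with $\varphi^n(\gamma)$ nonempty for all $n$, then $\varphi^n(a)$ is a prefix of $\varphi^{n+1}(a)$ and the lengths tend to infinity, so the infinite word $\varphi^\infty(a)=\lim_n\varphi^n(a)$ is well defined (a pure morphic sequence); sequences $\psi(\varphi^\infty(a))$ with $\psi$ a coding are called morphic. The subword complexity of an infinite word $\beta$ is the function $p_\beta\colon\mathbb{N}\to\mathbb{N}$ where $p_\beta(n)$ is the number of distinct words of length $n$ occurring as (contiguous) subwords of $\beta$. Asymptotic notation refers to $n\to\infty$. -}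

module Defs where

open import Data.Nat using (ℕ; zero; suc; _+_; _*_; _^_; _≤_; _<_)
open import Data.Nat.Logarithm using (⌊log₂_⌋)
open import Data.Fin using (Fin; toℕ)
open import Data.List using (List; []; _∷_; concatMap; length; lookup)
open import Data.List.Relation.Unary.Unique.Propositional using (Unique)
open import Data.List.Membership.Propositional using (_∈_)
open import Data.Vec as Vec using (Vec)
open import Data.Product using (Σ; ∃; ∃-syntax; _×_)
open import Relation.Binary.PropositionalEquality using (_≡_; _≢_)

Word : ℕ → Set
Word s = List (Fin s)

InfWord : ℕ → Set
InfWord s = ℕ → Fin s

-- A morphism Σ* → Σ* is determined by the images of the letters.
Morphism : ℕ → Set
Morphism s = Fin s → Word s

applyM : ∀ {s} → Morphism s → Word s → Word s
applyM φ w = concatMap φ w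

iterM : ∀ {s} → Morphism s → ℕ → Word s → Word s
iterM φ zero    w = w
iterM φ (suc n) w = applyM φ (iterM φ n w)

-- A coding Σ* → Σ* is a letter-to-letter map (|ψ(b)| = 1), applied pointwise.
Coding : ℕ → Set
Coding s = Fin s → Fin s

PrefixOf : ∀ {s} → Word s → InfWord s → Set
PrefixOf u α = ∀ (i : Fin (length u)) → lookup u i ≡ α (toℕ i)

-- α = φ^∞(a) : every φⁿ(a) is a prefix of α (under the hypotheses the
-- lengths |φⁿ(a)| tend to infinity, so this determines α uniquely).
IsFixedPointLimit : ∀ {s} → Morphism s → Fin s → InfWord s → Set
IsFixedPointLimit φ a α = ∀ n → PrefixOf (iterM φ n (a ∷ [])) α

Factor : ∀ {s} → InfWord s → (n : ℕ) → Vec (Fin s) n → Set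
Factor β n w = ∃[ i ] (∀ (j : Fin n) → Vec.lookup w j ≡ β (i + toℕ j))

IsSubwordComplexity : ∀ {s} → InfWord s → (ℕ → ℕ) → Set
IsSubwordComplexity {s} β p =
  ∀ n → Σ (List (Vec (Fin s) n)) λ ws →
    length ws ≡ p n × Unique ws ×
    (∀ w → (w ∈ ws → Factor β n w) × (Factor β n w → w ∈ ws))

-- p(n) = Θ(n^{1+1/k}), equivalently (raising to the k-th power, k ≥ 1):
-- for some C and N, for all n ≥ N:  n^{k+1} ≤ C·p(n)^k  and  p(n)^k ≤ C·n^{k+1}.
IsThetaPow : (ℕ → ℕ) → ℕ → Set
IsThetaPow p k = ∃[ C ] ∃[ N ] (∀ n → N ≤ n →
  (n ^ (suc k) ≤ C * (p n ^ k)) × (p n ^ k ≤ C * n ^ (suc k)))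

IsBigONLogN : (ℕ → ℕ) → Set
IsBigONLogN p = ∃[ C ] ∃[ N ] (∀ n → N ≤ n → p n ≤ C * n * ⌊log₂ n ⌋)

{-# OPTIONS --safe #-}
module Submission where

open import Defs
open import Data.Nat
open import Data.Nat.Properties
open import Data.Fin using (Fin; toℕ; fromℕ<; combine; funToFin; finToFun)
import Data.Fin as Fin
import Data.Fin.Properties as Fin
open import Data.Maybe using (Maybe; just; nothing)
open import Data.Maybe.Properties using (just-injective)
open import Data.List hiding (find; any; all)
open import Data.List.Properties
open import Data.List.Membership.Propositional
open import Data.List.Membership.Propositional.Properties
open import Data.List.Relation.Unary.All as All using (All; []; _∷_)
import Data.List.Relation.Unary.All.Properties as All
open import Data.List.Relation.Unary.Any as Any using (Any; here; there)
import Data.List.Relation.Unary.Any.Properties as Any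
open import Data.List.Relation.Unary.AllPairs using ([]; _∷_)
open import Data.List.Relation.Unary.Unique.Propositional using (Unique)
open import Data.Product hiding (map; zip; zipWith; assocʳ; assocˡ; swap)
open import Data.Sum using (_⊎_; inj₁; inj₂; [_,_]′)
open import Data.Empty using (⊥; ⊥-elim)
open import Function using (_∘_; case_of_)
open import Relation.Nullary using (¬_; Dec; yes; no)
open import Relation.Unary using (Decidable)
open import Relation.Binary.Definitions using (tri<; tri≈; tri>)
open import Relation.Binary.PropositionalEquality hiding (J)
open import Data.Nat.Logarithm using (⌊log₂_⌋; ⌊log₂⌋-mono-≤; ⌊log₂⌊n/2⌋⌋≡⌊log₂n⌋∸1; ⌊log₂[2*b]⌋≡1+⌊log₂b⌋)
open import Data.Nat.Divisibility using (_∣_; divides; m∣m*n; ∣-trans; m≤n⇒m!∣n!)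
open import Data.Nat.Induction using (<-rec)
open import Relation.Nullary.Decidable using (¬?; _×-dec_; _⊎-dec_)
open import Data.Nat.DivMod using (_/_; m/n*n≤m; m≡m%n+[m/n]*n; m%n<n)
open import Data.Vec as Vec using (Vec)
import Data.Vec.Properties as Vec
import Data.List.Relation.Unary.Unique.Propositional.Properties as Unique

-- After passing to a power of φ and discarding mortal letters, β is the limit of words W m a with
-- W (m + 1) c = W m (φ c), and every letter grows like m^d or exponentially.  Fix a common multiple p
-- of the periods that long words in bounded letters produce.  Reading W m c against a p-periodic
-- pattern may be assumed to behave the same for all m, so that the lengths of the maximal p-periodic
-- runs of β fall into finitely many sequences ℓ(m), each bounded, of order m^d with d ≥ 1, or at least
-- exponential.
--
-- Let k be the least such d.  A window of length n containing a run of length ℓ(m) ~ m^k is determined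
-- only by the offset of the run and by m, which gives of order n · n^{1/k} windows.  Conversely, at a
-- level M ~ n^{1/k} (M ~ log n if there is no d) every run meeting a level-M boundary is either short
-- or longer than n.  Hence a window is covered by one letter of level M, or it is a bounded number
-- of letters of level M between two p-periodic words; both kinds number O(n · M).

-- Words

-- The obstacle is that a run may cross many letters of a level, so what stops it is not visible
-- near a given boundary. The remedy is to follow it upwards. As long as the reading survives the
-- rest of a parent's image on one side, the boundary moves to that edge and the same run is seen
-- among the parents, one level higher. The climb ends inside the image φ e of one letter, where
-- both directions break off. A run is thus described by e, a position in φ e and a state, and these
-- are the finitely many types.
--
-- For the upper bound, any K consecutive letters of a window, none of them growing too fast,
-- contain after I further generations a periodic block longer than the bound on short runs. Its run
-- has length at least n, so it swallows the part of the window to its left or the part to its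
-- right. Sliding the K letters along the window finds where the answer switches from left to right,
-- and at most K + 1 letters remain there.
--
-- Reading to the left must break off for a run to have a length. It fails to do so only if β itself
-- has period p, a case of bounded complexity treated separately.

split-++ : ∀ {A : Set} (xs : List A) {ys} zs {ws} → xs ++ ys ≡ zs ++ ws →
  (∃[ k ] zs ≡ xs ++ k × ys ≡ k ++ ws) ⊎ (∃[ k ] xs ≡ zs ++ k × ws ≡ k ++ ys)
split-++ []       zs       eq = inj₁ (zs , refl , eq)
split-++ (x ∷ xs) []       eq = inj₂ (x ∷ xs , refl , sym eq)
split-++ (x ∷ xs) (z ∷ zs) eq with ∷-injective eq
... | refl , eq′ with split-++ xs zs eq′
... | inj₁ (k , p , q) = inj₁ (k , cong (x ∷_) p , q)
... | inj₂ (k , p , q) = inj₂ (k , cong (x ∷_) p , q)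

++-assoc₃ : ∀ {A : Set} (a b c : List A) {d} → (a ++ b ++ c) ++ d ≡ a ++ b ++ c ++ d
++-assoc₃ a b c {d} = trans (++-assoc a (b ++ c) d) (cong (a ++_) (++-assoc b c d))

length-++₃ : ∀ {A : Set} (a b c : List A) → length (a ++ b ++ c) ≡ length a + (length b + length c)
length-++₃ a b c = trans (length-++ a) (cong (length a +_) (length-++ b))

infix-trans : ∀ {A : Set} {w : List A} a b {c d v} → v ≡ a ++ w ++ b → ∀ {u} → u ≡ c ++ v ++ d →
  u ≡ (c ++ a) ++ w ++ (b ++ d)
infix-trans {w = w} a b {c} {d} refl {u} eq = trans eq (trans (cong (c ++_) (++-assoc₃ a w b))
  (sym (++-assoc c a _)))

concatMap-infix : ∀ {A B : Set} (f : A → List B) {u} a v b → u ≡ a ++ v ++ b →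
  concatMap f u ≡ concatMap f a ++ concatMap f v ++ concatMap f b
concatMap-infix f a v b refl = trans (concatMap-++ f a (v ++ b)) (cong (concatMap f a ++_) (concatMap-++ f v b))

concatMap-[_] : ∀ {A B : Set} (f : A → List B) c → concatMap f (c ∷ []) ≡ f c
concatMap-[_] f c = ++-identityʳ (f c)

∈-infix : ∀ {A : Set} {c : A} {u} → c ∈ u → ∃[ a ] ∃[ b ] u ≡ a ++ (c ∷ []) ++ b
∈-infix m with a , b , eq ← ∈-∃++ m = a , b , eq

concatMap-∈ : ∀ {A B : Set} (f : A → List B) {c u} → c ∈ u → ∃[ a ] ∃[ b ] concatMap f u ≡ a ++ f c ++ b
concatMap-∈ f {c} m with a , b , eq ← ∈-infix m =
  concatMap f a , concatMap f b , trans (concatMap-infix f a (c ∷ []) b eq)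
    (cong (λ x → concatMap f a ++ x ++ concatMap f b) (concatMap-[ f ] c))

concatMap-concatMap : ∀ {A B C : Set} (f : B → List C) (g : A → List B) u →
  concatMap f (concatMap g u) ≡ concatMap (λ c → concatMap f (g c)) u
concatMap-concatMap f g []      = refl
concatMap-concatMap f g (c ∷ u) = trans (concatMap-++ f (g c) (concatMap g u))
  (cong (concatMap f (g c) ++_) (concatMap-concatMap f g u))

reverse-concatMap : ∀ {A B : Set} (f : A → List B) u →
  reverse (concatMap f u) ≡ concatMap (reverse ∘ f) (reverse u)
reverse-concatMap f []      = refl
reverse-concatMap f (c ∷ u) = begin
  reverse (f c ++ concatMap f u)                                ≡⟨ reverse-++ (f c) _ ⟩
  reverse (concatMap f u) ++ reverse (f c)                      ≡⟨ cong (_++ reverse (f c)) (reverse-concatMap f u) ⟩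
  concatMap g (reverse u) ++ reverse (f c)                      ≡⟨ cong (concatMap g (reverse u) ++_) (concatMap-[ g ] c) ⟨
  concatMap g (reverse u) ++ concatMap g (c ∷ [])               ≡⟨ concatMap-++ g (reverse u) _ ⟨
  concatMap g (reverse u ∷ʳ c)                                  ≡⟨ cong (concatMap g) (unfold-reverse c u) ⟨
  concatMap g (reverse (c ∷ u))                                 ∎
  where open ≡-Reasoning
        g = reverse ∘ f

length≤concatMap : ∀ {A B : Set} (f : A → List B) → (∀ c → 1 ≤ length (f c)) →
  ∀ u → length u ≤ length (concatMap f u)
length≤concatMap f ne []      = z≤n
length≤concatMap f ne (c ∷ u) = ≤-trans (+-mono-≤ (ne c) (length≤concatMap f ne u)) (≤-reflexive (sym (length-++ (f c))))

concatMap-cong-All : ∀ {A B : Set} {f g : A → List B} {u} → All (λ c → f c ≡ g c) u → concatMap f u ≡ concatMap g u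
concatMap-cong-All []       = refl
concatMap-cong-All (p ∷ ps) = cong₂ _++_ p (concatMap-cong-All ps)

All-infix : ∀ {A : Set} {P : A → Set} a v b {u} → u ≡ a ++ v ++ b → All P u → All P v
All-infix a v b refl ps = All.++⁻ˡ v (All.++⁻ʳ a ps)

-- Cutting a window out of a concatenation of images

SuffixOfLetter PrefixOfLetter : ∀ {A B : Set} → (A → List B) → List A → List B → Set
SuffixOfLetter f U s = s ≡ [] ⊎ ∃[ e ] e ∈ U × ∃[ x ] f e ≡ x ++ s
PrefixOfLetter f U t = t ≡ [] ⊎ ∃[ e ] e ∈ U × ∃[ y ] f e ≡ t ++ y

cutˡ : ∀ {A B : Set} (f : A → List B) U t′ {Y} → concatMap f U ≡ t′ ++ Y →
  ∃[ v ] ∃[ U₂ ] ∃[ t ] U ≡ v ++ U₂ × t′ ≡ concatMap f v ++ t × t ++ Y ≡ concatMap f U₂ ×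
    (t ≡ [] ⊎ ∃[ e ] ∃[ U₃ ] U₂ ≡ e ∷ U₃ × ∃[ y ] f e ≡ t ++ y × Y ≡ y ++ concatMap f U₃)
cutˡ f [] [] {[]} eq = [] , [] , [] , refl , refl , refl , inj₁ refl
cutˡ f (e ∷ U) t′ eq with split-++ (f e) t′ eq
... | inj₂ (y , p , q) = [] , e ∷ U , t′ , refl , refl , sym eq , inj₂ (e , U , refl , y , p , q)
... | inj₁ (k , p , q) with cutˡ f U k q
... | v , U₂ , t , refl , refl , r , s = e ∷ v , U₂ , t , refl , trans p (sym (++-assoc (f e) _ _)) , r , s

-- `X≡` and `Y≡` remember what lies outside the window, because a run through the window is later
-- measured beyond both of its ends.
record Cut {A B : Set} (f : A → List B) (U : List A) (X w Y : List B) : Set where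
  constructor mkCut
  field
    U₁ v U₂ : List A
    s t     : List B
    U≡      : U ≡ U₁ ++ v ++ U₂
    w≡      : w ≡ s ++ concatMap f v ++ t
    X≡      : X ++ s ≡ concatMap f U₁
    Y≡      : t ++ Y ≡ concatMap f U₂
    sOf     : SuffixOfLetter f U s
    tOf     : PrefixOfLetter f U t

InLetter : ∀ {A B : Set} → (A → List B) → List A → List B → Set
InLetter f U w = ∃[ e ] e ∈ U × ∃[ x ] ∃[ y ] f e ≡ x ++ w ++ y

cut : ∀ {A B : Set} (f : A → List B) U {X} w {Y} → concatMap f U ≡ X ++ w ++ Y → InLetter f U w ⊎ Cut f U X w Y
cut f [] {[]} [] {[]} eq = inj₂ (mkCut [] [] [] [] [] refl refl refl refl (inj₁ refl) (inj₁ refl))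
cut f (e ∷ U) {X} w {Y} eq with split-++ (f e) X eq
... | inj₁ (k , p , q) with cut f U w q
...   | inj₁ (e′ , m , r) = inj₁ (e′ , there m , r)
...   | inj₂ (mkCut U₁ v U₂ s t a b c d sO tO) = inj₂ (mkCut (e ∷ U₁) v U₂ s t (cong (e ∷_) a) b
          (trans (cong (_++ s) p) (trans (++-assoc (f e) k s) (cong (f e ++_) c))) d (thereₛ sO) (thereₜ tO))
  where
  thereₛ : SuffixOfLetter f U s → SuffixOfLetter f (e ∷ U) s
  thereₛ (inj₁ x) = inj₁ x
  thereₛ (inj₂ (e′ , m , x)) = inj₂ (e′ , there m , x)
  thereₜ : PrefixOfLetter f U t → PrefixOfLetter f (e ∷ U) t
  thereₜ (inj₁ x) = inj₁ x
  thereₜ (inj₂ (e′ , m , x)) = inj₂ (e′ , there m , x)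
cut f (e ∷ U) {X} w {Y} eq | inj₂ (k , p , q) with split-++ w k q
... | inj₁ (k′ , r , _) = inj₁ (e , here refl , X , k′ , trans p (cong (X ++_) r))
... | inj₂ (t′ , r , q′) with cutˡ f U t′ q′
... | v , U₂ , t , refl , refl , c , d = inj₂ (mkCut (e ∷ []) v U₂ k t refl r
        (trans (sym p) (sym (concatMap-[ f ] e))) c (inj₂ (e , here refl , X , p)) (tOf d))
  where
  tOf : (t ≡ [] ⊎ ∃[ e′ ] ∃[ U₃ ] U₂ ≡ e′ ∷ U₃ × ∃[ y ] f e′ ≡ t ++ y × Y ≡ y ++ concatMap f U₃) → PrefixOfLetter f (e ∷ v ++ U₂) t
  tOf (inj₁ x) = inj₁ x
  tOf (inj₂ (e′ , U₃ , refl , y , x , _)) = inj₂ (e′ , there (∈-++⁺ʳ v (here refl)) , y , x)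

firstNot : ∀ {A : Set} {S : A → Set} → Decidable S → ∀ u →
  All S u ⊎ ∃[ q ] ∃[ c ] ∃[ y ] u ≡ q ++ c ∷ y × All S q × ¬ S c
firstNot S? [] = inj₁ []
firstNot S? (c ∷ u) with S? c
... | no ¬p = inj₂ ([] , c , u , refl , [] , ¬p)
... | yes p with firstNot S? u
... | inj₁ ps = inj₁ (p ∷ ps)
... | inj₂ (q , c′ , y , refl , ps , ¬p) = inj₂ (c ∷ q , c′ , y , refl , p ∷ ps , ¬p)

-- Enumerating words, uniform constants, eventually periodic sequences

words : ∀ s → ℕ → List (Word s)
words s zero    = [] ∷ []
words s (suc n) = concatMap (λ c → map (c ∷_) (words s n)) (allFin s)

∈-words : ∀ {s} (w : Word s) → w ∈ words s (length w)
∈-words []      = here refl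
∈-words (c ∷ w) = ∈-concatMap⁺ (λ c → map (c ∷_) (words _ (length w))) (lose (∈-allFin c) (∈-map⁺ (c ∷_) (∈-words w)))

words≤ : ∀ s → ℕ → List (Word s)
words≤ s zero    = words s zero
words≤ s (suc n) = words≤ s n ++ words s (suc n)

∈-words≤ : ∀ {s} (w : Word s) {n} → length w ≤ n → w ∈ words≤ s n
∈-words≤ [] {zero} p = here refl
∈-words≤ w {suc n} p with m≤n⇒m<n∨m≡n p
... | inj₁ (s≤s q) = ∈-++⁺ˡ (∈-words≤ w q)
... | inj₂ q       = ∈-++⁺ʳ (words≤ _ n) (subst (λ k → w ∈ words _ k) q (∈-words w))

unique⇒length≤ : ∀ {A : Set} {xs ys : List A} → Unique xs → (∀ {x} → x ∈ xs → x ∈ ys) → length xs ≤ length ys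
unique⇒length≤ [] sub = z≤n
unique⇒length≤ {xs = x ∷ xs} {ys} (x∉ ∷ u) sub with a , b , refl ← ∈-∃++ (sub (here refl)) =
  ≤-trans (s≤s (unique⇒length≤ u (λ m → keep m (sub (there m)))))
    (≤-reflexive (trans (cong suc (length-++ a)) (trans (sym (+-suc (length a) (length b))) (sym (length-++ a)))))
  where
  keep : ∀ {y} → y ∈ xs → y ∈ a ++ x ∷ b → y ∈ a ++ b
  keep m n with ∈-++⁻ a n
  ... | inj₁ p = ∈-++⁺ˡ p
  ... | inj₂ (here refl) = ⊥-elim (All.lookup x∉ m refl)
  ... | inj₂ (there p) = ∈-++⁺ʳ a p

length-concatMap≤ : ∀ {A B : Set} (f : A → List B) K → ∀ u → (∀ c → length (f c) ≤ K) →
  length (concatMap f u) ≤ length u * K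
length-concatMap≤ f K [] p = z≤n
length-concatMap≤ f K (c ∷ u) p = ≤-trans (≤-reflexive (length-++ (f c))) (+-mono-≤ (p c) (length-concatMap≤ f K u p))

uniform : ∀ {A : Set} {P : A → ℕ → Set} → (∀ {x m n} → m ≤ n → P x m → P x n) → (xs : List A) →
  (∀ x → ∃ (P x)) → ∃[ n ] ∀ {x} → x ∈ xs → P x n
uniform mono [] h = 0 , λ ()
uniform mono (x ∷ xs) h with h x | uniform mono xs h
... | m , p | n , q = m ⊔ n , λ { (here refl) → mono (m≤m⊔n m n) p ; (there i) → mono (m≤n⊔m m n) (q i) }

uniformFin : ∀ {s} {P : Fin s → ℕ → Set} → (∀ {x m n} → m ≤ n → P x m → P x n) →
  (∀ x → ∃ (P x)) → ∃[ n ] ∀ x → P x n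
uniformFin {s} mono h with uniform mono (allFin s) h
... | n , p = n , λ x → p (∈-allFin x)

-- By pigeonhole a value recurs, and determinism then makes the sequence periodic with period d from
-- i′ on. All multiples of d beyond i′ carry the same value; the factor `suc i′` puts N beyond i′
-- and keeps it positive.
idempotentIndex : ∀ {K} (st : ℕ → Fin K) → (∀ i j → st i ≡ st j → st (suc i) ≡ st (suc j)) →
  ∃[ N ] 1 ≤ N × ∀ j → st (suc j * N) ≡ st N
idempotentIndex {K} st det
  with i , j , i<j , eq ← Fin.pigeonhole (n<1+n K) (st ∘ toℕ) = N , N≥1 , thm
  where
  open ≡-Reasoning
  i′ = toℕ i
  d = toℕ j ∸ i′
  d≥1 : 1 ≤ d
  d≥1 = m<n⇒0<n∸m i<j
  N = suc i′ * d
  N≥1 : 1 ≤ N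
  N≥1 = ≤-trans d≥1 (m≤m+n d (i′ * d))
  shift : ∀ k → st (i′ + k) ≡ st (d + (i′ + k))
  shift zero = subst₂ (λ x y → st x ≡ st y) (sym (+-identityʳ i′))
    (trans (sym (m∸n+n≡m (<⇒≤ i<j))) (cong (d +_) (sym (+-identityʳ i′)))) eq
  shift (suc k) = subst₂ (λ x y → st x ≡ st y) (sym (+-suc i′ k))
    (trans (sym (+-suc d (i′ + k))) (cong (d +_) (sym (+-suc i′ k)))) (det _ _ (shift k))
  shift′ : ∀ m → i′ ≤ m → st m ≡ st (d + m)
  shift′ m i≤m = subst (λ x → st x ≡ st (d + x)) (m+[n∸m]≡n i≤m) (shift (m ∸ i′))
  shifts : ∀ t m → i′ ≤ m → st m ≡ st (t * d + m)
  shifts zero m i≤m = refl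
  shifts (suc t) m i≤m = trans (shifts t m i≤m) (trans (shift′ _ (≤-trans i≤m (m≤n+m m (t * d))))
    (cong st (sym (+-assoc d (t * d) m))))
  i≤N : i′ ≤ N
  i≤N = ≤-trans (n≤1+n i′) (≤-trans (≤-reflexive (sym (*-identityʳ (suc i′)))) (*-monoʳ-≤ (suc i′) d≥1))
  thm : ∀ j → st (suc j * N) ≡ st N
  thm j = begin
    st (N + j * N)                ≡⟨ cong st (+-comm N (j * N)) ⟩
    st (j * N + N)                ≡⟨ cong (λ x → st (x + N)) (sym (*-assoc j (suc i′) d)) ⟩
    st (j * suc i′ * d + N)       ≡⟨ shifts (j * suc i′) N i≤N ⟨
    st N                          ∎

idempotentIndex₂ : ∀ {K L} (st : ℕ → Fin K) (st′ : ℕ → Fin L) →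
  (∀ i j → st i ≡ st j → st (suc i) ≡ st (suc j)) → (∀ i j → st′ i ≡ st′ j → st′ (suc i) ≡ st′ (suc j)) →
  ∃[ n ] ∀ j → st (suc j * suc n) ≡ st (suc n) × st′ (suc j * suc n) ≡ st′ (suc n)
idempotentIndex₂ st st′ det det′ with idempotentIndex (λ m → combine (st m) (st′ m)) (λ i j e →
    let e₁ , e₂ = Fin.combine-injective (st i) (st′ i) (st j) (st′ j) e in cong₂ combine (det i j e₁) (det′ i j e₂))
... | suc n , _ , h = n , λ j → Fin.combine-injective (st (suc j * suc n)) (st′ (suc j * suc n)) (st (suc n)) (st′ (suc n)) (h j)

-- Growth types

-- `strict` makes runs of different levels differ in length, which the lower bound counts. `mono`
-- lets `strict` survive the addition of a term of smaller degree. At degree 0 the sequence is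
-- bounded and cannot increase strictly for ever.
record Poly (f : ℕ → ℕ) (d : ℕ) : Set where
  constructor mkPoly
  field
    C m₀   : ℕ
    lo     : ∀ m → m₀ ≤ m → suc m ^ d ≤ C * f m
    hi     : ∀ m → f m ≤ C * suc m ^ d
    mono   : ∀ m → m₀ ≤ m → f m ≤ f (suc m)
    strict : 1 ≤ d → ∀ m → m₀ ≤ m → f m < f (suc m)

record EventuallyZero (f : ℕ → ℕ) : Set where
  constructor mkZero
  field
    C m₀  : ℕ
    bound : ∀ m → f m ≤ C
    zeros : ∀ m → m₀ ≤ m → f m ≡ 0

-- At least exponential growth, stated in the form in which it is applied: a number of levels of
-- order log n suffices to exceed n. Such sequences only have to be large, so there is no upper
-- bound.
Expo : (ℕ → ℕ) → Set
Expo f = ∃[ C ] ∀ n m → C * suc ⌊log₂ n ⌋ ≤ m → n ≤ f m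

-- Eventually zero and degree 0 are kept apart because summation separates them: increments of
-- degree 0 add up to degree 1, increments that eventually vanish add up to a constant.
data Growth (f : ℕ → ℕ) : Set where
  zer : EventuallyZero f → Growth f
  pol : ∀ d → Poly f d → Growth f
  exp : Expo f → Growth f

Growth-ext : ∀ {f g} → (∀ m → f m ≡ g m) → Growth f → Growth g
Growth-ext e (zer (mkZero C m₀ b z)) = zer (mkZero C m₀ (λ m → subst (_≤ C) (e m) (b m)) (λ m p → trans (sym (e m)) (z m p)))
Growth-ext e (pol d (mkPoly C m₀ l h mo st)) = pol d (mkPoly C m₀
  (λ m p → subst (λ x → suc m ^ d ≤ C * x) (e m) (l m p))
  (λ m → subst (_≤ C * suc m ^ d) (e m) (h m))
  (λ m p → subst₂ _≤_ (e m) (e (suc m)) (mo m p))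
  (λ q m p → subst₂ _<_ (e m) (e (suc m)) (st q m p)))
Growth-ext e (exp (C , p)) = exp (C , λ n m q → subst (n ≤_) (e m) (p n m q))

^-≤-suc : ∀ m {d e} → d ≤ e → suc m ^ d ≤ suc m ^ e
^-≤-suc m p = ^-monoʳ-≤ (suc m) p

1≤^ : ∀ m d → 1 ≤ suc m ^ d
1≤^ m d = subst (_≤ suc m ^ d) (^-zeroˡ d) (^-monoˡ-≤ d (s≤s z≤n))

*-swap : ∀ a b c → a * (b * c) ≡ b * (a * c)
*-swap a b c = trans (sym (*-assoc a b c)) (trans (cong (_* c) (*-comm a b)) (*-assoc b a c))

^-distrib-* : ∀ a b d → (a * b) ^ d ≡ a ^ d * b ^ d
^-distrib-* a b zero = refl
^-distrib-* a b (suc d) = begin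
  a * b * (a * b) ^ d       ≡⟨ cong (a * b *_) (^-distrib-* a b d) ⟩
  a * b * (a ^ d * b ^ d)   ≡⟨ *-assoc a b _ ⟩
  a * (b * (a ^ d * b ^ d)) ≡⟨ cong (a *_) (*-swap b (a ^ d) (b ^ d)) ⟩
  a * (a ^ d * (b * b ^ d)) ≡⟨ *-assoc a (a ^ d) _ ⟨
  a * a ^ d * (b * b ^ d)   ∎
  where open ≡-Reasoning

suc-suc-^ : ∀ m d → suc (suc m) ^ d ≤ 2 ^ d * suc m ^ d
suc-suc-^ m d = ≤-trans (^-monoˡ-≤ d (≤-trans (≤-reflexive (cong suc (sym (+-comm m 1))))
    (≤-trans (+-monoʳ-≤ (suc m) (s≤s z≤n)) (≤-reflexive (cong (suc m +_) (sym (+-identityʳ (suc m))))))))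
  (≤-reflexive (^-distrib-* 2 (suc m) d))

Growth-+-comm : ∀ {f g : ℕ → ℕ} → Growth (λ m → f m + g m) → Growth (λ m → g m + f m)
Growth-+-comm {f} {g} = Growth-ext (λ m → +-comm (f m) (g m))

polyAdd : ∀ {f g d e} → d ≤ e → Poly f d → Poly g e → Poly (λ m → f m + g m) e
polyAdd {f} {g} {d} {e} d≤e (mkPoly C m₀ l h mo st) (mkPoly C′ m₀′ l′ h′ mo′ st′) =
  mkPoly (C + C′) (m₀ ⊔ m₀′)
    (λ m p → ≤-trans (l′ m (≤-trans (m≤n⊔m m₀ m₀′) p)) (*-mono-≤ (m≤n+m C′ C) (m≤n+m (g m) (f m))))
    (λ m → ≤-trans (+-mono-≤ (≤-trans (h m) (*-monoʳ-≤ C (^-≤-suc m d≤e))) (h′ m))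
      (≤-reflexive (sym (*-distribʳ-+ (suc m ^ e) C C′))))
    (λ m p → +-mono-≤ (mo m (≤-trans (m≤m⊔n m₀ m₀′) p)) (mo′ m (≤-trans (m≤n⊔m m₀ m₀′) p)))
    (λ q m p → +-mono-≤-< (mo m (≤-trans (m≤m⊔n m₀ m₀′) p)) (st′ q m (≤-trans (m≤n⊔m m₀ m₀′) p)))

zeroAdd : ∀ {f g} → EventuallyZero f → Growth g → Growth (λ m → f m + g m)
zeroAdd {f} {g} (mkZero C m₀ b z) (zer (mkZero C′ m₀′ b′ z′)) = zer (mkZero (C + C′) (m₀ ⊔ m₀′)
  (λ m → +-mono-≤ (b m) (b′ m))
  (λ m p → cong₂ _+_ (z m (≤-trans (m≤m⊔n m₀ m₀′) p)) (z′ m (≤-trans (m≤n⊔m m₀ m₀′) p))))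
zeroAdd {f} {g} (mkZero C m₀ b z) (pol e (mkPoly C′ m₀′ l′ h′ mo′ st′)) = pol e (mkPoly (C + C′) (m₀ ⊔ m₀′)
    (λ m p → ≤-trans (l′ m (≤-trans (m≤n⊔m m₀ m₀′) p)) (*-mono-≤ (m≤n+m C′ C) (m≤n+m (g m) (f m))))
    (λ m → ≤-trans (+-mono-≤ (≤-trans (b m) (≤-trans (≤-reflexive (sym (*-identityʳ C))) (*-monoʳ-≤ C (1≤^ m e)))) (h′ m))
      (≤-reflexive (sym (*-distribʳ-+ (suc m ^ e) C C′))))
    (λ m p → +-mono-≤ (zz m p) (mo′ m (≤-trans (m≤n⊔m m₀ m₀′) p)))
    (λ q m p → +-mono-≤-< (zz m p) (st′ q m (≤-trans (m≤n⊔m m₀ m₀′) p))))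
  where
  zz : ∀ m → m₀ ⊔ m₀′ ≤ m → f m ≤ f (suc m)
  zz m p = subst (_≤ f (suc m)) (sym (z m (≤-trans (m≤m⊔n m₀ m₀′) p))) z≤n
zeroAdd {f} {g} _ (exp (C , p)) = exp (C , λ n m q → ≤-trans (p n m q) (m≤n+m (g m) (f m)))

Growth-+ : ∀ {f g} → Growth f → Growth g → Growth (λ m → f m + g m)
Growth-+ {f} {g} (zer x) G = zeroAdd x G
Growth-+ {f} {g} (pol d x) (zer y) = Growth-+-comm {g} {f} (zeroAdd y (pol d x))
Growth-+ {f} {g} (pol d x) (pol e y) with ≤-total d e
... | inj₁ p = pol e (polyAdd p x y)
... | inj₂ p = Growth-+-comm {g} {f} (pol d (polyAdd p y x))
Growth-+ {f} {g} (pol d x) (exp (C , p)) = exp (C , λ n m q → ≤-trans (p n m q) (m≤n+m (g m) (f m)))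
Growth-+ {f} {g} (exp (C , p)) G = exp (C , λ n m q → ≤-trans (p n m q) (m≤m+n (f m) (g m)))

expoShift : ∀ {f g : ℕ → ℕ} → (∀ m → f m ≤ g (suc m)) → Expo f → Expo g
expoShift {f} {g} e (C , p) = suc C , λ { n zero () ; n (suc m) (s≤s q) →
  ≤-trans (p n m (≤-trans (m≤n+m _ ⌊log₂ n ⌋) q)) (e m) }

Growth-shift : ∀ {f g} → (∀ m → g (suc m) ≡ f m) → Growth f → Growth g
Growth-shift {f} {g} e (zer (mkZero C m₀ b z)) = zer (mkZero (g 0 + C) (suc m₀)
  (λ { zero → m≤m+n (g 0) C ; (suc m) → ≤-trans (≤-reflexive (e m)) (≤-trans (b m) (m≤n+m C (g 0))) })
  (λ { (suc m) (s≤s p) → trans (e m) (z m p) }))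
Growth-shift {f} {g} e (pol d (mkPoly C m₀ l h mo st)) = pol d (mkPoly (g 0 + 2 ^ d * C) (suc m₀)
  (λ { (suc m) (s≤s p) → lo m p })
  (λ { zero → ≤-trans (m≤m+n (g 0) _) (≤-trans (≤-reflexive (sym (*-identityʳ _))) (*-monoʳ-≤ (g 0 + 2 ^ d * C) (1≤^ 0 d)))
     ; (suc m) → ≤-trans (≤-reflexive (e m)) (≤-trans (h m) (*-mono-≤ (≤-trans (m≤n*m C (2 ^ d) {{m^n≢0 2 d}}) (m≤n+m _ (g 0))) (^-monoˡ-≤ d (n≤1+n (suc m))))) })
  (λ { (suc m) (s≤s p) → subst₂ _≤_ (sym (e m)) (sym (e (suc m))) (mo m p) })
  (λ { q (suc m) (s≤s p) → subst₂ _<_ (sym (e m)) (sym (e (suc m))) (st q m p) }))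
  where
  lo : ∀ m → m₀ ≤ m → suc (suc m) ^ d ≤ (g 0 + 2 ^ d * C) * g (suc m)
  lo m p = begin
    suc (suc m) ^ d               ≤⟨ suc-suc-^ m d ⟩
    2 ^ d * suc m ^ d             ≤⟨ *-monoʳ-≤ (2 ^ d) (l m p) ⟩
    2 ^ d * (C * f m)             ≡⟨ *-assoc (2 ^ d) C (f m) ⟨
    2 ^ d * C * f m               ≤⟨ *-monoˡ-≤ (f m) (m≤n+m (2 ^ d * C) (g 0)) ⟩
    (g 0 + 2 ^ d * C) * f m       ≡⟨ cong ((g 0 + 2 ^ d * C) *_) (e m) ⟨
    (g 0 + 2 ^ d * C) * g (suc m) ∎
    where open ≤-Reasoning
Growth-shift {f} {g} e (exp x) = exp (expoShift (λ m → ≤-reflexive (sym (e m))) x)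

-- Telescoped in polySum to bound Σ (j+1)^d from below.
pow-increment : ∀ j d → suc j ^ suc d ≤ j ^ suc d + suc d * suc j ^ d
pow-increment j zero = ≤-reflexive (trans (*-identityʳ (suc j)) (trans (+-comm 1 j) (cong (_+ 1) (sym (*-identityʳ j)))))
pow-increment j (suc d) = begin
  suc j * suc j ^ suc d                                         ≤⟨ *-monoʳ-≤ (suc j) (pow-increment j d) ⟩
  suc j * (j ^ suc d + suc d * suc j ^ d)                       ≡⟨ *-distribˡ-+ (suc j) (j ^ suc d) _ ⟩
  (j ^ suc d + j * j ^ suc d) + suc j * (suc d * suc j ^ d)     ≡⟨ cong₂ _+_ (+-comm (j ^ suc d) _) (*-swap (suc j) (suc d) (suc j ^ d)) ⟩
  (j ^ suc (suc d) + j ^ suc d) + suc d * suc j ^ suc d         ≤⟨ +-monoˡ-≤ (suc d * suc j ^ suc d) (+-monoʳ-≤ (j ^ suc (suc d)) (^-monoˡ-≤ (suc d) (n≤1+n j))) ⟩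
  (j ^ suc (suc d) + suc j ^ suc d) + suc d * suc j ^ suc d     ≡⟨ +-assoc (j ^ suc (suc d)) _ _ ⟩
  j ^ suc (suc d) + suc (suc d) * suc j ^ suc d                 ∎
  where
  open ≤-Reasoning

polySum : ∀ {f g d} → (∀ m → g (suc m) ≡ f m + g m) → Poly f d → Poly g (suc d)
polySum {f} {g} {d} e (mkPoly C m₀ l h mo st) = mkPoly C′ (suc m₀) lo hi (λ m p → <⇒≤ (str m p)) (λ _ → str)
  where
  open ≤-Reasoning
  C₁ = suc d * C + m₀ ^ suc d
  C′ = g 0 + C + 2 ^ suc d * C₁
  f≥1 : ∀ m → m₀ ≤ m → 1 ≤ f m
  f≥1 m p with f m in eq
  ... | zero  = ⊥-elim (<⇒≱ (1≤^ m d) (≤-trans (l m p) (≤-reflexive (trans (cong (C *_) eq) (*-zeroʳ C)))))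
  ... | suc _ = s≤s z≤n
  str : ∀ m → suc m₀ ≤ m → g m < g (suc m)
  str m p = ≤-trans (+-monoˡ-≤ (g m) (f≥1 m (<⇒≤ p))) (≤-reflexive (sym (e m)))
  g≥1 : ∀ m → m₀ ≤ m → 1 ≤ g (suc m)
  g≥1 m p = ≤-trans (f≥1 m p) (≤-trans (m≤m+n (f m) (g m)) (≤-reflexive (sym (e m))))
  tele : ∀ k → (k + m₀) ^ suc d ≤ suc d * C * g (k + m₀) + m₀ ^ suc d
  tele zero = m≤n+m _ (suc d * C * g m₀)
  tele (suc k) = begin
    suc (k + m₀) ^ suc d                                                  ≤⟨ pow-increment (k + m₀) d ⟩
    (k + m₀) ^ suc d + suc d * suc (k + m₀) ^ d                           ≤⟨ +-mono-≤ (tele k) (*-monoʳ-≤ (suc d) (l (k + m₀) (m≤n+m m₀ k))) ⟩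
    (suc d * C * g (k + m₀) + m₀ ^ suc d) + suc d * (C * f (k + m₀))      ≡⟨ +-assoc (suc d * C * g (k + m₀)) _ _ ⟩
    suc d * C * g (k + m₀) + (m₀ ^ suc d + suc d * (C * f (k + m₀)))      ≡⟨ cong (suc d * C * g (k + m₀) +_) (trans (+-comm (m₀ ^ suc d) _) (cong (_+ m₀ ^ suc d) (sym (*-assoc (suc d) C _)))) ⟩
    suc d * C * g (k + m₀) + (suc d * C * f (k + m₀) + m₀ ^ suc d)        ≡⟨ +-assoc (suc d * C * g (k + m₀)) _ _ ⟨
    (suc d * C * g (k + m₀) + suc d * C * f (k + m₀)) + m₀ ^ suc d        ≡⟨ cong (_+ m₀ ^ suc d) (trans (sym (*-distribˡ-+ (suc d * C) _ _)) (cong (suc d * C *_) (trans (+-comm (g (k + m₀)) _) (sym (e (k + m₀)))))) ⟩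
    suc d * C * g (suc k + m₀) + m₀ ^ suc d                               ∎
  tele′ : ∀ m → m₀ ≤ m → suc m ^ suc d ≤ C₁ * g (suc m)
  tele′ m p = begin
    suc m ^ suc d                                    ≡⟨ cong (_^ suc d) (sym eqm) ⟩
    (suc m ∸ m₀ + m₀) ^ suc d                        ≤⟨ tele (suc m ∸ m₀) ⟩
    suc d * C * g (suc m ∸ m₀ + m₀) + m₀ ^ suc d     ≡⟨ cong (λ x → suc d * C * g x + m₀ ^ suc d) eqm ⟩
    suc d * C * g (suc m) + m₀ ^ suc d               ≤⟨ +-monoʳ-≤ (suc d * C * g (suc m)) (≤-trans (≤-reflexive (sym (*-identityʳ _))) (*-monoʳ-≤ (m₀ ^ suc d) (g≥1 m p))) ⟩
    suc d * C * g (suc m) + m₀ ^ suc d * g (suc m)   ≡⟨ *-distribʳ-+ (g (suc m)) (suc d * C) (m₀ ^ suc d) ⟨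
    C₁ * g (suc m)                                   ∎
    where eqm = m∸n+n≡m (≤-trans p (n≤1+n m))
  lo : ∀ m → suc m₀ ≤ m → suc m ^ suc d ≤ C′ * g m
  lo (suc m) (s≤s p) = begin
    suc (suc m) ^ suc d               ≤⟨ suc-suc-^ m (suc d) ⟩
    2 ^ suc d * suc m ^ suc d         ≤⟨ *-monoʳ-≤ (2 ^ suc d) (tele′ m p) ⟩
    2 ^ suc d * (C₁ * g (suc m))      ≡⟨ *-assoc (2 ^ suc d) C₁ _ ⟨
    2 ^ suc d * C₁ * g (suc m)        ≤⟨ *-monoˡ-≤ (g (suc m)) (m≤n+m _ (g 0 + C)) ⟩
    C′ * g (suc m)                    ∎
  hi₀ : ∀ m → g m ≤ g 0 + C * (m * suc m ^ d)
  hi₀ zero = m≤m+n (g 0) _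
  hi₀ (suc m) = begin
    g (suc m)                                              ≡⟨ e m ⟩
    f m + g m                                              ≤⟨ +-mono-≤ (h m) (hi₀ m) ⟩
    C * suc m ^ d + (g 0 + C * (m * suc m ^ d))            ≤⟨ +-mono-≤ (*-monoʳ-≤ C pw) (+-monoʳ-≤ (g 0) (*-monoʳ-≤ C (*-monoʳ-≤ m pw))) ⟩
    C * P + (g 0 + C * (m * P))                            ≡⟨ trans (+-comm (C * P) _) (+-assoc (g 0) _ _) ⟩
    g 0 + (C * (m * P) + C * P)                            ≡⟨ cong (g 0 +_) (trans (sym (*-distribˡ-+ C (m * P) P)) (cong (C *_) (+-comm (m * P) P))) ⟩
    g 0 + C * (suc m * P)                                  ∎
    where P = suc (suc m) ^ d
          pw = ^-monoˡ-≤ d (n≤1+n (suc m))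
  hi : ∀ m → g m ≤ C′ * suc m ^ suc d
  hi m = begin
    g m                                            ≤⟨ hi₀ m ⟩
    g 0 + C * (m * suc m ^ d)                      ≤⟨ +-mono-≤ (≤-trans (≤-reflexive (sym (*-identityʳ (g 0)))) (*-monoʳ-≤ (g 0) (1≤^ m (suc d)))) (*-monoʳ-≤ C (*-monoˡ-≤ (suc m ^ d) (n≤1+n m))) ⟩
    g 0 * suc m ^ suc d + C * suc m ^ suc d        ≡⟨ *-distribʳ-+ (suc m ^ suc d) (g 0) C ⟨
    (g 0 + C) * suc m ^ suc d                      ≤⟨ *-monoˡ-≤ (suc m ^ suc d) (m≤m+n (g 0 + C) _) ⟩
    C′ * suc m ^ suc d                             ∎

Growth-sum : ∀ {f g} → (∀ m → g (suc m) ≡ f m + g m) → Growth f → Growth g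
Growth-sum {f} {g} e (pol d x) = pol (suc d) (polySum e x)
Growth-sum {f} {g} e (exp x) = exp (expoShift (λ m → ≤-trans (m≤m+n (f m) (g m)) (≤-reflexive (sym (e m)))) x)
Growth-sum {f} {g} e (zer (mkZero C m₀ b z)) = decideConst (g m₀) refl
  where
  const : ∀ k → g (k + m₀) ≡ g m₀
  const zero = refl
  const (suc k) = trans (e (k + m₀)) (trans (cong (_+ g (k + m₀)) (z _ (m≤n+m m₀ k))) (const k))
  const′ : ∀ m → m₀ ≤ m → g m ≡ g m₀
  const′ m p = subst (λ x → g x ≡ g m₀) (m∸n+n≡m p) (const (m ∸ m₀))
  below : ∀ k m → g m ≤ g (k + m)
  below zero m = ≤-refl
  below (suc k) m = ≤-trans (below k m) (≤-trans (m≤n+m _ (f (k + m))) (≤-reflexive (sym (e (k + m)))))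
  bnd : ∀ m → g m ≤ g m₀
  bnd m = ≤-trans (below m₀ m) (≤-reflexive (const′ (m₀ + m) (m≤m+n m₀ m)))
  -- g never decreases and is constant from m₀ on, so its final value decides between identically
  -- zero and degree 0.
  decideConst : ∀ v → g m₀ ≡ v → Growth g
  decideConst zero eq = zer (mkZero 0 0 (λ m → subst (g m ≤_) eq (bnd m)) (λ m _ → n≤0⇒n≡0 (subst (g m ≤_) eq (bnd m))))
  decideConst (suc v) eq = pol 0 (mkPoly (suc v) m₀
    (λ m p → *-mono-≤ (s≤s (z≤n {v})) (subst (1 ≤_) (sym (trans (const′ m p) eq)) (s≤s z≤n)))
    (λ m → subst (g m ≤_) (trans eq (sym (*-identityʳ (suc v)))) (bnd m))
    (λ m p → ≤-reflexive (trans (const′ m p) (sym (const′ (suc m) (≤-trans p (n≤1+n m))))))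
    (λ ()))

-- Words of period p

-- A state is the word of the p letters expected next.

module _ {s : ℕ} where

  step : Word s → Fin s → Maybe (Word s)
  step []      x = nothing
  step (y ∷ t) x with x Fin.≟ y
  ... | yes _ = just (t ++ x ∷ [])
  ... | no  _ = nothing

  run : Word s → Word s → Maybe (Word s)
  run z []      = just z
  run z (x ∷ X) with step z x
  ... | just z′ = run z′ X
  ... | nothing = nothing

  hd : Word s → Word s → ℕ
  hd z []      = 0
  hd z (x ∷ X) with step z x
  ... | just z′ = suc (hd z′ X)
  ... | nothing = 0

  Alive Dead : Word s → Word s → Set
  Alive z X = ∃[ z′ ] run z X ≡ just z′
  Dead  z X = run z X ≡ nothing

  alive? : ∀ z X → Alive z X ⊎ Dead z X
  alive? z X with run z X
  ... | just z′ = inj₁ (z′ , refl)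
  ... | nothing = inj₂ refl

  alive≢dead : ∀ z X → Alive z X → Dead z X → ⊥
  alive≢dead _ _ (_ , p) q with () ← trans (sym p) q

  run-++-just : ∀ z X {Y z′} → run z X ≡ just z′ → run z (X ++ Y) ≡ run z′ Y
  run-++-just z [] refl = refl
  run-++-just z (x ∷ X) eq with step z x
  ... | just z₁ = run-++-just z₁ X eq

  run-++-nothing : ∀ z X {Y} → Dead z X → Dead z (X ++ Y)
  run-++-nothing z (x ∷ X) eq with step z x
  ... | just z₁ = run-++-nothing z₁ X eq
  ... | nothing = refl

  run-++⁻ : ∀ z X {Y z″} → run z (X ++ Y) ≡ just z″ → ∃[ z′ ] run z X ≡ just z′ × run z′ Y ≡ just z″
  run-++⁻ z X {Y} eq with alive? z X
  ... | inj₁ (z′ , p) = z′ , p , trans (sym (run-++-just z X p)) eq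
  ... | inj₂ p = ⊥-elim (alive≢dead z (X ++ Y) (_ , eq) (run-++-nothing z X p))

  hd-++-just : ∀ z X {Y z′} → run z X ≡ just z′ → hd z (X ++ Y) ≡ length X + hd z′ Y
  hd-++-just z [] refl = refl
  hd-++-just z (x ∷ X) eq with step z x
  ... | just z₁ = cong suc (hd-++-just z₁ X eq)

  hd-++-nothing : ∀ z X {Y} → Dead z X → hd z (X ++ Y) ≡ hd z X
  hd-++-nothing z (x ∷ X) eq with step z x
  ... | just z₁ = cong suc (hd-++-nothing z₁ X eq)
  ... | nothing = refl

  hd≤⇒alive : ∀ z X {Y} → length X ≤ hd z (X ++ Y) → Alive z X
  hd≤⇒alive z [] p = z , refl
  hd≤⇒alive z (x ∷ X) p with step z x
  hd≤⇒alive z (x ∷ X) (s≤s p) | just z₁ = hd≤⇒alive z₁ X p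

  -- Reading X from z to z′ is the conjugacy equation zX = Xz′, and `run-complete` gives the
  -- converse for nonempty states. An equation between words can be reversed, and this is how
  -- rightward readings turn into leftward ones.
  run-rotate : ∀ z X {z′} → run z X ≡ just z′ → z ++ X ≡ X ++ z′
  run-rotate z [] refl = ++-identityʳ z
  run-rotate (y ∷ t) (x ∷ X) eq with x Fin.≟ y
  ... | yes refl = cong (x ∷_) (trans (sym (++-assoc t (x ∷ []) X)) (run-rotate (t ++ x ∷ []) X eq))

  run-complete : ∀ y t X {z′} → (y ∷ t) ++ X ≡ X ++ z′ → run (y ∷ t) X ≡ just z′
  run-complete y t [] eq = cong just (trans (sym (++-identityʳ (y ∷ t))) eq)
  run-complete y t (x ∷ X) eq with ∷-injective eq
  ... | refl , eq′ with y Fin.≟ y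
  ... | no ¬p = ⊥-elim (¬p refl)
  ... | yes _ = go t eq′
    where
    go : ∀ t → t ++ y ∷ X ≡ X ++ _ → run (t ++ y ∷ []) X ≡ just _
    go [] e = run-complete y [] X e
    go (u ∷ t) e = run-complete u (t ++ y ∷ []) X (trans (++-assoc (u ∷ t) (y ∷ []) X) e)

  run-complete′ : ∀ z X {z′} → 1 ≤ length z → z ++ X ≡ X ++ z′ → run z X ≡ just z′
  run-complete′ (y ∷ t) X _ = run-complete y t X

  run-length : ∀ z X {z′} → run z X ≡ just z′ → length z′ ≡ length z
  run-length z X {z′} eq = +-cancelˡ-≡ (length X) _ _ (trans (sym (length-++ X)) (trans (cong length (sym (run-rotate z X eq)))
    (trans (length-++ z) (+-comm (length z) _))))

  run-reverse : ∀ z X {z′} → 1 ≤ length z → run z X ≡ just z′ → run (reverse z′) (reverse X) ≡ just (reverse z)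
  run-reverse z X {z′} p eq = run-complete′ _ _
    (subst (1 ≤_) (sym (trans (length-reverse z′) (run-length z X eq))) p)
    (trans (sym (reverse-++ X z′)) (trans (cong reverse (sym (run-rotate z X eq))) (reverse-++ z X)))

  hd-stop : ∀ z X → 1 ≤ length z → Dead z X →
    ∃[ X₁ ] ∃[ x ] ∃[ X₂ ] ∃[ y ] ∃[ t ] X ≡ X₁ ++ x ∷ X₂ × length X₁ ≡ hd z X × run z X₁ ≡ just (y ∷ t) × x ≢ y
  hd-stop (y ∷ t) (x ∷ X) p eq with x Fin.≟ y in e
  ... | no x≢y = [] , x , X , y , t , refl , refl , refl , x≢y
  ... | yes refl with hd-stop (t ++ x ∷ []) X (subst (1 ≤_) (sym (length-++-comm t (x ∷ []))) (s≤s z≤n)) eq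
  ... | X₁ , x′ , X₂ , y′ , t′ , refl , l , r , ne = x ∷ X₁ , x′ , X₂ , y′ , t′ , refl , cong suc l , r′ , ne
    where
    r′ : run (x ∷ t) (x ∷ X₁) ≡ just (y′ ∷ t′)
    r′ rewrite e = r

  periodicPrefix : Word s → ℕ → Word s
  periodicPrefix z       zero    = []
  periodicPrefix []      (suc n) = []
  periodicPrefix (y ∷ t) (suc n) = y ∷ periodicPrefix (t ++ y ∷ []) n

  alive⇒periodicPrefix : ∀ z X → Alive z X → X ≡ periodicPrefix z (length X)
  alive⇒periodicPrefix z [] p = refl
  alive⇒periodicPrefix (y ∷ t) (x ∷ X) (z′ , p) with x Fin.≟ y
  ... | yes refl = cong (x ∷_) (alive⇒periodicPrefix (t ++ x ∷ []) X (z′ , p))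

  module Period (p : ℕ) (p≥1 : 1 ≤ p) where

    OK : Word s → Set
    OK X = ∃[ z ] length z ≡ p × Alive z X

    len≥1 : ∀ (z : Word s) → length z ≡ p → 1 ≤ length z
    len≥1 z eq = subst (1 ≤_) (sym eq) p≥1

    OK-infix : ∀ X a b {c} → X ≡ a ++ b ++ c → OK X → OK b
    OK-infix _ a b {c} refl (z , l , z″ , eq) with run-++⁻ z a eq
    ... | z₁ , e₁ , e₂ with run-++⁻ z₁ b e₂
    ... | z₂ , e₃ , _ = z₁ , trans (run-length z a e₁) l , z₂ , e₃

    OK-reverse : ∀ X → OK X → OK (reverse X)
    OK-reverse X (z , l , z′ , eq) = reverse z′ , trans (length-reverse z′) (trans (run-length z X eq) l) ,
      reverse z , run-reverse z X (len≥1 z l) eq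

    OK-reverse⁻ : ∀ X → OK (reverse X) → OK X
    OK-reverse⁻ X p = subst OK (reverse-involutive X) (OK-reverse (reverse X) p)

    -- One candidate per state, whatever the length n: a periodic end of a window therefore costs
    -- only a constant factor in the count.
    periodicWords : ℕ → List (Word s)
    periodicWords n = map (λ z → periodicPrefix z n) (words s p)

    OK⇒∈ : ∀ X → OK X → X ∈ periodicWords (length X)
    OK⇒∈ X (z , l , a) = subst (_∈ periodicWords (length X)) (sym (alive⇒periodicPrefix z X a))
      (∈-map⁺ (λ z → periodicPrefix z (length X)) (subst (λ k → z ∈ words s k) l (∈-words z)))

    rep : ℕ → Word s → Word s
    rep zero    Y = []
    rep (suc j) Y = Y ++ rep j Y

    rep-comm : ∀ j Y → rep j Y ++ Y ≡ Y ++ rep j Y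
    rep-comm zero Y = sym (++-identityʳ Y)
    rep-comm (suc j) Y = trans (++-assoc Y _ Y) (cong (Y ++_) (rep-comm j Y))

    length-rep : ∀ j Y → length (rep j Y) ≡ j * length Y
    length-rep zero Y = refl
    length-rep (suc j) Y = trans (length-++ Y) (cong (length Y +_) (length-rep j Y))

    -- Since the length of Y divides p, some power of Y has length p. Powers of Y commute with Y, so
    -- this power is a state to which reading Y returns.
    OK-rep : ∀ j Y → length Y ∣ p → OK (rep j Y)
    OK-rep j Y (divides t eq) = rep t Y , trans (length-rep t Y) (sym eq) , rep t Y , go j
      where
      nonempty : 1 ≤ length (rep t Y)
      nonempty = subst (1 ≤_) (trans eq (sym (length-rep t Y))) p≥1
      one : run (rep t Y) Y ≡ just (rep t Y)
      one = run-complete′ _ Y nonempty (rep-comm t Y)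
      go : ∀ j → run (rep t Y) (rep j Y) ≡ just (rep t Y)
      go zero = refl
      go (suc j) = trans (run-++-just (rep t Y) Y one) (go j)

-- Iterated morphisms

module _ {s : ℕ} (φ : Morphism s) where

  iterM-++ : ∀ n u v → iterM φ n (u ++ v) ≡ iterM φ n u ++ iterM φ n v
  iterM-++ zero u v = refl
  iterM-++ (suc n) u v = trans (cong (applyM φ) (iterM-++ n u v)) (concatMap-++ φ (iterM φ n u) _)

  iterM-[] : ∀ n → iterM φ n [] ≡ []
  iterM-[] zero = refl
  iterM-[] (suc n) = cong (applyM φ) (iterM-[] n)

  iterM-+ : ∀ m n u → iterM φ (m + n) u ≡ iterM φ m (iterM φ n u)
  iterM-+ zero n u = refl
  iterM-+ (suc m) n u = cong (applyM φ) (iterM-+ m n u)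

  iterM-suc : ∀ n u → iterM φ (suc n) u ≡ iterM φ n (applyM φ u)
  iterM-suc n u = trans (cong (λ k → iterM φ k u) (+-comm 1 n)) (iterM-+ n 1 u)

  iterM-letters : ∀ n u → iterM φ n u ≡ concatMap (λ c → iterM φ n (c ∷ [])) u
  iterM-letters n [] = iterM-[] n
  iterM-letters n (c ∷ u) = trans (iterM-++ n (c ∷ []) u) (cong (iterM φ n (c ∷ []) ++_) (iterM-letters n u))

  iterM-suc-letter : ∀ n c → iterM φ (suc n) (c ∷ []) ≡ concatMap (λ d → iterM φ n (d ∷ [])) (φ c)
  iterM-suc-letter n c = trans (iterM-suc n (c ∷ [])) (trans (cong (iterM φ n) (concatMap-[ φ ] c)) (iterM-letters n (φ c)))

  iterM-infix : ∀ n {u} a v b → u ≡ a ++ v ++ b → iterM φ n u ≡ iterM φ n a ++ iterM φ n v ++ iterM φ n b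
  iterM-infix n a v b refl = trans (iterM-++ n a (v ++ b)) (cong (iterM φ n a ++_) (iterM-++ n v b))

  power : ℕ → Morphism s
  power N c = iterM φ N (c ∷ [])

  applyM-power : ∀ N u → applyM (power N) u ≡ iterM φ N u
  applyM-power N u = sym (iterM-letters N u)

  length≤iterM : (∀ c → 1 ≤ length (φ c)) → ∀ n u → length u ≤ length (iterM φ n u)
  length≤iterM ne zero u = ≤-refl
  length≤iterM ne (suc n) u = ≤-trans (length≤iterM ne n u) (length≤concatMap φ ne (iterM φ n u))

iterM-power : ∀ {s} (φ : Morphism s) N m u → iterM (power φ N) m u ≡ iterM φ (m * N) u
iterM-power φ N zero u = refl
iterM-power φ N (suc m) u = trans (applyM-power φ N _) (trans (cong (iterM φ N) (iterM-power φ N m u)) (sym (iterM-+ φ N (m * N) u)))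

module Levels {s : ℕ} (φ : Morphism s) (W : ℕ → Fin s → Word s)
  (stepW : ∀ m c → W (suc m) c ≡ concatMap (W m) (φ c)) where

  W* : ℕ → Word s → Word s
  W* m = concatMap (W m)

  W*-suc : ∀ m u → W* (suc m) u ≡ W* m (applyM φ u)
  W*-suc m u = trans (concatMap-cong (stepW m) u) (sym (concatMap-concatMap (W m) φ u))

  W*-iter : ∀ i m u → W* (i + m) u ≡ W* m (iterM φ i u)
  W*-iter zero m u = refl
  W*-iter (suc i) m u = trans (cong (λ k → W* k u) (sym (+-suc i m))) (trans (W*-iter i (suc m) u) (W*-suc m (iterM φ i u)))

  W-iter : ∀ i m c → W (i + m) c ≡ W* m (iterM φ i (c ∷ []))
  W-iter i m c = trans (sym (concatMap-[ W (i + m) ] c)) (W*-iter i m (c ∷ []))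

-- `W m c` is what the letter c of level m spells in β. Keeping only its recurrence absorbs the
-- coding, the erased letters and the passage to powers of the morphism.
record Base {s : ℕ} (β : InfWord s) : Set where
  field
    φ     : Morphism s
    W     : ℕ → Fin s → Word s
    stepW : ∀ m c → W (suc m) c ≡ concatMap (W m) (φ c)
    φ≥1   : ∀ c → 1 ≤ length (φ c)
    W≥1   : ∀ m c → 1 ≤ length (W m c)
    a     : Fin s
    γ     : Word s
    φa    : φ a ≡ a ∷ γ
    γ≥1   : 1 ≤ length γ
    -- The letters occurring in φⁿ c are the same for all n ≥ 1.
    star⁻ : ∀ {c d} → d ∈ applyM φ (φ c) → d ∈ φ c
    star⁺ : ∀ {c d} → d ∈ φ c → d ∈ applyM φ (φ c)
    -- Every letter can be found in β in a controlled place: at the very start as a copy of a, or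
    -- inside γ and so behind a long prefix. The lower bound needs this room to the left.
    reach : ∀ c → (φ c ≡ φ a × (∀ m → W m c ≡ W m a)) ⊎ c ∈ γ
    pre   : ∀ m → PrefixOf (W m a) β
  open Levels φ W stepW public

  star-iter⁻ : ∀ n {c d} → d ∈ iterM φ (suc n) (c ∷ []) → d ∈ φ c
  star-iter⁻ zero {c} {d} m = subst (d ∈_) (concatMap-[ φ ] c) m
  star-iter⁻ (suc n) {c} {d} m with find (∈-concatMap⁻ φ m)
  ... | e , e∈ , d∈ = star⁻ (∈-concatMap⁺ φ (lose (star-iter⁻ n e∈) d∈))

  star-iter⁺ : ∀ n {c d} → d ∈ φ c → d ∈ iterM φ (suc n) (c ∷ [])
  star-iter⁺ zero {c} {d} m = subst (d ∈_) (sym (concatMap-[ φ ] c)) m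
  star-iter⁺ (suc n) {c} {d} m with find (∈-concatMap⁻ φ (star⁺ m))
  ... | e , e∈ , d∈ = ∈-concatMap⁺ φ (lose (star-iter⁺ n e∈) d∈)

  iter-a : ∀ n → ∃[ δ ] iterM φ (suc n) (a ∷ []) ≡ a ∷ γ ++ δ
  iter-a zero = [] , cong (_++ []) φa
  iter-a (suc n) with iter-a n
  ... | δ , eq = applyM φ (γ ++ δ) , trans (cong (applyM φ) eq) (cong (_++ applyM φ (γ ++ δ)) φa)

-- Passing to the levels h + mN turns properties that hold eventually, or at multiples of N, into
-- properties of all levels. The fields `star⁻` and `star⁺` survive because the letters of φⁿ c do
-- not depend on n ≥ 1.
renorm : ∀ {s} {β : InfWord s} → Base β → (n h : ℕ) → Base β
renorm {s} {β} S n h = record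
  { φ = power φ N ; W = W′ ; stepW = step′
  ; φ≥1 = λ c → length≤iterM φ φ≥1 N (c ∷ [])
  ; W≥1 = λ m → W≥1 (h + m * N)
  ; a = a ; γ = γ ++ proj₁ (iter-a n) ; φa = proj₂ (iter-a n)
  ; γ≥1 = ≤-trans γ≥1 (length-++-≤ˡ γ)
  ; star⁻ = λ {c} {d} m → star-iter⁺ n (star-iter⁻ (n + N) (subst (d ∈_) (eq₂ c) m))
  ; star⁺ = λ {c} {d} m → subst (d ∈_) (sym (eq₂ c)) (star-iter⁺ (n + N) (star-iter⁻ n m))
  ; reach = reach′
  ; pre = λ m → pre (h + m * N) }
  where
  open Base S
  N = suc n
  W′ : ℕ → Fin s → Word s
  W′ m = W (h + m * N)
  step′ : ∀ m c → W′ (suc m) c ≡ concatMap (W′ m) (power φ N c)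
  step′ m c = trans (cong (λ k → W k c) (trans (sym (+-assoc h N (m * N))) (trans (cong (_+ m * N) (+-comm h N)) (+-assoc N h (m * N)))))
    (W-iter N (h + m * N) c)
  eq₂ : ∀ c → applyM (power φ N) (power φ N c) ≡ iterM φ (N + N) (c ∷ [])
  eq₂ c = trans (applyM-power φ N _) (sym (iterM-+ φ N N (c ∷ [])))
  reach′ : ∀ c → (power φ N c ≡ power φ N a × (∀ m → W′ m c ≡ W′ m a)) ⊎ c ∈ γ ++ proj₁ (iter-a n)
  reach′ c with reach c
  ... | inj₂ c∈ = inj₂ (∈-++⁺ˡ c∈)
  ... | inj₁ (p , q) = inj₁ (trans (iterM-suc-letter φ n c) (trans (cong (concatMap (λ d → iterM φ n (d ∷ []))) p)
          (sym (iterM-suc-letter φ n a))) , λ m → q _)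

-- Bounded letters

-- Boundedness enters through closure properties of an abstract predicate, so that the very same `B`
-- serves after `renorm`; an inductive definition over φ would change with φ.
record BSys {s : ℕ} (β : InfWord s) : Set₁ where
  field
    base  : Base β
  open Base base public
  field
    B      : Fin s → Set
    B?     : Decidable B
    Bcl    : ∀ {c} → B c → All B (φ c)
    Bop    : ∀ {c} → All B (φ c) → B c
    Bfix   : ∀ {c} → φ c ≡ c ∷ [] → B c
    Bconst : ∀ {c} → B c → ∀ m → W m c ≡ W 0 c

  Bcl-iter : ∀ n {u} → All B u → All B (iterM φ n u)
  Bcl-iter zero p = p
  Bcl-iter (suc n) p = All.concat⁺ (All.map⁺ (All.map Bcl (Bcl-iter n p)))

  Bop-iter : ∀ n {u} → All B (iterM φ n u) → All B u
  Bop-iter zero p = p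
  Bop-iter (suc n) {u} p = Bop-iter n (All.map Bop (All.map⁻ (All.concat⁻ p)))

  W*-B : ∀ m {u} → All B u → W* m u ≡ W* 0 u
  W*-B m p = concatMap-cong-All (All.map (λ b → Bconst b m) p)

renormB : ∀ {s} {β : InfWord s} → BSys β → (n h : ℕ) → BSys β
renormB S n h = record
  { base = renorm base n h ; B = B ; B? = B?
  ; Bcl = λ b → Bcl-iter (suc n) (b ∷ [])
  ; Bop = λ {c} bs → All.head (Bop-iter (suc n) {c ∷ []} bs)
  ; Bfix = λ {c} e → Bfix (single c e)
  ; Bconst = λ b m → trans (Bconst b _) (sym (Bconst b _)) }
  where
  open BSys S
  -- φ never shortens words, so φ c is one letter; by `star-iter⁻` the letter c occurs in φ c, so it
  -- is that letter.
  single : ∀ c → power φ (suc n) c ≡ c ∷ [] → φ c ≡ c ∷ []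
  single c e with φ c | φ≥1 c | star-iter⁻ n {c} {c} (subst (c ∈_) (sym e) (here refl)) |
      subst (length (φ c) ≤_) (cong length (trans (trans (cong (iterM φ n) (sym (concatMap-[ φ ] c))) (sym (iterM-suc φ n (c ∷ [])))) e)) (length≤iterM φ φ≥1 n (φ c))
  ... | d ∷ [] | _ | here refl | _ = refl
  ... | d ∷ d′ ∷ ds | _ | _ | s≤s ()

-- Logarithms

1≤log : ∀ n → 1 ≤ ⌊log₂ suc (suc n) ⌋
1≤log n = ⌊log₂⌋-mono-≤ {2} {suc (suc n)} (s≤s (s≤s z≤n))

half-double : ∀ n → ⌊ n /2⌋ + ⌊ n /2⌋ ≤ n
half-double n = ≤-trans (+-monoʳ-≤ ⌊ n /2⌋ (⌊n/2⌋≤⌈n/2⌉ n)) (≤-reflexive (⌊n/2⌋+⌈n/2⌉≡n n))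

half-double< : ∀ n → n < suc ⌊ n /2⌋ + suc ⌊ n /2⌋
half-double< zero = s≤s z≤n
half-double< (suc zero) = s≤s (s≤s z≤n)
half-double< (suc (suc n)) = s≤s (subst (suc (suc n) ≤_) (sym (+-suc (suc ⌊ n /2⌋) (suc ⌊ n /2⌋))) (s≤s (half-double< n)))

double : ∀ x → x + x ≡ 2 * x
double x = cong (x +_) (sym (+-identityʳ x))

log-suc : ∀ n → ⌊log₂ suc (suc n) ⌋ ≡ suc ⌊log₂ ⌊ suc (suc n) /2⌋ ⌋
log-suc n with ⌊log₂ suc (suc n) ⌋ in eq | 1≤log n
... | suc l | s≤s _ = cong suc (sym (trans (⌊log₂⌊n/2⌋⌋≡⌊log₂n⌋∸1 (suc (suc n))) (cong (_∸ 1) eq)))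

n<2^suc-log : ∀ n → n < 2 ^ suc ⌊log₂ n ⌋
n<2^suc-log = <-rec (λ n → n < 2 ^ suc ⌊log₂ n ⌋) go
  where
  go : ∀ n → (∀ {m} → m < n → m < 2 ^ suc ⌊log₂ m ⌋) → n < 2 ^ suc ⌊log₂ n ⌋
  go zero _ = s≤s z≤n
  go (suc zero) _ = s≤s (s≤s z≤n)
  go n@(suc (suc n′)) rec = ≤-trans (half-double< n) (≤-trans (+-mono-≤ ih ih)
      (≤-reflexive (trans (double (2 ^ suc ⌊log₂ ⌊ n /2⌋ ⌋)) (cong (λ l → 2 * 2 ^ l) (sym (log-suc n′))))))
    where ih = rec (s≤s (s≤s (⌊n/2⌋≤n n′)))

2^log≤n : ∀ n → 1 ≤ n → 2 ^ ⌊log₂ n ⌋ ≤ n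
2^log≤n = <-rec (λ n → 1 ≤ n → 2 ^ ⌊log₂ n ⌋ ≤ n) go
  where
  go : ∀ n → (∀ {m} → m < n → 1 ≤ m → 2 ^ ⌊log₂ m ⌋ ≤ m) → 1 ≤ n → 2 ^ ⌊log₂ n ⌋ ≤ n
  go (suc zero) _ _ = s≤s z≤n
  go n@(suc (suc n′)) rec _ = ≤-trans (≤-reflexive (cong (2 ^_) (log-suc n′)))
      (≤-trans (≤-reflexive (sym (double (2 ^ ⌊log₂ ⌊ n /2⌋ ⌋)))) (≤-trans (+-mono-≤ ih ih) (half-double n)))
    where ih = rec (s≤s (s≤s (⌊n/2⌋≤n n′))) (s≤s z≤n)

-- Least sets of letters closed under a decidable rule

module Saturation {s : ℕ} (Q : Fin s → Set) (Rule : List (Fin s) → Fin s → Set)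
  (rule? : ∀ S c → Dec (Rule S c)) (sound : ∀ {S c} → All Q S → ¬ c ∈ S → Rule S c → Q c) where

  open import Data.List.Membership.DecPropositional (Fin._≟_ {s}) using (_∈?_)

  saturate : ∃[ S ] All Q S × (∀ c → ¬ c ∈ S → ¬ Rule S c)
  -- Fuel plus the number of collected letters stays above s, and there are at most s distinct
  -- letters, so the fuel is never exhausted.
  saturate = go (suc s) [] [] [] (≤-reflexive (sym (+-identityʳ (suc s))))
    where
    go : ∀ fuel S → Unique S → All Q S → s < fuel + length S → ∃[ S ] All Q S × (∀ c → ¬ c ∈ S → ¬ Rule S c)
    go zero S u q lt = ⊥-elim (<⇒≱ lt (≤-trans (unique⇒length≤ u (λ {x} _ → ∈-allFin x)) (≤-reflexive (length-tabulate {n = s} (λ i → i)))))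
    go (suc fuel) S u q lt with Fin.any? (λ c → ¬? (c ∈? S) ×-dec rule? S c)
    ... | no ¬p = S , q , λ c c∉ r → ¬p (c , c∉ , r)
    ... | yes (c , c∉ , r) = go fuel (c ∷ S) (All.tabulate (λ {x} m e → c∉ (subst (_∈ S) (sym e) m)) ∷ u) (sound q c∉ r ∷ q)
          (subst (s <_) (sym (+-suc fuel (length S))) lt)

module Bounded {s : ℕ} {β : InfWord s} (S₀ : Base β) where
  open Base S₀
  open import Data.List.Membership.DecPropositional (Fin._≟_ {s}) using (_∈?_)

  -- By `star⁻` a letter that recurs in one of its iterates already occurs in its own image. If it
  -- is bounded it must be its whole image, since φ erases nothing. Hence `fix` is the only seed
  -- required.
  data Bd : Fin s → Set where
    tree : ∀ {c} → All Bd (φ c) → Bd c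
    fix  : ∀ {c} → φ c ≡ c ∷ [] → Bd c

  Rule : List (Fin s) → Fin s → Set
  Rule S c = All (_∈ S) (φ c) ⊎ φ c ≡ c ∷ []

  sound : ∀ {S c} → All Bd S → ¬ c ∈ S → Rule S c → Bd c
  sound q _ (inj₁ ps) = tree (All.map (All.lookup q) ps)
  sound q _ (inj₂ e) = fix e

  open Saturation Bd Rule (λ S c → All.all? (_∈? S) (φ c) ⊎-dec ≡-dec Fin._≟_ (φ c) (c ∷ [])) sound

  Bd? : Decidable Bd
  Bd? c with c ∈? proj₁ saturate
  ... | yes m = yes (All.lookup (proj₁ (proj₂ saturate)) m)
  ... | no ¬m = no (λ b → ¬m (inS b))
    where
    complete : ∀ {c} → Rule (proj₁ saturate) c → c ∈ proj₁ saturate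
    complete {c} r with c ∈? proj₁ saturate
    ... | yes m = m
    ... | no ¬m = ⊥-elim (proj₂ (proj₂ saturate) c ¬m r)
    inS  : ∀ {c} → Bd c → c ∈ proj₁ saturate
    inS* : ∀ {u} → All Bd u → All (_∈ proj₁ saturate) u
    inS (tree ps) = complete (inj₁ (inS* ps))
    inS (fix e) = complete (inj₂ e)
    inS* [] = []
    inS* (p ∷ ps) = inS p ∷ inS* ps

  stab  : ∀ {c} → Bd c → ∃[ h ] ∀ m → h ≤ m → W m c ≡ W h c
  stab* : ∀ {u} → All Bd u → ∃[ h ] ∀ m → h ≤ m → W* m u ≡ W* h u
  stab {c} (tree ps) with stab* ps
  ... | h , p = suc h , λ { (suc m) (s≤s q) → trans (stepW m c) (trans (p m q) (sym (stepW h c))) }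
  stab {c} (fix e) = 0 , λ m _ → const m
    where
    const : ∀ m → W m c ≡ W 0 c
    const zero = refl
    const (suc m) = trans (stepW m c) (trans (cong (concatMap (W m)) e) (trans (concatMap-[ W m ] c) (const m)))
  stab* [] = 0 , λ _ _ → refl
  stab* (_∷_ {c} {u} p ps) with stab p | stab* ps
  ... | h , q | h′ , q′ = h ⊔ h′ , λ m l → cong₂ _++_
        (trans (q m (≤-trans (m≤m⊔n h h′) l)) (sym (q (h ⊔ h′) (m≤m⊔n h h′))))
        (trans (q′ m (≤-trans (m≤n⊔m h h′) l)) (sym (q′ (h ⊔ h′) (m≤n⊔m h h′))))

  stable : ∃[ h ] ∀ c → Bd c → ∀ m → h ≤ m → W m c ≡ W h c
  stable = uniformFin {P = λ c h → Bd c → ∀ m → h ≤ m → W m c ≡ W h c}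
    (λ l p b m q → trans (p b m (≤-trans l q)) (sym (p b _ l)))
    λ c → case Bd? c of λ { (yes b) → proj₁ (stab b) , λ _ → proj₂ (stab b) ; (no ¬b) → 0 , λ b → ⊥-elim (¬b b) }

  toBSys : BSys β
  toBSys = record
    { base = renorm S₀ 0 h ; B = Bd ; B? = Bd?
    ; Bcl = λ b → All.++⁺ (cl b) []
    ; Bop = λ {c} bs → tree (All.++⁻ˡ (φ c) bs)
    ; Bfix = λ {c} e → fix (trans (sym (++-identityʳ (φ c))) e)
    ; Bconst = λ {c} b m → trans (proj₂ stable c b _ (m≤m+n h _)) (cong (λ k → W k c) (sym (+-identityʳ h))) }
    where
    h = proj₁ stable
    cl : ∀ {c} → Bd c → All Bd (φ c)
    cl (tree ps) = ps
    cl (fix e) = subst (All Bd) (sym e) (fix e ∷ [])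

-- Letters of polynomial and of exponential growth

module Letters {s : ℕ} {β : InfWord s} (S₀ : Base β) where
  open Base S₀
  open import Data.List.Membership.DecPropositional (Fin._≟_ {s}) using (_∈?_)

  -- Cycles of letters have length one here, so polynomial growth means that a recurring letter
  -- occurs exactly once in its image, among letters already known to be polynomial.
  data PolyLetter : Fin s → Set where
    tree : ∀ {c} → All PolyLetter (φ c) → PolyLetter c
    loop : ∀ {c} u v → φ c ≡ u ++ c ∷ v → All PolyLetter u → All PolyLetter v → PolyLetter c

  outside : List (Fin s) → Word s → Word s
  outside S = filter (λ c → ¬? (c ∈? S))

  outside≡[] : ∀ S u → outside S u ≡ [] → All (_∈ S) u
  outside≡[] S [] e = []
  outside≡[] S (c ∷ u) e with c ∈? S
  ... | yes m = m ∷ outside≡[] S u e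

  outside≡[c] : ∀ S u {c} → outside S u ≡ c ∷ [] → ∃[ x ] ∃[ y ] u ≡ x ++ c ∷ y × All (_∈ S) x × All (_∈ S) y
  outside≡[c] S (d ∷ u) e with d ∈? S
  ... | no _ with refl , e′ ← ∷-injective e = [] , u , refl , [] , outside≡[] S u e′
  ... | yes m with x , y , refl , p , q ← outside≡[c] S u e = d ∷ x , y , refl , m ∷ p , q

  Rule : List (Fin s) → Fin s → Set
  Rule S c = outside S (φ c) ≡ [] ⊎ outside S (φ c) ≡ c ∷ []

  sound : ∀ {S c} → All PolyLetter S → ¬ c ∈ S → Rule S c → PolyLetter c
  sound {S} {c} q _ (inj₁ e) = tree (All.map (All.lookup q) (outside≡[] S (φ c) e))
  sound {S} {c} q _ (inj₂ e) with x , y , eq , p , r ← outside≡[c] S (φ c) e =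
    loop x y eq (All.map (All.lookup q) p) (All.map (All.lookup q) r)

  open Saturation PolyLetter Rule (λ S c → ≡-dec Fin._≟_ _ [] ⊎-dec ≡-dec Fin._≟_ _ (c ∷ [])) sound

  S = proj₁ saturate

  ν : Word s → ℕ
  ν u = length (outside S u)

  ν-++ : ∀ u v → ν (u ++ v) ≡ ν u + ν v
  ν-++ u v = trans (cong length (filter-++ (λ c → ¬? (c ∈? S)) u v)) (length-++ (outside S u))

  ν-infix : ∀ {u} x v y → u ≡ x ++ v ++ y → ν v ≤ ν u
  ν-infix x v y refl = ≤-trans (m≤m+n (ν v) (ν y)) (≤-trans (≤-reflexive (sym (ν-++ v y)))
    (≤-trans (m≤n+m _ (ν x)) (≤-reflexive (sym (ν-++ x (v ++ y))))))

  ν-φ : ∀ c → ¬ c ∈ S → 1 ≤ ν (φ c)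
  ν-φ c c∉ with outside S (φ c) in e
  ... | [] = ⊥-elim (proj₂ (proj₂ saturate) c c∉ (inj₁ e))
  ... | _ ∷ _ = s≤s z≤n

  ν-mono : ∀ u → ν u ≤ ν (applyM φ u)
  ν-mono [] = z≤n
  ν-mono (c ∷ u) with c ∈? S
  ... | yes _ = ≤-trans (ν-mono u) (≤-trans (m≤n+m _ (ν (φ c))) (≤-reflexive (sym (ν-++ (φ c) (applyM φ u)))))
  ... | no c∉ = ≤-trans (+-mono-≤ (ν-φ c c∉) (ν-mono u)) (≤-reflexive (sym (ν-++ (φ c) (applyM φ u))))

  ν-mono-iter : ∀ k u → ν u ≤ ν (iterM φ k u)
  ν-mono-iter zero u = ≤-refl
  ν-mono-iter (suc k) u = ≤-trans (ν-mono-iter k u) (ν-mono (iterM φ k u))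

  ν-mono-≤ : ∀ {i j} → i ≤ j → ∀ u → ν (iterM φ i u) ≤ ν (iterM φ j u)
  ν-mono-≤ {i} {j} i≤j u = ≤-trans (ν-mono-iter (j ∸ i) (iterM φ i u))
    (≤-reflexive (cong ν (trans (sym (iterM-+ φ (j ∸ i) i u)) (cong (λ k → iterM φ k u) (m∸n+n≡m i≤j)))))

  σ : Fin s → Fin s
  σ c with outside S (φ c)
  ... | [] = c
  ... | d ∷ _ = d

  σ-prop : ∀ c → ¬ c ∈ S → σ c ∈ outside S (φ c)
  σ-prop c c∉ with outside S (φ c) | ν-φ c c∉
  ... | d ∷ _ | _ = here refl

  σ^ : ℕ → Fin s → Fin s
  σ^ zero c = c
  σ^ (suc i) c = σ (σ^ i c)

  σ^-+ : ∀ i j c → σ^ (i + j) c ≡ σ^ i (σ^ j c)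
  σ^-+ zero j c = refl
  σ^-+ (suc i) j c = cong σ (σ^-+ i j c)

  σ^∉ : ∀ i c → ¬ c ∈ S → ¬ σ^ i c ∈ S
  σ^∉ zero c c∉ = c∉
  σ^∉ (suc i) c c∉ = proj₂ (∈-filter⁻ (λ c → ¬? (c ∈? S)) {xs = φ (σ^ i c)} (σ-prop (σ^ i c) (σ^∉ i c c∉)))

  σ^∈ : ∀ i c → ¬ c ∈ S → σ^ i c ∈ iterM φ i (c ∷ [])
  σ^∈ zero c c∉ = here refl
  σ^∈ (suc i) c c∉ = ∈-concatMap⁺ φ (lose (σ^∈ i c c∉)
    (proj₁ (∈-filter⁻ (λ c → ¬? (c ∈? S)) {xs = φ (σ^ i c)} (σ-prop (σ^ i c) (σ^∉ i c c∉)))))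

  -- Follow σ from c for s + 1 steps. If every image on the way had a single letter outside S, the
  -- path would repeat a letter e; then e occurs in φ e by `star-iter⁻` and is the only outside
  -- letter there, so the saturated set S would contain it.
  ν-doubles : ∀ c → ¬ c ∈ S → 2 ≤ ν (iterM φ (suc s) (c ∷ []))
  ν-doubles c c∉ with Fin.any? (λ (i : Fin (suc s)) → 2 ≤? ν (φ (σ^ (toℕ i) c)))
  ... | yes (i , p) with x , y , eq ← concatMap-∈ φ (σ^∈ (toℕ i) c c∉) =
    ≤-trans p (≤-trans (ν-infix x _ y eq) (ν-mono-≤ {suc (toℕ i)} {suc s} (Fin.toℕ<n i) (c ∷ [])))
  ... | no ¬p with Fin.pigeonhole (n<1+n s) (λ i → σ^ (toℕ i) c)
  ... | i , j , i<j , eq = ⊥-elim (proj₂ (proj₂ saturate) e e∉ (inj₂ single))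
    where
    e = σ^ (toℕ i) c
    e∉ = σ^∉ (toℕ i) c c∉
    k = toℕ j ∸ toℕ i
    σᵏe : σ^ k e ≡ e
    σᵏe = trans (sym (σ^-+ k (toℕ i) c)) (trans (cong (λ n → σ^ n c) (m∸n+n≡m (<⇒≤ i<j))) (sym eq))
    k≡ : ∃[ k′ ] k ≡ suc k′
    k≡ with k | m<n⇒0<n∸m i<j
    ... | suc k′ | _ = k′ , refl
    e∈ : e ∈ φ e
    e∈ = star-iter⁻ (proj₁ k≡) (subst₂ (λ x n → x ∈ iterM φ n (e ∷ [])) σᵏe (proj₂ k≡) (σ^∈ k e e∉))
    single : outside S (φ e) ≡ e ∷ []
    single with outside S (φ e) in eq′ | ∈-filter⁺ (λ c → ¬? (c ∈? S)) e∈ e∉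
    ... | d ∷ [] | here refl = refl
    ... | d ∷ d′ ∷ ds | _ = ⊥-elim (¬p (i , subst (λ z → 2 ≤ length z) (sym eq′) (s≤s (s≤s z≤n))))

  ν-doubles* : ∀ u → 2 * ν u ≤ ν (iterM φ (suc s) u)
  ν-doubles* [] = z≤n
  ν-doubles* (c ∷ u) with c ∈? S
  ... | yes _ = ≤-trans (ν-doubles* u) (ν-infix (iterM φ (suc s) (c ∷ [])) (iterM φ (suc s) u) []
                  (trans (iterM-++ φ (suc s) (c ∷ []) u) (cong (iterM φ (suc s) (c ∷ []) ++_) (sym (++-identityʳ _)))))
  ... | no c∉ = ≤-trans (≤-reflexive (*-suc 2 (ν u))) (≤-trans (+-mono-≤ (ν-doubles c c∉) (ν-doubles* u))
                  (≤-reflexive (sym (trans (cong ν (iterM-++ φ (suc s) (c ∷ []) u)) (ν-++ (iterM φ (suc s) (c ∷ [])) _)))))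

  ν-exp : ∀ t c → ¬ c ∈ S → 2 ^ t ≤ ν (iterM φ (t * suc s) (c ∷ []))
  ν-exp zero c c∉ with c ∈? S
  ... | yes m = ⊥-elim (c∉ m)
  ... | no _ = s≤s z≤n
  ν-exp (suc t) c c∉ = ≤-trans (*-monoʳ-≤ 2 (ν-exp t c c∉)) (≤-trans (ν-doubles* _)
    (≤-reflexive (cong ν (sym (iterM-+ φ (suc s) (t * suc s) (c ∷ []))))))

  ∣W∣ : Fin s → ℕ → ℕ
  ∣W∣ c m = length (W m c)

  ∣iter∣≤∣W∣ : ∀ m c → length (iterM φ m (c ∷ [])) ≤ ∣W∣ c m
  ∣iter∣≤∣W∣ m c = ≤-trans (length≤concatMap (W 0) (W≥1 0) (iterM φ m (c ∷ [])))
    (≤-reflexive (cong length (trans (sym (W-iter m 0 c)) (cong (λ k → W k c) (+-identityʳ m)))))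

  classify : ∀ c → PolyLetter c ⊎ Expo (∣W∣ c)
  classify c with c ∈? S
  ... | yes m = inj₁ (All.lookup (proj₁ (proj₂ saturate)) m)
  ... | no c∉ = inj₂ (suc s , λ n m p → ≤-trans (<⇒≤ (n<2^suc-log n)) (≤-trans (ν-exp (suc ⌊log₂ n ⌋) c c∉)
        (≤-trans (ν-mono-≤ (≤-trans (≤-reflexive (*-comm (suc ⌊log₂ n ⌋) (suc s))) p) (c ∷ []))
          (≤-trans (length-filter (λ c → ¬? (c ∈? S)) (iterM φ m (c ∷ []))) (∣iter∣≤∣W∣ m c)))))

  ∣W*∣ : Word s → ℕ → ℕ
  ∣W*∣ u m = length (W* m u)

  growth  : ∀ {c} → PolyLetter c → Growth (∣W∣ c)
  growth* : ∀ {u} → All PolyLetter u → Growth (∣W*∣ u)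
  growth {c} (tree ps) = Growth-shift (λ m → cong length (stepW m c)) (growth* ps)
  growth {c} (loop u v eq p q) = Growth-sum
      (λ m → trans (cong length (trans (stepW m c) (concatMap-infix (W m) u (c ∷ []) v eq)))
        (trans (length-++₃ (W* m u) (W* m (c ∷ [])) (W* m v)) (trans (cong (λ x → ∣W*∣ u m + (length x + ∣W*∣ v m)) (concatMap-[ W m ] c))
          (trans (cong (∣W*∣ u m +_) (+-comm (∣W∣ c m) _)) (sym (+-assoc (∣W*∣ u m) _ _))))))
      (Growth-+ (growth* p) (growth* q))
  growth* [] = zer (mkZero 0 0 (λ _ → z≤n) (λ _ _ → refl))
  growth* {c ∷ u} (p ∷ ps) = Growth-ext (λ m → sym (length-++ (W m c))) (Growth-+ (growth p) (growth* ps))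

  Growth-W : ∀ c → Growth (∣W∣ c)
  Growth-W c with classify c
  ... | inj₁ p = growth p
  ... | inj₂ e = exp e

  Growth-W* : ∀ u → Growth (∣W*∣ u)
  Growth-W* [] = growth* []
  Growth-W* (c ∷ u) = Growth-ext (λ m → sym (length-++ (W m c))) (Growth-+ (Growth-W c) (Growth-W* u))

-- Long runs of bounded letters are periodic

-- The part of the data that is invariant under reversing all words. The equation φ a = aγ is not,
-- so it is left out, and statements on suffixes follow from those on prefixes.
record Core (s : ℕ) : Set₁ where
  field
    φ      : Morphism s
    W      : ℕ → Fin s → Word s
    stepW  : ∀ m c → W (suc m) c ≡ concatMap (W m) (φ c)
    W≥1    : ∀ m c → 1 ≤ length (W m c)
    B      : Fin s → Set
    B?     : Decidable B
    Bcl    : ∀ {c} → B c → All B (φ c)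
    Bop    : ∀ {c} → All B (φ c) → B c
    Bconst : ∀ {c} → B c → ∀ m → W m c ≡ W 0 c

toCore : ∀ {s} {β : InfWord s} → BSys β → Core s
toCore S = record { BSys S }

All-reverse : ∀ {A : Set} {P : A → Set} u → All P u → All P (reverse u)
All-reverse u p = All.tabulate (λ m → All.lookup p (subst (_ ∈_) (reverse-involutive u) (Any.reverse⁺ m)))

reverseCore : ∀ {s} → Core s → Core s
reverseCore S = record
  { φ = λ c → reverse (φ c) ; W = λ m c → reverse (W m c)
  ; stepW = λ m c → trans (cong reverse (stepW m c)) (reverse-concatMap (W m) (φ c))
  ; W≥1 = λ m c → subst (1 ≤_) (sym (length-reverse (W m c))) (W≥1 m c)
  ; B = B ; B? = B?
  ; Bcl = λ {c} b → All-reverse (φ c) (Bcl b)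
  ; Bop = λ {c} bs → Bop (subst (All B) (reverse-involutive (φ c)) (All-reverse (reverse (φ c)) bs))
  ; Bconst = λ b m → cong reverse (Bconst b m) }
  where open Core S

iterM-reverse : ∀ {s} (φ : Morphism s) n u → iterM (reverse ∘ φ) n (reverse u) ≡ reverse (iterM φ n u)
iterM-reverse φ zero u = refl
iterM-reverse φ (suc n) u = trans (cong (applyM (reverse ∘ φ)) (iterM-reverse φ n u)) (sym (reverse-concatMap φ (iterM φ n u)))

funToFin-cong : ∀ {m n} (f g : Fin m → Fin n) → (∀ i → f i ≡ g i) → funToFin f ≡ funToFin g
funToFin-cong {zero} _ _ e = refl
funToFin-cong {suc m} f g e = cong₂ combine (e Fin.zero) (funToFin-cong (f ∘ Fin.suc) (g ∘ Fin.suc) (e ∘ Fin.suc))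

funToFin-injective : ∀ {m n} (f g : Fin m → Fin n) → funToFin f ≡ funToFin g → ∀ i → f i ≡ g i
funToFin-injective f g e i = trans (sym (Fin.finToFun-funToFin f i)) (trans (cong (λ k → finToFun k i) e) (Fin.finToFun-funToFin g i))

module Prefixes {s : ℕ} (S : Core s) where
  open Core S
  open Levels φ W stepW

  W*-B : ∀ m {u} → All B u → W* m u ≡ W* 0 u
  W*-B m p = concatMap-cong-All (All.map (λ b → Bconst b m) p)

  Bop-iter : ∀ n {u} → All B (iterM φ n u) → All B u
  Bop-iter zero p = p
  Bop-iter (suc n) {u} p = Bop-iter n (All.map Bop (All.map⁻ (All.concat⁻ p)))

  record FirstUnbounded (c : Fin s) : Set where
    constructor mkFU
    field
      q    : Word s
      next : Fin s
      prop : ¬ B c → ∃[ y ] φ c ≡ q ++ next ∷ y × All B q × ¬ B next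

  firstUnbounded : ∀ c → FirstUnbounded c
  firstUnbounded c with firstNot B? (φ c)
  -- Arbitrary values for a bounded letter; `prop` concerns unbounded letters only.
  ... | inj₁ bs = mkFU [] c (λ ¬b → ⊥-elim (¬b (Bop bs)))
  ... | inj₂ (q , d , y , e , bs , ¬b) = mkFU q d (λ _ → y , e , bs , ¬b)

  q : Fin s → Word s
  q c = FirstUnbounded.q (firstUnbounded c)
  lam : Fin s → Fin s
  lam c = FirstUnbounded.next (firstUnbounded c)
  lam-prop : ∀ c → ¬ B c → ∃[ y ] φ c ≡ q c ++ lam c ∷ y × All B (q c) × ¬ B (lam c)
  lam-prop c = FirstUnbounded.prop (firstUnbounded c)

  lam^ : ℕ → Fin s → Fin s
  lam^ zero c = c
  lam^ (suc i) c = lam (lam^ i c)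

  lam^-suc : ∀ i c → lam^ (suc i) c ≡ lam^ i (lam c)
  lam^-suc zero c = refl
  lam^-suc (suc i) c = cong lam (lam^-suc i c)

  lam^-+ : ∀ i j c → lam^ (i + j) c ≡ lam^ i (lam^ j c)
  lam^-+ zero j c = refl
  lam^-+ (suc i) j c = cong lam (lam^-+ i j c)

  -- What the maximal bounded prefix of φᴰ c spells when c is unbounded: φᴰ c begins with an iterate
  -- of q c, which is bounded and spells the same as q c, and goes on with an iterate of the first
  -- unbounded letter lam c.
  Y : ℕ → Fin s → Word s
  Y zero c = []
  Y (suc D) c = W* 0 (q c) ++ Y D (lam c)

  Y-+ : ∀ i j c → Y (i + j) c ≡ Y i c ++ Y j (lam^ i c)
  Y-+ zero j c = refl
  Y-+ (suc i) j c = trans (cong (W* 0 (q c) ++_) (trans (Y-+ i j (lam c)) (cong (λ d → Y i (lam c) ++ Y j d) (sym (lam^-suc i c)))))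
    (sym (++-assoc (W* 0 (q c)) _ _))

  boundedPrefix : ∀ D c v {y} → ¬ B c → iterM φ D (c ∷ []) ≡ v ++ y → All B v → ∃[ r ] Y D c ≡ W* 0 v ++ r
  boundedPrefix zero c [] ¬b e bs = [] , refl
  boundedPrefix zero c (d ∷ v) ¬b e (b ∷ _) = ⊥-elim (¬b (subst B (sym (proj₁ (∷-injective e))) b))
  boundedPrefix (suc D) c v {y} ¬b e bs with lam-prop c ¬b
  ... | y₀ , φc , qB , ¬b′ with split-++ (iterM φ D (q c)) v (trans (sym eq) e)
    where
    eq : iterM φ (suc D) (c ∷ []) ≡ iterM φ D (q c) ++ iterM φ D (lam c ∷ []) ++ iterM φ D y₀
    eq = trans (iterM-suc φ D (c ∷ [])) (trans (cong (iterM φ D) (trans (concatMap-[ φ ] c) φc)) (iterM-infix φ D (q c) (lam c ∷ []) y₀ refl))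
  ... | inj₂ (k , e₁ , _) = W* 0 k ++ Y D (lam c) , trans (cong (_++ Y D (lam c)) W0q) (++-assoc (W* 0 v) _ _)
    where
    W0q : W* 0 (q c) ≡ W* 0 v ++ W* 0 k
    W0q = trans (sym (W*-B (D + 0) qB)) (trans (W*-iter D 0 (q c)) (trans (cong (W* 0) e₁) (concatMap-++ (W 0) v k)))
  ... | inj₁ (k , refl , e₂) with split-++ (iterM φ D (lam c ∷ [])) k e₂
  ...   | inj₁ (k′ , refl , _) = ⊥-elim (¬b′ (All.head (Bop-iter D {lam c ∷ []} (All.++⁻ˡ (iterM φ D (lam c ∷ [])) (All.++⁻ʳ (iterM φ D (q c)) bs)))))
  ...   | inj₂ (k′ , e₃ , _) with boundedPrefix D (lam c) k ¬b′ e₃ (All.++⁻ʳ (iterM φ D (q c)) bs)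
  ...     | r , e₄ = r , trans (cong₂ _++_ (trans (sym (W*-B (D + 0) qB)) (W*-iter D 0 (q c))) e₄)
                (trans (sym (++-assoc (W* 0 (iterM φ D (q c))) (W* 0 k) r)) (cong (_++ r) (sym (concatMap-++ (W 0) (iterM φ D (q c)) k))))

  lamIndex : ∃[ N ] 1 ≤ N × ∀ j → funToFin (lam^ (suc j * N)) ≡ funToFin (lam^ N)
  lamIndex = idempotentIndex (λ m → funToFin (lam^ m)) (λ i j e → funToFin-cong (lam^ (suc i)) (lam^ (suc j)) (λ c → cong lam (funToFin-injective (lam^ i) (lam^ j) e c)))

  N = proj₁ lamIndex

  Y-bound : ∃[ H ] ∀ c → length (Y N c) ≤ H × length (W 0 c) ≤ H
  Y-bound = uniformFin {P = λ c H → length (Y N c) ≤ H × length (W 0 c) ≤ H}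
    (λ l (p , q) → ≤-trans p l , ≤-trans q l) (λ c → length (Y N c) ⊔ length (W 0 c) , m≤m⊔n _ _ , m≤n⊔m (length (Y N c)) _)

  Hb = proj₁ Y-bound

  lam-fixed : ∀ c → lam^ N (lam^ N c) ≡ lam^ N c
  lam-fixed c = trans (sym (lam^-+ N N c)) (trans (cong (λ k → lam^ (N + k) c) (sym (+-identityʳ N))) (funToFin-injective (lam^ (2 * N)) (lam^ N) (proj₂ (proj₂ lamIndex) 1) c))

  module _ (p : ℕ) (p≥1 : 1 ≤ p) (div : ∀ d → 1 ≤ d → d ≤ Hb → d ∣ p) where
    open Period {s} p p≥1

    Y-rep : ∀ j c → Y (j * N) (lam^ N c) ≡ rep j (Y N (lam^ N c))
    Y-rep zero c = refl
    Y-rep (suc j) c = trans (Y-+ N (j * N) (lam^ N c)) (cong (Y N (lam^ N c) ++_) (trans (cong (Y (j * N)) (lam-fixed c)) (Y-rep j c)))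

    OK-[] : Fin s → OK []
    OK-[] c = replicate p c , length-replicate p , _ , refl

    rep-[] : ∀ j → rep j [] ≡ []
    rep-[] zero = refl
    rep-[] (suc j) = rep-[] j

    OK-repY : ∀ j c → OK (rep j (Y N c))
    OK-repY j c with Y N c | proj₁ (proj₂ Y-bound c)
    ... | [] | _ = subst OK (sym (rep-[] j)) (OK-[] c)
    ... | x ∷ X | l = OK-rep j (x ∷ X) (div _ (s≤s z≤n) l)

    -- After N steps the first unbounded letter is fixed by lam^N, so Y is a preperiod of at most Hb
    -- letters followed by powers of a word whose length divides p. The first Hb + 1 letters of v
    -- spell more than the preperiod. If c is bounded, v itself is short.
    prefixPeriodic : ∀ c D v {y} → iterM φ D (c ∷ []) ≡ v ++ y → All B v →
      ∃[ h ] ∃[ g ] v ≡ h ++ g × length h ≤ suc Hb × OK (W* 0 g)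
    prefixPeriodic c D v {y} e bs with length v ≤? suc Hb | B? c
    ... | yes l | _ = v , [] , sym (++-identityʳ v) , l , OK-[] c
    ... | no ¬l | yes b = ⊥-elim (¬l (≤-trans (length-++-≤ˡ v) (≤-trans (≤-reflexive (cong length (sym e)))
        (≤-trans (length≤concatMap (W 0) (W≥1 0) (iterM φ D (c ∷ [])))
        (≤-trans (≤-reflexive (cong length (trans (sym (W-iter D 0 c)) (Bconst b (D + 0)))))
        (≤-trans (proj₂ (proj₂ Y-bound c)) (n≤1+n Hb)))))))
    ... | no ¬l | no ¬b with boundedPrefix D c v ¬b e bs
    ... | r , eY = h , g , sym (take++drop≡id (suc Hb) v) , ≤-reflexive lh , okg
      where
      h = take (suc Hb) v
      g = drop (suc Hb) v
      lh : length h ≡ suc Hb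
      lh = trans (length-take (suc Hb) v) (m≤n⇒m⊓n≡m (<⇒≤ (≰⇒> ¬l)))
      c₁ = lam^ N c
      -- Y D c is extended to the index N + D·N, at which it splits exactly into the preperiod and
      -- whole powers.
      D≤ : D ≤ N + D * N
      D≤ = ≤-trans (≤-trans (≤-reflexive (sym (*-identityʳ D))) (*-monoʳ-≤ D (proj₁ (proj₂ lamIndex)))) (m≤n+m (D * N) N)
      rest = Y (N + D * N ∸ D) (lam^ D c)
      eq : W* 0 h ++ (W* 0 g ++ (r ++ rest)) ≡ Y N c ++ rep D (Y N c₁)
      eq = begin
        W* 0 h ++ (W* 0 g ++ (r ++ rest))   ≡⟨ sym (++-assoc (W* 0 h) (W* 0 g) _) ⟩
        (W* 0 h ++ W* 0 g) ++ (r ++ rest)   ≡⟨ cong (_++ (r ++ rest)) (trans (sym (concatMap-++ (W 0) h g)) (cong (W* 0) (take++drop≡id (suc Hb) v))) ⟩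
        W* 0 v ++ (r ++ rest)               ≡⟨ ++-assoc (W* 0 v) r rest ⟨
        (W* 0 v ++ r) ++ rest               ≡⟨ cong (_++ rest) eY ⟨
        Y D c ++ rest                       ≡⟨ Y-+ D _ c ⟨
        Y (D + (N + D * N ∸ D)) c           ≡⟨ cong (λ k → Y k c) (m+[n∸m]≡n D≤) ⟩
        Y (N + D * N) c                     ≡⟨ Y-+ N (D * N) c ⟩
        Y N c ++ Y (D * N) c₁               ≡⟨ cong (Y N c ++_) (Y-rep D c) ⟩
        Y N c ++ rep D (Y N c₁)             ∎
        where open ≡-Reasoning
      okg : OK (W* 0 g)
      okg with split-++ (W* 0 h) (Y N c) eq
      ... | inj₁ (k , e₁ , _) = ⊥-elim (<⇒≱ (≤-trans (s≤s (proj₁ (proj₂ Y-bound c))) (≤-trans (≤-reflexive (sym lh)) (length≤concatMap (W 0) (W≥1 0) h)))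
                (≤-trans (length-++-≤ˡ (W* 0 h)) (≤-reflexive (cong length (sym e₁)))))
      ... | inj₂ (k , _ , e₂) = OK-infix _ k (W* 0 g) e₂ (OK-repY D c₁)

record PSys {s : ℕ} (β : InfWord s) : Set₁ where
  field
    bsys : BSys β
    p    : ℕ
    p≥1  : 1 ≤ p
    H    : ℕ
  open BSys bsys public
  open Period {s} p p≥1 public
  field
    PPr : ∀ c D v {y} → iterM φ D (c ∷ []) ≡ v ++ y → All B v →
      ∃[ h ] ∃[ g ] v ≡ h ++ g × length h ≤ H × OK (W* 0 g)
    PPl : ∀ c D v {x} → iterM φ D (c ∷ []) ≡ x ++ v → All B v →
      ∃[ g ] ∃[ h ] v ≡ g ++ h × length h ≤ H × OK (W* 0 g)

toPSys : ∀ {s} {β : InfWord s} → BSys β → PSys β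
toPSys {s} {β} S = record { bsys = S ; p = p ; p≥1 = p≥1 ; H = suc (R.Hb ⊔ L.Hb) ; PPr = ppr ; PPl = ppl }
  where
  open BSys S
  module R = Prefixes (toCore S)
  module L = Prefixes (reverseCore (toCore S))
  p = (R.Hb ⊔ L.Hb) !
  p≥1 : 1 ≤ p
  p≥1 = 1≤n! (R.Hb ⊔ L.Hb)
  open Period {s} p p≥1
  div : ∀ d → 1 ≤ d → d ≤ R.Hb ⊔ L.Hb → d ∣ p
  div (suc d) _ l = ∣-trans (m∣m*n (d !)) (m≤n⇒m!∣n! l)
  ppr : ∀ c D v {y} → iterM φ D (c ∷ []) ≡ v ++ y → All B v →
      ∃[ h ] ∃[ g ] v ≡ h ++ g × length h ≤ suc (R.Hb ⊔ L.Hb) × OK (W* 0 g)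
  ppr c D v e bs with R.prefixPeriodic p p≥1 (λ d l m → div d l (≤-trans m (m≤m⊔n R.Hb L.Hb))) c D v e bs
  ... | h , g , e′ , l , o = h , g , e′ , ≤-trans l (s≤s (m≤m⊔n R.Hb L.Hb)) , o
  ppl : ∀ c D v {x} → iterM φ D (c ∷ []) ≡ x ++ v → All B v →
      ∃[ g ] ∃[ h ] v ≡ g ++ h × length h ≤ suc (R.Hb ⊔ L.Hb) × OK (W* 0 g)
  ppl c D v {x} e bs with L.prefixPeriodic p p≥1 (λ d l m → div d l (≤-trans m (m≤n⊔m R.Hb L.Hb))) c D (reverse v)
      (trans (iterM-reverse φ D (c ∷ [])) (trans (cong reverse e) (reverse-++ x v))) (All-reverse v bs)
  ... | h , g , e′ , l , o = reverse g , reverse h , trans (sym (reverse-involutive v)) (trans (cong reverse e′) (reverse-++ h g)) ,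
        subst (_≤ suc (R.Hb ⊔ L.Hb)) (sym (length-reverse h)) (≤-trans l (s≤s (m≤n⊔m R.Hb L.Hb))) ,
        subst OK (trans (reverse-concatMap (reverse ∘ W 0) g) (concatMap-cong (λ c → reverse-involutive (W 0 c)) (reverse g))) (OK-reverse (concatMap (reverse ∘ W 0) g) o)

renormP : ∀ {s} {β : InfWord s} → PSys β → (n h : ℕ) → PSys β
renormP {s} {β} S n h = record
  { bsys = renormB bsys n h ; p = p ; p≥1 = p≥1 ; H = H
  ; PPr = λ c D v e bs → ppr c D v e bs
  ; PPl = λ c D v e bs → ppl c D v e bs }
  where
  open PSys S
  module S′ = BSys (renormB bsys n h)
  ppr : ∀ c D v {y} → iterM S′.φ D (c ∷ []) ≡ v ++ y → All B v →
      ∃[ h ] ∃[ g ] v ≡ h ++ g × length h ≤ H × OK (S′.W* 0 g)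
  ppr c D v e bs with PPr c (D * suc n) v (trans (sym (iterM-power φ (suc n) D (c ∷ []))) e) bs
  ... | h₁ , g , refl , l , o = h₁ , g , refl , l , subst OK (sym (W*-B (h + 0) (All.++⁻ʳ h₁ bs))) o
  ppl : ∀ c D v {x} → iterM S′.φ D (c ∷ []) ≡ x ++ v → All B v →
      ∃[ g ] ∃[ h ] v ≡ g ++ h × length h ≤ H × OK (S′.W* 0 g)
  ppl c D v e bs with PPl c (D * suc n) v (trans (sym (iterM-power φ (suc n) D (c ∷ []))) e) bs
  ... | g , h₁ , refl , l , o = g , h₁ , refl , l , subst OK (sym (W*-B (h + 0) (All.++⁻ˡ g bs))) o

-- Reading behaviour independent of the level

words-length : ∀ s n {w} → w ∈ words s n → length w ≡ n
words-length s zero (here refl) = refl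
words-length s (suc n) m with find (∈-concatMap⁻ (λ c → map (c ∷_) (words s n)) {xs = allFin s} m)
... | c , _ , m′ with ∈-map⁻ (c ∷_) m′
... | w , m″ , refl = cong suc (words-length s n m″)

module Encode {s : ℕ} (p : ℕ) where

  zs = words s p
  q = length zs

  state : Fin q → Word s
  state = lookup zs

  state-length : ∀ i → length (state i) ≡ p
  state-length i = words-length s p (∈-lookup {xs = zs} i)

  member : ∀ z → length z ≡ p → z ∈ zs
  member z l = subst (λ k → z ∈ words s k) l (∈-words z)

  state-index : ∀ z (l : length z ≡ p) → state (Any.index (member z l)) ≡ z
  state-index z l = sym (Any.lookup-index (member z l))

  enc : Maybe (Word s) → Fin (suc q)
  enc nothing = Fin.zero
  enc (just z) with length z ≟ p
  ... | yes l = Fin.suc (Any.index (member z l))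
  ... | no _ = Fin.zero

  Good : Maybe (Word s) → Set
  Good r = ∀ z → r ≡ just z → length z ≡ p

  enc-injective : ∀ r r′ → Good r → Good r′ → enc r ≡ enc r′ → r ≡ r′
  enc-injective nothing nothing _ _ _ = refl
  enc-injective nothing (just z) _ g e with length z ≟ p
  ... | no ¬l = ⊥-elim (¬l (g z refl))
  enc-injective (just z) nothing g _ e with length z ≟ p
  ... | no ¬l = ⊥-elim (¬l (g z refl))
  enc-injective (just z) (just z′) g g′ e with length z ≟ p | length z′ ≟ p
  ... | no ¬l | _ = ⊥-elim (¬l (g z refl))
  ... | yes _ | no ¬l = ⊥-elim (¬l (g′ z′ refl))
  ... | yes l | yes l′ = cong just (trans (sym (state-index z l)) (trans (cong state (Fin.suc-injective e)) (state-index z′ l′)))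

  -- A whole transition function as one element of a finite set, so that the sequence of levels
  -- falls under `idempotentIndex`.
  table : ∀ {n K} → (Fin n → Word s → Fin K) → Fin ((K ^ q) ^ n)
  table f = funToFin (λ c → funToFin (λ i → f c (state i)))

  table-cong : ∀ {n K} (f g : Fin n → Word s → Fin K) → (∀ c z → length z ≡ p → f c z ≡ g c z) → table f ≡ table g
  table-cong f g e = funToFin-cong _ _ (λ c → funToFin-cong _ _ (λ i → e c (state i) (state-length i)))

  table-injective : ∀ {n K} (f g : Fin n → Word s → Fin K) → table f ≡ table g → ∀ c z → length z ≡ p → f c z ≡ g c z
  table-injective f g e c z l = subst (λ z → f c z ≡ g c z) (state-index z l)
    (funToFin-injective (λ i → f c (state i)) (λ i → g c (state i))
      (funToFin-injective (λ c → funToFin (λ i → f c (state i))) (λ c → funToFin (λ i → g c (state i))) e c) _)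

Link : ∀ {s} → (Fin s → Word s) → Morphism s → Word s → Fin s → Word s → Fin s → Set
Link V f z c z′ c′ = ∃[ v ] ∃[ y ] f c ≡ v ++ c′ ∷ y × run z (concatMap V v) ≡ just z′ × Dead z′ (V c′)

-- Link leads to the first letter of f c at which reading breaks off.  Once this map on pairs
-- (state, letter) is idempotent, the length read grows by |W m v| from each level to the next.
FixedLink : ∀ {s} → ℕ → (Fin s → Word s) → Morphism s → Set
FixedLink p V f = ∀ z c → length z ≡ p → Dead z (V c) →
  ∃[ z′ ] ∃[ c′ ] length z′ ≡ p × Link V f z c z′ c′ × Link V f z′ c′ z′ c′

module Reading {s : ℕ} (p : ℕ) (φ : Morphism s) (W : ℕ → Fin s → Word s)
  (stepW : ∀ m c → W (suc m) c ≡ concatMap (W m) (φ c)) where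
  open Encode {s} p
  open Levels φ W stepW

  SameRun : ℕ → ℕ → Set
  SameRun m m′ = ∀ c z → length z ≡ p → run z (W m c) ≡ run z (W m′ c)

  sig : ∀ m → Fin ((suc q ^ q) ^ s)
  sig m = table (λ c z → enc (run z (W m c)))

  sig-same : ∀ m m′ → sig m ≡ sig m′ → SameRun m m′
  sig-same m m′ e c z l = enc-injective (run z (W m c)) (run z (W m′ c))
    (λ z′ e′ → trans (run-length z (W m c) e′) l) (λ z′ e′ → trans (run-length z (W m′ c) e′) l)
    (table-injective (λ c z → enc (run z (W m c))) (λ c z → enc (run z (W m′ c))) e c z l)

  same* : ∀ m m′ → SameRun m m′ → ∀ u z → length z ≡ p → run z (W* m u) ≡ run z (W* m′ u)
  same* m m′ h [] z l = refl
  same* m m′ h (c ∷ u) z l with alive? z (W m c)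
  ... | inj₁ (z′ , e) = trans (run-++-just z (W m c) e) (trans (same* m m′ h u z′ (trans (run-length z (W m c) e) l))
          (sym (run-++-just z (W m′ c) (trans (sym (h c z l)) e))))
  ... | inj₂ d = trans (run-++-nothing z (W m c) d) (sym (run-++-nothing z (W m′ c) (trans (sym (h c z l)) d)))

  -- The transitions of level m + 1 are those of level m composed along φ c, by a rule that does not
  -- involve m.
  sig-det : ∀ m m′ → sig m ≡ sig m′ → sig (suc m) ≡ sig (suc m′)
  sig-det m m′ e = table-cong (λ c z → enc (run z (W (suc m) c))) (λ c z → enc (run z (W (suc m′) c)))
    (λ c z l → cong enc (trans (cong (run z) (stepW m c)) (trans (same* m m′ (sig-same m m′ e) (φ c) z l) (cong (run z) (sym (stepW m′ c))))))

  module Next (const : ∀ m → SameRun m 0) where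

    const* : ∀ m u z → length z ≡ p → run z (W* m u) ≡ run z (W* 0 u)
    const* m = same* m 0 (const m)

    scan : ∀ z u → Alive z (W* 0 u) ⊎
      ∃[ v ] ∃[ c ] ∃[ y ] ∃[ z′ ] u ≡ v ++ c ∷ y × run z (W* 0 v) ≡ just z′ × Dead z′ (W 0 c)
    scan z [] = inj₁ (z , refl)
    scan z (c ∷ u) with alive? z (W 0 c)
    ... | inj₂ d = inj₂ ([] , c , u , z , refl , refl , d)
    ... | inj₁ (z₁ , e) with scan z₁ u
    ... | inj₁ (z₂ , e₂) = inj₁ (z₂ , trans (run-++-just z (W 0 c) e) e₂)
    ... | inj₂ (v , d , y , z′ , refl , e₂ , dd) = inj₂ (c ∷ v , d , y , z′ , refl , trans (run-++-just z (W 0 c) e) e₂ , dd)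

    scanDead : ∀ z c → length z ≡ p → Dead z (W 0 c) → ∃[ z′ ] ∃[ c′ ] Link (W 0) φ z c z′ c′
    scanDead z c l d with scan z (φ c)
    ... | inj₁ a = ⊥-elim (alive≢dead z (W* 0 (φ c)) a (trans (cong (run z) (sym (stepW 0 c))) (trans (const 1 c z l) d)))
    ... | inj₂ (v , c′ , y , z′ , e , r , dd) = z′ , c′ , v , y , e , r , dd

    nx : Word s × Fin s → Word s × Fin s
    nx (z , c) with length z ≟ p | alive? z (W 0 c)
    ... | yes l | inj₂ d = let z′ , c′ , _ = scanDead z c l d in z′ , c′
    -- A default that makes the map total; `nx-link` speaks only of readings that break off.
    ... | _     | _      = z , c

    nx-link : ∀ z c → length z ≡ p → Dead z (W 0 c) → Link (W 0) φ z c (proj₁ (nx (z , c))) (proj₂ (nx (z , c)))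
    nx-link z c l d with length z ≟ p | alive? z (W 0 c)
    ... | yes l′ | inj₂ d′ = proj₂ (proj₂ (scanDead z c l′ d′))
    ... | yes _  | inj₁ a = ⊥-elim (alive≢dead z (W 0 c) a d)
    ... | no ¬l  | _ = ⊥-elim (¬l l)

    nx-length : ∀ x → length (proj₁ x) ≡ p → length (proj₁ (nx x)) ≡ p
    nx-length (z , c) l with length z ≟ p | alive? z (W 0 c)
    ... | yes l′ | inj₂ d with scanDead z c l′ d
    ...   | z′ , c′ , v , y , e , r , _ = trans (run-length z (W* 0 v) r) l
    nx-length (z , c) l | yes _ | inj₁ _ = l
    nx-length (z , c) l | no _  | _ = l

    nx^ : ℕ → Word s × Fin s → Word s × Fin s
    nx^ zero x = x
    nx^ (suc m) x = nx (nx^ m x)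

    nx^-+ : ∀ i j x → nx^ (i + j) x ≡ nx^ i (nx^ j x)
    nx^-+ zero j x = refl
    nx^-+ (suc i) j x = cong nx (nx^-+ i j x)

    nx^-length : ∀ m x → length (proj₁ x) ≡ p → length (proj₁ (nx^ m x)) ≡ p
    nx^-length zero x l = l
    nx^-length (suc m) x l = nx-length (nx^ m x) (nx^-length m x l)

    encPair : Word s × Fin s → Fin (suc q * s)
    encPair (z , c) = combine (enc (just z)) c

    encPair-injective : ∀ x y → length (proj₁ x) ≡ p → length (proj₁ y) ≡ p → encPair x ≡ encPair y → x ≡ y
    encPair-injective (z , c) (z′ , c′) l l′ e with Fin.combine-injective (enc (just z)) c (enc (just z′)) c′ e
    ... | e₁ , refl with enc-injective (just z) (just z′) (λ { _ refl → l }) (λ { _ refl → l′ }) e₁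
    ... | refl = refl

    nsig : ∀ m → Fin (((suc q * s) ^ q) ^ s)
    nsig m = table (λ c z → encPair (nx^ m (z , c)))

    nsig-same : ∀ m m′ → nsig m ≡ nsig m′ → ∀ c z → length z ≡ p → nx^ m (z , c) ≡ nx^ m′ (z , c)
    nsig-same m m′ e c z l = encPair-injective _ _ (nx^-length m (z , c) l) (nx^-length m′ (z , c) l)
      (table-injective (λ c z → encPair (nx^ m (z , c))) (λ c z → encPair (nx^ m′ (z , c))) e c z l)

    nsig-det : ∀ m m′ → nsig m ≡ nsig m′ → nsig (suc m) ≡ nsig (suc m′)
    nsig-det m m′ e = table-cong (λ c z → encPair (nx^ (suc m) (z , c))) (λ c z → encPair (nx^ (suc m′) (z , c)))
      (λ c z l → cong (encPair ∘ nx) (nsig-same m m′ e c z l))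

    nx^-link : ∀ m z c → length z ≡ p → Dead z (W 0 c) →
      Link (W 0) (power φ m) z c (proj₁ (nx^ m (z , c))) (proj₂ (nx^ m (z , c)))
    nx^-link zero z c l d = [] , [] , refl , refl , d
    nx^-link (suc m) z c l d with nx^ m (z , c) | nx^-link m z c l d | nx^-length m (z , c) l
    ... | z₁ , c₁ | v , y , e , r , d₁ | l₁ with nx-link z₁ c₁ l₁ d₁
    ... | v′ , y′ , e′ , r′ , d′ = applyM φ v ++ v′ , y′ ++ applyM φ y , eq , rr , d′
      where
      eq : applyM φ (iterM φ m (c ∷ [])) ≡ (applyM φ v ++ v′) ++ _ ∷ y′ ++ applyM φ y
      eq = trans (cong (applyM φ) e) (trans (concatMap-++ φ v (c₁ ∷ y)) (trans (cong (λ x → applyM φ v ++ x ++ applyM φ y) e′)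
        (trans (cong (applyM φ v ++_) (++-assoc v′ _ (applyM φ y))) (sym (++-assoc (applyM φ v) v′ _)))))
      rr : run z (W* 0 (applyM φ v ++ v′)) ≡ just _
      rr = trans (cong (run z) (concatMap-++ (W 0) (applyM φ v) v′)) (trans (run-++-just z (W* 0 (applyM φ v))
        (trans (cong (run z) (sym (W*-suc 0 v))) (trans (const* 1 v z l) r))) r′)

    fixedLink : ∀ n → nsig (2 * suc n) ≡ nsig (suc n) → FixedLink p (W 0) (power φ (suc n))
    fixedLink n e z c l d = z₁ , c₁ , l₁ , L₁ , subst (λ x → Link (W 0) (power φ N) z₁ c₁ (proj₁ x) (proj₂ x)) fixed (nx^-link N z₁ c₁ l₁ d₁)
      where
      N = suc n
      z₁ = proj₁ (nx^ N (z , c))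
      c₁ = proj₂ (nx^ N (z , c))
      l₁ = nx^-length N (z , c) l
      L₁ = nx^-link N z c l d
      d₁ = proj₂ (proj₂ (proj₂ (proj₂ L₁)))
      fixed : nx^ N (z₁ , c₁) ≡ (z₁ , c₁)
      fixed = trans (sym (nx^-+ N N (z , c))) (trans (cong (λ k → nx^ (N + k) (z , c)) (sym (+-identityʳ N))) (nsig-same (2 * N) N e c z l))

record CSys {s : ℕ} (β : InfWord s) : Set₁ where
  field
    psys : PSys β
  open PSys psys public
  φˡ : Morphism s
  φˡ c = reverse (φ c)
  Wˡ : ℕ → Fin s → Word s
  Wˡ m c = reverse (W m c)
  stepˡ : ∀ m c → Wˡ (suc m) c ≡ concatMap (Wˡ m) (φˡ c)
  stepˡ = Core.stepW (reverseCore (toCore bsys))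
  module Right = Reading p φ W stepW
  module Left  = Reading p φˡ Wˡ stepˡ
  field
    constʳ : ∀ m → Right.SameRun m 0
    constˡ : ∀ m → Left.SameRun m 0

record NSys {s : ℕ} (β : InfWord s) : Set₁ where
  field
    csys : CSys β
  open CSys csys public
  field
    linkʳ : FixedLink p (W 0) φ
    linkˡ : FixedLink p (Wˡ 0) φˡ

toCSys : ∀ {s} {β : InfWord s} → PSys β → CSys β
toCSys {s} {β} S = go (idempotentIndex₂ R.sig L.sig R.sig-det L.sig-det)
  where
  module S = PSys S
  module R = Reading S.p S.φ S.W S.stepW
  module L = Reading S.p (λ c → reverse (S.φ c)) (λ m c → reverse (S.W m c)) (Core.stepW (reverseCore (toCore S.bsys)))
  go : (∃[ n ] ∀ j → R.sig (suc j * suc n) ≡ R.sig (suc n) × L.sig (suc j * suc n) ≡ L.sig (suc n)) → CSys β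
  go (n , same) = record
    -- The offset N makes level m the old level (m + 1)·N, because the old level 0 need not belong
    -- to the repeating part.
    { psys = renormP S n (suc n)
    ; constʳ = λ m → R.sig-same (suc m * suc n) (1 * suc n) (trans (proj₁ (same m)) (sym (proj₁ (same 0))))
    ; constˡ = λ m → L.sig-same (suc m * suc n) (1 * suc n) (trans (proj₂ (same m)) (sym (proj₂ (same 0)))) }

toNSys : ∀ {s} {β : InfWord s} → CSys β → NSys β
toNSys {s} {β} S = go (idempotentIndex₂ NR.nsig NL.nsig NR.nsig-det NL.nsig-det)
  where
  module S = CSys S
  module NR = S.Right.Next S.constʳ
  module NL = S.Left.Next S.constˡ
  go : (∃[ n ] ∀ j → NR.nsig (suc j * suc n) ≡ NR.nsig (suc n) × NL.nsig (suc j * suc n) ≡ NL.nsig (suc n)) → NSys β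
  go (n , same) = record
    -- All levels already read alike, so offset 0 will do; only φ has to become a power.
    { csys = record { psys = renormP S.psys n 0 ; constʳ = λ m → S.constʳ (m * suc n) ; constˡ = λ m → S.constˡ (m * suc n) }
    ; linkʳ = NR.fixedLink n (proj₁ (same 1))
    ; linkˡ = linkˡ }
    where
    tr : ∀ {z} c {z′ c′} → Link (S.Wˡ 0) (power S.φˡ (suc n)) z c z′ c′ →
      Link (S.Wˡ 0) (λ c → reverse (power S.φ (suc n) c)) z c z′ c′
    tr c (v , y , e , r) = v , y , trans (sym (iterM-reverse S.φ (suc n) (c ∷ []))) e , r
    linkˡ : FixedLink S.p (S.Wˡ 0) (λ c → reverse (power S.φ (suc n) c))
    linkˡ z c l d = let z′ , c′ , l′ , k₁ , k₂ = NL.fixedLink n (proj₂ (same 1)) z c l d in z′ , c′ , l′ , tr c k₁ , tr c′ k₂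

-- Growth of the length read before the first mismatch

module Heads {s : ℕ} (p : ℕ) (φ : Morphism s) (W : ℕ → Fin s → Word s)
  (stepW : ∀ m c → W (suc m) c ≡ concatMap (W m) (φ c)) (const : ∀ m → Reading.SameRun p φ W stepW m 0)
  (link : FixedLink p (W 0) φ) (growthW* : ∀ u → Growth (λ m → length (concatMap (W m) u))) where
  open Levels φ W stepW
  open Reading p φ W stepW
  open Next const

  deadLevel : ∀ m c z → length z ≡ p → Dead z (W 0 c) → Dead z (W m c)
  deadLevel m c z l d = trans (const m c z l) d

  hd-decompose : ∀ m {u} z v c y {z′} → length z ≡ p → u ≡ v ++ c ∷ y → run z (W* 0 v) ≡ just z′ → Dead z′ (W 0 c) →
    hd z (W* m u) ≡ length (W* m v) + hd z′ (W m c)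
  hd-decompose m z v c y {z′} l refl r d =
    trans (cong (hd z) (concatMap-++ (W m) v (c ∷ y))) (trans (hd-++-just z (W* m v) (trans (const* m v z l) r))
      (cong (length (W* m v) +_) (hd-++-nothing z′ (W m c) (deadLevel m c z′ (trans (run-length z (W* 0 v) r) l) d))))

  Growth-link : ∀ z c z′ c′ → length z ≡ p → Link (W 0) φ z c z′ c′ → Growth (λ m → hd z′ (W m c′)) → Growth (λ m → hd z (W m c))
  Growth-link z c z′ c′ l (v , y , e , r , d) g = Growth-shift
    (λ m → trans (cong (hd z) (stepW m c)) (hd-decompose m z v c′ y l e r d)) (Growth-+ (growthW* v) g)

  Growth-self : ∀ z c → length z ≡ p → Link (W 0) φ z c z c → Growth (λ m → hd z (W m c))
  Growth-self z c l (v , y , e , r , d) = Growth-sum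
    (λ m → trans (cong (hd z) (stepW m c)) (hd-decompose m z v c y l e r d)) (growthW* v)

  Growth-hd : ∀ z c → length z ≡ p → Dead z (W 0 c) → Growth (λ m → hd z (W m c))
  Growth-hd z c l d with link z c l d
  ... | z′ , c′ , l′ , k₁ , k₂ = Growth-link z c z′ c′ l k₁ (Growth-self z′ c′ l′ k₂)

  Growth-hd* : ∀ z u → length z ≡ p → Dead z (W* 0 u) → Growth (λ m → hd z (W* m u))
  Growth-hd* z u l d with scan z u
  ... | inj₁ a = ⊥-elim (alive≢dead z (W* 0 u) a d)
  ... | inj₂ (v , c , y , z′ , e , r , d′) = Growth-ext (λ m → sym (hd-decompose m z v c y l e r d′))
          (Growth-+ (growthW* v) (Growth-hd z′ c (trans (run-length z (W* 0 v) r) l) d′))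

-- Runs of period p and their lengths

minPositive : ∀ {A : Set} (f : A → ℕ) (xs : List A) →
  (∀ {x} → x ∈ xs → f x ≡ 0) ⊎ ∃[ x ] x ∈ xs × 1 ≤ f x × (∀ {y} → y ∈ xs → f y ≡ 0 ⊎ f x ≤ f y)
minPositive f [] = inj₁ λ ()
minPositive f (x ∷ xs) with f x in e | minPositive f xs
... | zero | inj₁ h = inj₁ λ { (here refl) → e ; (there m) → h m }
... | zero | inj₂ (y , m , l , h) = inj₂ (y , there m , l , λ { (here refl) → inj₁ e ; (there m) → h m })
... | suc d | inj₁ h = inj₂ (x , here refl , subst (1 ≤_) (sym e) (s≤s z≤n) , λ { (here refl) → inj₂ ≤-refl ; (there m) → inj₁ (h m) })
... | suc d | inj₂ (y , m , l , h) with ≤-total (f x) (f y)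
...   | inj₁ le = inj₂ (x , here refl , subst (1 ≤_) (sym e) (s≤s z≤n) ,
          λ { (here refl) → inj₂ ≤-refl ; (there m) → [ inj₁ , (λ q → inj₂ (≤-trans le q)) ]′ (h m) })
...   | inj₂ ge = inj₂ (y , there m , l , λ { (here refl) → inj₂ ge ; (there m) → h m })

take-length : ∀ {A : Set} (u : List A) {v} → take (length u) (u ++ v) ≡ u
take-length [] = refl
take-length (x ∷ u) = cong (x ∷_) (take-length u)

drop-length : ∀ {A : Set} (u : List A) {v} → drop (length u) (u ++ v) ≡ v
drop-length [] = refl
drop-length (x ∷ u) = drop-length u

module Runs {s : ℕ} {β : InfWord s} (N : NSys β) where
  open NSys N
  open Letters base

  Growth-Wˡ* : ∀ u → Growth (λ m → length (concatMap (Wˡ m) u))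
  Growth-Wˡ* u = Growth-ext (λ m → len m u) (Growth-W* u)
    where
    len : ∀ m u → length (W* m u) ≡ length (concatMap (Wˡ m) u)
    len m [] = refl
    len m (c ∷ u) = trans (length-++ (W m c)) (trans (cong₂ _+_ (sym (length-reverse (W m c))) (len m u)) (sym (length-++ (Wˡ m c))))

  module HR = Heads p φ W stepW constʳ linkʳ Growth-W*
  module HL = Heads p φˡ Wˡ stepˡ constˡ linkˡ Growth-Wˡ*

  runʳ-const : ∀ m u z → length z ≡ p → run z (W* m u) ≡ run z (W* 0 u)
  runʳ-const m u z l = Right.Next.const* constʳ m u z l

  runˡ-const : ∀ m u z → length z ≡ p → run z (reverse (W* m u)) ≡ run z (reverse (W* 0 u))
  runˡ-const m u z l = trans (cong (run z) (reverse-concatMap (W m) u)) (trans (Left.Next.const* constˡ m (reverse u) z l)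
    (cong (run z) (sym (reverse-concatMap (W 0) u))))

  -- The length of the run through the boundary between u₀ and u₁ at level m, if z is expected to
  -- its right. Under period p the p letters before the boundary are the same word z, hence the
  -- reading to the left starts from its reversal.
  ell : Word s → Word s → Word s → ℕ → ℕ
  ell z u₀ u₁ m = hd (reverse z) (reverse (W* m u₀)) + hd z (W* m u₁)

  DeadBoth : Word s → Word s → Word s → Set
  DeadBoth z u₀ u₁ = length z ≡ p × Dead (reverse z) (reverse (W* 0 u₀)) × Dead z (W* 0 u₁)

  deadBoth? : ∀ z u₀ u₁ → Dec (DeadBoth z u₀ u₁)
  deadBoth? z u₀ u₁ with length z ≟ p | alive? (reverse z) (reverse (W* 0 u₀)) | alive? z (W* 0 u₁)
  ... | no ¬l | _ | _ = no λ (l , _) → ¬l l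
  ... | yes l | inj₁ a | _ = no λ (_ , d , _) → alive≢dead (reverse z) (reverse (W* 0 u₀)) a d
  ... | yes l | inj₂ _ | inj₁ a = no λ (_ , _ , d) → alive≢dead z (W* 0 u₁) a d
  ... | yes l | inj₂ d | inj₂ d′ = yes (l , d , d′)

  Growth-ell : ∀ z u₀ u₁ → DeadBoth z u₀ u₁ → Growth (ell z u₀ u₁)
  Growth-ell z u₀ u₁ (l , d₀ , d₁) = Growth-+
    (Growth-ext (λ m → cong (hd (reverse z)) (sym (reverse-concatMap (W m) u₀)))
      (HL.Growth-hd* (reverse z) (reverse u₀) (trans (length-reverse z) l)
        (trans (cong (run (reverse z)) (sym (reverse-concatMap (W 0) u₀))) d₀)))
    (HR.Growth-hd* z u₁ l d₁)

  -- A letter e, a cut position in φ e and a state: the places where `runGap` finds a run that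
  -- breaks off on both sides.
  Type : Set
  Type = Fin s × ℕ × Word s

  left right : Type → Word s
  left  (e , i , z) = take i (φ e)
  right (e , i , z) = drop i (φ e)

  code : Type → Word s
  code (e , i , z) = z

  types : List Type
  types = concatMap (λ e → concatMap (λ i → map (λ z → e , i , z) (words s p)) (upTo (suc (length (φ e))))) (allFin s)

  ∈-types : ∀ e i z → i ≤ length (φ e) → length z ≡ p → (e , i , z) ∈ types
  ∈-types e i z i≤ l = ∈-concatMap⁺ _ (lose (∈-allFin e) (∈-concatMap⁺ _ (lose (∈-upTo⁺ (s≤s i≤))
    (∈-map⁺ _ (subst (λ k → z ∈ words s k) l (∈-words z))))))

  lenOf : Type → ℕ → ℕ
  lenOf τ = ell (code τ) (left τ) (right τ)

  DeadT : Type → Set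
  DeadT τ = DeadBoth (code τ) (left τ) (right τ)

  Jump : Type → ℕ → ℕ → ℕ → Set
  Jump τ C n m = DeadT τ → lenOf τ m ≤ C ⊎ n ≤ lenOf τ m

  LogReady : ℕ → ℕ → ℕ → Set
  LogReady C n m = C * suc ⌊log₂ n ⌋ ≤ m

  -- The first condition makes runs of degree at least k long, the logarithmic one does so for
  -- exponential types and passes the threshold of the polynomial ones. Logarithms being of smaller
  -- order than roots, it leaves the order of the level unchanged.
  PowReady : ℕ → ℕ → ℕ → ℕ → Set
  PowReady k C n m = C * n ≤ suc m ^ k × LogReady C n m

  LogReady-anti : ∀ {C C′} n m → C ≤ C′ → LogReady C′ n m → LogReady C n m
  LogReady-anti n m l h = ≤-trans (*-monoˡ-≤ (suc ⌊log₂ n ⌋) l) h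

  LogReady⇒≤ : ∀ C n m → LogReady C n m → C ≤ m
  LogReady⇒≤ C n m h = ≤-trans (≤-trans (≤-reflexive (sym (*-identityʳ C))) (*-monoʳ-≤ C (s≤s z≤n))) h

  Jump-mono : ∀ {τ C C′ n m} → C ≤ C′ → Jump τ C n m → Jump τ C′ n m
  Jump-mono l h d = [ (λ x → inj₁ (≤-trans x l)) , inj₂ ]′ (h d)

  -- Index 0 gathers the types that cannot determine the exponent: bounded ones, at least
  -- exponential ones, and those whose readings do not both break off.
  data Class (τ : Type) : ℕ → Set where
    tame : (∃[ C ] ∀ n m → LogReady C n m → Jump τ C n m) → Class τ 0
    poly : ∀ d → DeadT τ → Poly (lenOf τ) (suc d) → Class τ (suc d)

  class : ∀ τ → ∃ (Class τ)
  class τ with deadBoth? (code τ) (left τ) (right τ)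
  ... | no ¬d = 0 , tame (0 , λ n m _ d → ⊥-elim (¬d d))
  ... | yes d with Growth-ell (code τ) (left τ) (right τ) d
  ...   | zer (mkZero C _ b _) = 0 , tame (C , λ n m _ _ → inj₁ (b m))
  ...   | pol zero (mkPoly C _ _ h _ _) = 0 , tame (C , λ n m _ _ → inj₁ (≤-trans (h m) (≤-reflexive (*-identityʳ C))))
  ...   | pol (suc e) x = suc e , poly e d x
  ...   | exp (C , h) = 0 , tame (C , λ n m r _ → inj₂ (h n m r))

  degree : Type → ℕ
  degree τ = proj₁ (class τ)

  powJump : ∀ {τ d k} → k ≤ d → Poly (lenOf τ) d → ∃[ C ] ∀ n m → PowReady k C n m → Jump τ C n m
  -- The constant acts twice: as a factor it absorbs C, and through `LogReady` it forces m beyond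
  -- m₀.
  powJump {τ} {d} {k} k≤d (mkPoly C m₀ lo _ _ _) = suc (C + m₀) , λ n m (r , r′) _ → inj₂ (*-cancelˡ-≤ (suc (C + m₀))
    (≤-trans r (≤-trans (^-monoʳ-≤ (suc m) k≤d) (≤-trans (lo m (≤-trans (m≤n+m m₀ (suc C)) (LogReady⇒≤ (suc (C + m₀)) n m r′)))
      (*-monoˡ-≤ (lenOf τ m) (≤-trans (m≤m+n C m₀) (n≤1+n _)))))))

  data Verdict : Set where
    power-case : ∀ k τ → 1 ≤ k → DeadT τ → Poly (lenOf τ) k →
      (∃[ C ] ∀ {τ} → τ ∈ types → ∀ n m → PowReady k C n m → Jump τ C n m) → Verdict
    log-case : (∃[ C ] ∀ {τ} → τ ∈ types → ∀ n m → LogReady C n m → Jump τ C n m) → Verdict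

  verdict : Verdict
  verdict with minPositive degree types
  ... | inj₁ h = log-case (proj₁ all , λ m → proj₂ all m (h m))
    where
    tameC : ∀ τ → ∃[ C ] (degree τ ≡ 0 → ∀ n m → LogReady C n m → Jump τ C n m)
    tameC τ with class τ
    ... | zero , tame (C , h) = C , λ _ → h
    ... | suc _ , _ = 0 , λ ()
    all = uniform {P = λ τ C → degree τ ≡ 0 → ∀ n m → LogReady C n m → Jump τ C n m}
      (λ {τ} l q e n m r → Jump-mono {τ} {n = n} {m} l (q e n m (LogReady-anti n m l r))) types tameC
  ... | inj₂ (τ , _ , d≥1 , h) = found (class τ) refl
    where
    found : ∀ (x : ∃ (Class τ)) → class τ ≡ x → Verdict
    found (zero , _) e = ⊥-elim (<⇒≱ d≥1 (≤-reflexive (cong proj₁ e)))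
    found (suc d , poly _ dd x) e = power-case (suc d) τ (s≤s z≤n) dd x
        (proj₁ all , λ m → proj₂ all m (h m))
      where
      powC : ∀ τ′ → ∃[ C ] (degree τ′ ≡ 0 ⊎ degree τ ≤ degree τ′ → ∀ n m → PowReady (suc d) C n m → Jump τ′ C n m)
      powC τ′ with class τ′
      ... | zero , tame (C , h) = C , λ _ n m r → h n m (proj₂ r)
      ... | suc d′ , poly _ _ x′ with suc d ≤? suc d′
      ...   | yes le = let C , q = powJump {τ′} le x′ in C , λ _ → q
      ...   | no ¬le = 0 , λ { (inj₂ le) → ⊥-elim (¬le (subst (_≤ suc d′) (cong proj₁ e) le)) }
      all = uniform {P = λ τ′ C → degree τ′ ≡ 0 ⊎ degree τ ≤ degree τ′ → ∀ n m → PowReady (suc d) C n m → Jump τ′ C n m}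
        (λ {τ′} l q e n m (r , r′) → Jump-mono {τ′} {n = n} {m} l
          (q e n m (≤-trans (*-monoˡ-≤ n l) r , LogReady-anti n m l r′))) types powC

-- Long bounded factors

longOuter : ∀ {a b c} → a + (b + a) ≤ c → ∀ {x y z} → c ≡ x + (y + z) → y ≤ b → a ≤ x ⊎ a ≤ z
longOuter {a} {b} le {x} {y} {z} refl y≤b with a ≤? x | a ≤? z
... | yes p | _ = inj₁ p
... | _ | yes p = inj₂ p
... | no ¬p | no ¬q = ⊥-elim (<⇒≱ (+-mono-<-≤ (≰⇒> ¬p) (+-mono-≤ y≤b (<⇒≤ (≰⇒> ¬q)))) le)

module LongBounded {s : ℕ} {β : InfWord s} (N : NSys β) (L : ℕ) where
  open NSys N
  open Letters base

  OKword : Word s → Set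
  OKword v = ∃[ x ] ∃[ g ] ∃[ y ] v ≡ x ++ g ++ y × suc (suc L) ≤ length g × OK (W* 0 g)

  OKword-infix : ∀ {u} x v y → u ≡ x ++ v ++ y → OKword v → OKword u
  OKword-infix x v y e (x′ , g , y′ , e′ , l , o) = x ++ x′ , g , y′ ++ y , infix-trans x′ y′ {x} {y} e′ e , l , o

  Kc-bound : ∃[ K ] ∀ c → length (W* 0 (φ c)) ≤ K
  Kc-bound = uniformFin {P = λ c K → length (W* 0 (φ c)) ≤ K} (λ l p → ≤-trans p l) (λ c → _ , ≤-refl)

  -- A bounded factor cut among several children has at most Kc letters in whole images, so with
  -- length K one of its two ends has length G. Removing H irregular letters leaves L + 2 periodic
  -- ones: one for the left of a boundary, and L + 1 for its right to exceed L.
  Kc G K : ℕ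
  Kc = proj₁ Kc-bound
  G = H + suc (suc L)
  K = G + (Kc + G)

  long-half : ∀ (h g : Word s) → length h ≤ H → ∀ {n} → n ≡ length h + length g → G ≤ n → suc (suc L) ≤ length g
  long-half h g lh refl le = +-cancelˡ-≤ H _ _ (≤-trans le (+-monoˡ-≤ (length g) lh))

  longPrefix : ∀ c D t {y} → iterM φ D (c ∷ []) ≡ t ++ y → All B t → G ≤ length t → OKword t
  longPrefix c D t e bs l with PPr c D t e bs
  ... | h , g , refl , lh , o = h , g , [] , cong (h ++_) (sym (++-identityʳ g)) , long-half h g lh (length-++ h) l , o

  longSuffix : ∀ c D t {x} → iterM φ D (c ∷ []) ≡ x ++ t → All B t → G ≤ length t → OKword t
  longSuffix c D t e bs l with PPl c D t e bs
  ... | g , h , refl , lh , o = [] , g , h , refl , long-half h g lh (trans (length-++ g) (+-comm (length g) _)) l , o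

  -- Descend while v lies within the image of a single child. When it is cut, one of its ends is a
  -- long bounded prefix or suffix of an iterated letter, and those are periodic up to H letters. At
  -- D = 0 there is only one letter, fewer than K.
  boundedFactor : ∀ D c {x} v {y} → iterM φ D (c ∷ []) ≡ x ++ v ++ y → All B v → K ≤ length v → OKword v
  boundedFactor zero c {x} v {y} e bs l = ⊥-elim (<⇒≱ (≤-trans (≤-trans (s≤s (s≤s z≤n)) (m≤n+m (suc (suc L)) H)) (≤-trans (m≤m+n G _) l))
    (≤-trans (≤-trans (m≤m+n (length v) (length y)) (≤-trans (m≤n+m _ (length x)) (≤-reflexive (sym (length-++₃ x v y))))) (≤-reflexive (cong length (sym e)))))
  boundedFactor (suc D) c {x} v {y} e bs l with cut (λ d → iterM φ D (d ∷ [])) (φ c) {x} v {y} (trans (sym (iterM-suc-letter φ D c)) e)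
  ... | inj₁ (d , _ , x′ , y′ , e′) = boundedFactor D d {x′} v {y′} e′ bs l
  ... | inj₂ (mkCut U₁ v₁ U₂ p t eU refl _ _ pO tO) = choose pO tO (longOuter {G} {Kc} l (length-++₃ p fv t) mid)
    where
    f = λ d → iterM φ D (d ∷ [])
    fv = concatMap f v₁
    pB = All.++⁻ˡ p bs
    fvB = All.++⁻ˡ fv (All.++⁻ʳ p bs)
    tB = All.++⁻ʳ fv (All.++⁻ʳ p bs)
    v₁B : All B v₁
    v₁B = Bop-iter D (subst (All B) (sym (iterM-letters φ D v₁)) fvB)
    -- The letters of v₁ are bounded, so their iterates spell what they spell themselves, and each
    -- letter spells at least one.
    mid : length fv ≤ Kc
    mid = begin
      length fv                      ≤⟨ length≤concatMap (W 0) (W≥1 0) fv ⟩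
      length (W* 0 fv)               ≡⟨ cong (λ z → length (W* 0 z)) (iterM-letters φ D v₁) ⟨
      length (W* 0 (iterM φ D v₁))   ≡⟨ cong length (W*-iter D 0 v₁) ⟨
      length (W* (D + 0) v₁)         ≡⟨ cong length (W*-B (D + 0) v₁B) ⟩
      length (W* 0 v₁)               ≤⟨ ≤-trans (m≤m+n _ _) (m≤n+m _ (length (W* 0 U₁))) ⟩
      length (W* 0 U₁) + (length (W* 0 v₁) + length (W* 0 U₂)) ≡⟨ length-++₃ (W* 0 U₁) (W* 0 v₁) (W* 0 U₂) ⟨
      length (W* 0 U₁ ++ W* 0 v₁ ++ W* 0 U₂) ≡⟨ cong length (concatMap-infix (W 0) U₁ v₁ U₂ eU) ⟨
      length (W* 0 (φ c))            ≤⟨ proj₂ Kc-bound c ⟩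
      Kc                             ∎
      where open ≤-Reasoning
    G≥1 : ∀ {n} → G ≤ n → n ≢ 0
    G≥1 le refl with () ← ≤-trans (≤-trans (s≤s z≤n) (m≤n+m (suc (suc L)) H)) le
    choose : SuffixOfLetter f (φ c) p → PrefixOfLetter f (φ c) t → G ≤ length p ⊎ G ≤ length t → OKword (p ++ fv ++ t)
    choose (inj₁ refl) _ (inj₁ le) = ⊥-elim (G≥1 le refl)
    choose (inj₂ (d , _ , x′ , e′)) _ (inj₁ le) = OKword-infix [] p (fv ++ t) refl (longSuffix d D p e′ pB le)
    choose _ (inj₁ refl) (inj₂ le) = ⊥-elim (G≥1 le refl)
    choose _ (inj₂ (d , _ , y′ , e′)) (inj₂ le) = OKword-infix (p ++ fv) t []
      (trans (sym (++-assoc p fv t)) (cong ((p ++ fv) ++_) (sym (++-identityʳ t)))) (longPrefix d D t e′ tB le)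

  LongIn : Word s → Set
  LongIn u = ∃[ x ] ∃[ v ] ∃[ y ] u ≡ x ++ v ++ y × All B v × K ≤ length v

  LongIn-infix : ∀ {u} x v y → u ≡ x ++ v ++ y → LongIn v → LongIn u
  LongIn-infix x v y e (x′ , g , y′ , e′ , r) = x ++ x′ , g , y′ ++ y , infix-trans x′ y′ {x} {y} e′ e , r

  loop-iter : ∀ {e} u v → φ e ≡ u ++ e ∷ v → All B u → All B v → ∀ i → ∃[ x ] ∃[ y ] iterM φ i (e ∷ []) ≡ x ++ e ∷ y ×
    All B x × All B y × i * length u ≤ length x × i * length v ≤ length y
  loop-iter u v φe bu bv zero = [] , [] , refl , [] , [] , z≤n , z≤n
  loop-iter {e} u v φe bu bv (suc i) with loop-iter u v φe bu bv i
  ... | x , y , eq , bx , by , lx , ly = applyM φ x ++ u , v ++ applyM φ y , eq′ ,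
      All.++⁺ (Bcl-iter 1 bx) bu , All.++⁺ bv (Bcl-iter 1 by) ,
      ≤-trans (+-mono-≤ (≤-refl {length u}) (≤-trans lx (length≤concatMap φ φ≥1 x))) (≤-reflexive (trans (+-comm (length u) _) (sym (length-++ (applyM φ x))))) ,
      ≤-trans (+-mono-≤ (≤-refl {length v}) (≤-trans ly (length≤concatMap φ φ≥1 y))) (≤-reflexive (sym (length-++ v)))
    where
    eq′ : applyM φ (iterM φ i (e ∷ [])) ≡ (applyM φ x ++ u) ++ e ∷ v ++ applyM φ y
    eq′ = trans (cong (applyM φ) eq) (trans (concatMap-++ φ x (e ∷ y)) (trans (cong (λ w → applyM φ x ++ w ++ applyM φ y) φe)
      (trans (cong (applyM φ x ++_) (++-assoc u _ _)) (sym (++-assoc (applyM φ x) u _)))))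

  -- Descend to an unbounded letter e with φ e = u e v and u, v bounded. They are not both empty, by
  -- `Bfix`, so copies of their images accumulate beside e, at least one letter per step.
  polyLong  : ∀ {e} → PolyLetter e → ¬ B e → ∃[ i₀ ] ∀ i → i₀ ≤ i → LongIn (iterM φ i (e ∷ []))
  polyLong* : ∀ {u} → All PolyLetter u → ¬ All B u → ∃[ i₀ ] ∀ i → i₀ ≤ i → LongIn (iterM φ i u)
  polyLong {e} (tree ps) ¬b with polyLong* ps (λ bs → ¬b (Bop bs))
  ... | i₀ , h = suc i₀ , λ { (suc i) (s≤s l) → subst LongIn (sym (trans (iterM-suc φ i (e ∷ [])) (cong (iterM φ i) (concatMap-[ φ ] e)))) (h i l) }
  polyLong {e} (loop u v φe pu pv) ¬b with All.all? B? u | All.all? B? v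
  ... | no ¬bu | _ with polyLong* pu ¬bu
  ...   | i₀ , h = suc i₀ , λ { (suc i) (s≤s l) → LongIn-infix [] (iterM φ i u) (iterM φ i (e ∷ v))
            (trans (iterM-suc φ i (e ∷ [])) (trans (cong (iterM φ i) (trans (concatMap-[ φ ] e) φe)) (iterM-++ φ i u (e ∷ v)))) (h i l) }
  polyLong {e} (loop u v φe pu pv) ¬b | yes _ | no ¬bv with polyLong* pv ¬bv
  ...   | i₀ , h = suc i₀ , λ { (suc i) (s≤s l) → LongIn-infix (iterM φ i (u ++ e ∷ [])) (iterM φ i v) []
            (trans (iterM-suc φ i (e ∷ [])) (trans (cong (iterM φ i) (trans (concatMap-[ φ ] e) (trans φe (sym (++-assoc u (e ∷ []) v)))))
              (trans (iterM-++ φ i (u ++ e ∷ []) v) (cong (iterM φ i (u ++ e ∷ []) ++_) (sym (++-identityʳ _)))))) (h i l) }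
  polyLong {e} (loop [] [] φe pu pv) ¬b | yes _ | yes _ = ⊥-elim (¬b (Bfix φe))
  polyLong {e} (loop (c ∷ u) v φe pu pv) ¬b | yes bu | yes bv = K , λ i l → let x , y , eq , bx , _ , lx , _ = loop-iter (c ∷ u) v φe bu bv i in
    [] , x , e ∷ y , eq , bx , ≤-trans l (≤-trans (m≤m*n i (suc (length u))) lx)
  polyLong {e} (loop [] (c ∷ v) φe pu pv) ¬b | yes bu | yes bv = K , λ i l → let x , y , eq , _ , by , _ , ly = loop-iter [] (c ∷ v) φe bu bv i in
    x ++ e ∷ [] , y , [] , trans eq (trans (sym (++-assoc x (e ∷ []) y)) (cong ((x ++ e ∷ []) ++_) (sym (++-identityʳ y)))) , by , ≤-trans l (≤-trans (m≤m*n i (suc (length v))) ly)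
  polyLong* {[]} [] ¬b = ⊥-elim (¬b [])
  polyLong* {c ∷ u} (p ∷ ps) ¬b with B? c
  ... | no ¬bc = let i₀ , h = polyLong p ¬bc in i₀ , λ i l → LongIn-infix [] (iterM φ i (c ∷ [])) (iterM φ i u) (iterM-++ φ i (c ∷ []) u) (h i l)
  ... | yes bc = let i₀ , h = polyLong* ps (λ bs → ¬b (bc ∷ bs)) in i₀ , λ i l → LongIn-infix (iterM φ i (c ∷ [])) (iterM φ i u) []
          (trans (iterM-++ φ i (c ∷ []) u) (cong (iterM φ i (c ∷ []) ++_) (sym (++-identityʳ _)))) (h i l)

  open Runs N using (LogReady; LogReady-anti)

  -- `Slow` keeps what the window argument uses of polynomial growth: long bounded factors appear
  -- after a fixed number of generations.
  Fast Slow : ℕ → Fin s → Set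
  Fast I c = ∀ n m → LogReady I n m → n ≤ ∣W∣ c m
  Slow I c = B c ⊎ (∀ i → I ≤ i → LongIn (iterM φ i (c ∷ [])))

  dichotomy : ∃[ I ] ∀ c → Fast I c ⊎ Slow I c
  dichotomy = uniformFin {P = λ c I → Fast I c ⊎ Slow I c} mono one
    where
    mono : ∀ {c I I′} → I ≤ I′ → Fast I c ⊎ Slow I c → Fast I′ c ⊎ Slow I′ c
    mono l (inj₁ f) = inj₁ λ n m r → f n m (LogReady-anti n m l r)
    mono l (inj₂ (inj₁ b)) = inj₂ (inj₁ b)
    mono l (inj₂ (inj₂ h)) = inj₂ (inj₂ λ i q → h i (≤-trans l q))
    one : ∀ c → ∃[ I ] (Fast I c ⊎ Slow I c)
    one c with classify c | B? c
    ... | inj₂ (C , h) | _ = C , inj₁ h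
    ... | inj₁ _ | yes b = 0 , inj₂ (inj₁ b)
    ... | inj₁ pl | no ¬b = let i₀ , h = polyLong pl ¬b in i₀ , inj₂ (inj₂ h)

  I : ℕ
  I = proj₁ dichotomy

  BOKword : Word s → Set
  BOKword v = ∃[ x ] ∃[ g ] ∃[ y ] v ≡ x ++ g ++ y × suc (suc L) ≤ length g × OK (W* 0 g) × All B g

  addB : ∀ {v} → All B v → OKword v → BOKword v
  addB bs (x , g , y , e , l , o) = x , g , y , e , l , o , All-infix x g y e bs

  BOKword-infix : ∀ {u} x v y → u ≡ x ++ v ++ y → BOKword v → BOKword u
  BOKword-infix x v y e (x′ , g , y′ , e′ , r) = x ++ x′ , g , y′ ++ y , infix-trans x′ y′ {x} {y} e′ e , r

  -- If v is bounded throughout, its own length gives the long bounded factor; otherwise a single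
  -- unbounded slow letter contains one after I generations.
  slowWord : ∀ D c {x} v {y} → iterM φ D (c ∷ []) ≡ x ++ v ++ y → All (Slow I) v → K ≤ length v → BOKword (iterM φ I v)
  slowWord D c {x} v {y} e sl l with firstNot B? v
  ... | inj₁ bs = addB (Bcl-iter I bs) (boundedFactor (I + D) c {iterM φ I x} (iterM φ I v) {iterM φ I y}
        (trans (iterM-+ φ I D (c ∷ [])) (iterM-infix φ I x v y e)) (Bcl-iter I bs) (≤-trans l (length≤iterM φ φ≥1 I v)))
  ... | inj₂ (q , d , r , refl , _ , ¬b) with All.head (All.++⁻ʳ q sl)
  ...   | inj₁ b = ⊥-elim (¬b b)
  ...   | inj₂ h with h I ≤-refl
  ...     | x′ , v′ , y′ , e′ , bs , l′ = BOKword-infix (iterM φ I q) (iterM φ I (d ∷ [])) (iterM φ I r) (iterM-infix φ I q (d ∷ []) r refl)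
            (BOKword-infix x′ v′ y′ e′ (addB bs (boundedFactor I d {x′} v′ {y′} e′ bs l′)))

-- Upper bound

≤-split : ∀ {a b c d} → a + b ≤ c + d → a ≤ c ⊎ b ≤ d
≤-split {a} {b} {c} {d} le with a ≤? c | b ≤? d
... | yes p | _ = inj₁ p
... | _ | yes q = inj₂ q
... | no ¬p | no ¬q = ⊥-elim (<⇒≱ (+-mono-< (≰⇒> ¬p) (≰⇒> ¬q)) le)

module RunGap {s : ℕ} {β : InfWord s} (N : NSys β) (L n M : ℕ)
  (jump : ∀ {τ} → τ ∈ Runs.types N → ∀ m → M ≤ m → Runs.Jump N τ L n m) where
  open NSys N
  open Runs N

  length-rev : ∀ (z : Word s) → length z ≡ p → length (reverse z) ≡ p
  length-rev z l = trans (length-reverse z) l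

  reverse-W*-++ : ∀ m u v → reverse (W* m (u ++ v)) ≡ reverse (W* m v) ++ reverse (W* m u)
  reverse-W*-++ m u v = trans (cong reverse (concatMap-++ (W m) u v)) (reverse-++ (W* m u) (W* m v))

  -- Moving the reference boundary across a word that matches does not change the run.
  moveˡ : ∀ m A X z {z′} → length z ≡ p → run z (W* m X) ≡ just z′ →
    run (reverse z′) (reverse (W* m (A ++ X))) ≡ run (reverse z) (reverse (W* m A)) ×
    hd (reverse z′) (reverse (W* m (A ++ X))) ≡ length (W* m X) + hd (reverse z) (reverse (W* m A))
  moveˡ m A X z {z′} l r =
    trans (cong (run (reverse z′)) (reverse-W*-++ m A X)) (run-++-just (reverse z′) (reverse (W* m X)) r′) ,
    trans (cong (hd (reverse z′)) (reverse-W*-++ m A X)) (trans (hd-++-just (reverse z′) (reverse (W* m X)) r′)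
      (cong (_+ hd (reverse z) (reverse (W* m A))) (length-reverse (W* m X))))
    where r′ = run-reverse z (W* m X) (len≥1 z l) r

  moveʳ : ∀ m X C z {z′} → run z (W* m X) ≡ just z′ →
    run z (W* m (X ++ C)) ≡ run z′ (W* m C) × hd z (W* m (X ++ C)) ≡ length (W* m X) + hd z′ (W* m C)
  moveʳ m X C z r = trans (cong (run z) (concatMap-++ (W m) X C)) (run-++-just z (W* m X) r) ,
    trans (cong (hd z) (concatMap-++ (W m) X C)) (hd-++-just z (W* m X) r)

  Gap : ℕ → Set
  Gap ℓ = ℓ ≤ L ⊎ n ≤ ℓ

  ell-move : ∀ m A X C z {z′} → length z ≡ p → run z (W* 0 X) ≡ just z′ → ell z A (X ++ C) m ≡ ell z′ (A ++ X) C m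
  ell-move m A X C z {z′} l r = trans (cong (hd (reverse z) (reverse (W* m A)) +_) (proj₂ (moveʳ m X C z r′)))
    (trans (trans (sym (+-assoc (hd (reverse z) (reverse (W* m A))) _ _)) (cong (_+ hd z′ (W* m C)) (+-comm _ (length (W* m X)))))
      (cong (_+ hd z′ (W* m C)) (sym (proj₂ (moveˡ m A X z l r′)))))
    where r′ = trans (runʳ-const m X z l) r

  dead-move⁺ : ∀ A X C z {z′} → run z (W* 0 X) ≡ just z′ → DeadBoth z A (X ++ C) → DeadBoth z′ (A ++ X) C
  dead-move⁺ A X C z {z′} r (l , d₀ , d₁) = trans (run-length z (W* 0 X) r) l ,
    trans (proj₁ (moveˡ 0 A X z l r)) d₀ , trans (sym (proj₁ (moveʳ 0 X C z r))) d₁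

  dead-move⁻ : ∀ A X C z {z′} → length z ≡ p → run z (W* 0 X) ≡ just z′ → DeadBoth z′ (A ++ X) C → DeadBoth z A (X ++ C)
  dead-move⁻ A X C z {z′} l r (_ , d₀ , d₁) = l , trans (sym (proj₁ (moveˡ 0 A X z l r))) d₀ , trans (proj₁ (moveʳ 0 X C z r)) d₁

  -- φ A spells at level 0 what A spells at level 1, and both levels read alike.
  dead-lift : ∀ z A C → DeadBoth z (applyM φ A) (applyM φ C) → DeadBoth z A C
  dead-lift z A C (l , d₀ , d₁) = l ,
    trans (sym (runˡ-const 1 A (reverse z) (length-rev z l))) (trans (cong (λ x → run (reverse z) (reverse x)) (W*-suc 0 A)) d₀) ,
    trans (sym (runʳ-const 1 C z l)) (trans (cong (run z) (W*-suc 0 C)) d₁)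

  ell-lift : ∀ z A C m → ell z (applyM φ A) (applyM φ C) m ≡ ell z A C (suc m)
  ell-lift z A C m = cong₂ (λ x y → hd (reverse z) (reverse x) + hd z y) (sym (W*-suc m A)) (sym (W*-suc m C))

  -- The climb of a run. A side of φ e′ that is read without mismatch moves the boundary to its
  -- edge, and the parents show the same run at level J + 1, whence `jump` is required for all m ≥
  -- M. If both sides break off, the run is that of a type. At D = 0 one side is empty and cannot
  -- break off.
  runGap : ∀ D J c U₁ U₂ z → M ≤ J → iterM φ D (c ∷ []) ≡ U₁ ++ U₂ → DeadBoth z U₁ U₂ → Gap (ell z U₁ U₂ J)
  runGap zero J c [] U₂ z _ e (_ , () , _)
  runGap zero J c (_ ∷ []) [] z _ e (_ , _ , ())
  runGap zero J c (_ ∷ []) (_ ∷ _) z _ () d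
  runGap zero J c (_ ∷ _ ∷ _) U₂ z _ () d
  runGap (suc D) J c U₁ U₂ z M≤J e d with cutˡ φ (iterM φ D (c ∷ [])) U₁ e
  ... | V₁ , V₂ , .[] , eV , refl , eU , inj₁ refl = subst Gap (sym eq)
        (runGap D (suc J) c V₁ V₂ z (≤-trans M≤J (n≤1+n J)) eV (dead-lift z V₁ V₂ (subst₂ (DeadBoth z) (++-identityʳ (applyM φ V₁)) eU d)))
    where
    eq : ell z (applyM φ V₁ ++ []) U₂ J ≡ ell z V₁ V₂ (suc J)
    eq = trans (cong₂ (λ x y → ell z x y J) (++-identityʳ (applyM φ V₁)) eU) (ell-lift z V₁ V₂ J)
  ... | V₁ , .(e′ ∷ V₃) , t , eV , refl , eU , inj₂ (e′ , V₃ , refl , y , φe , refl) =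
    cases (alive? (reverse z) (reverse (W* 0 t))) (alive? z (W* 0 y))
    where
    l = proj₁ d
    A = applyM φ V₁
    C = applyM φ V₃
    cases : Alive (reverse z) (reverse (W* 0 t)) ⊎ Dead (reverse z) (reverse (W* 0 t)) → Alive z (W* 0 y) ⊎ Dead z (W* 0 y) →
      Gap (ell z (A ++ t) (y ++ C) J)
    cases _ (inj₁ (z′ , r)) = subst Gap (sym (trans (ell-move J (A ++ t) y C z l r) (trans (cong (λ x → ell z′ x C J) eq) (ell-lift z′ (V₁ ++ e′ ∷ []) V₃ J))))
        (runGap D (suc J) c (V₁ ++ e′ ∷ []) V₃ z′ (≤-trans M≤J (n≤1+n J)) (trans eV (sym (++-assoc V₁ (e′ ∷ []) V₃)))
          (dead-lift z′ (V₁ ++ e′ ∷ []) V₃ (subst (λ x → DeadBoth z′ x C) eq (dead-move⁺ (A ++ t) y C z r d))))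
      where
      eq : (A ++ t) ++ y ≡ applyM φ (V₁ ++ e′ ∷ [])
      eq = trans (++-assoc A t y) (trans (cong (A ++_) (trans (sym φe) (sym (concatMap-[ φ ] e′)))) (sym (concatMap-++ φ V₁ (e′ ∷ []))))
    cases (inj₁ (ζ , r)) (inj₂ _) = subst Gap (trans (sym (ell-lift z″ V₁ (e′ ∷ V₃) J)) (trans (cong (λ x → ell z″ A x J) (sym eq)) (ell-move J A t (y ++ C) z″ l″ r″)))
        (runGap D (suc J) c V₁ (e′ ∷ V₃) z″ (≤-trans M≤J (n≤1+n J)) eV
          (dead-lift z″ V₁ (e′ ∷ V₃) (subst (DeadBoth z″ A) eq (dead-move⁻ A t (y ++ C) z″ l″ r″ d))))
      where
      z″ = reverse ζ
      lζ = trans (run-length (reverse z) (reverse (W* 0 t)) r) (length-rev z l)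
      l″ : length z″ ≡ p
      l″ = length-rev ζ lζ
      r″ : run z″ (W* 0 t) ≡ just z
      r″ = subst₂ (λ x y → run z″ x ≡ just y) (reverse-involutive (W* 0 t)) (reverse-involutive z)
        (run-reverse (reverse z) (reverse (W* 0 t)) (len≥1 (reverse z) (length-rev z l)) r)
      eq : t ++ y ++ C ≡ applyM φ (e′ ∷ V₃)
      eq = trans (sym (++-assoc t y C)) (cong (_++ C) (sym φe))
    cases (inj₂ dₜ) (inj₂ d_y) = subst Gap eq (jump τ∈ J M≤J (l , subst (λ x → Dead (reverse z) (reverse (W* 0 x))) (sym lt) dₜ , subst (λ x → Dead z (W* 0 x)) (sym rt) d_y))
      where
      τ : Type
      τ = e′ , length t , z
      lt : left τ ≡ t
      lt = trans (cong (take (length t)) φe) (take-length t)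
      rt : right τ ≡ y
      rt = trans (cong (drop (length t)) φe) (drop-length t)
      τ∈ : τ ∈ types
      τ∈ = ∈-types e′ (length t) z (≤-trans (length-++-≤ˡ t) (≤-reflexive (cong length (sym φe)))) l
      eq : lenOf τ J ≡ ell z (A ++ t) (y ++ C) J
      eq = trans (cong₂ (λ x y → ell z x y J) lt rt) (cong₂ _+_
        (sym (trans (cong (hd (reverse z)) (reverse-W*-++ J A t)) (hd-++-nothing (reverse z) (reverse (W* J t)) (trans (runˡ-const J t (reverse z) (length-rev z l)) dₜ))))
        (sym (trans (cong (hd z) (concatMap-++ (W J) y C)) (hd-++-nothing z (W* J y) (trans (runʳ-const J y z l) d_y)))))

  module _ (aDead : ∀ z → length z ≡ p → Dead z (reverse (W 0 a))) where

    iter-head : ∀ D → ∃[ δ ] iterM φ D (a ∷ []) ≡ a ∷ δ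
    iter-head zero = [] , refl
    iter-head (suc D) = let δ , e = iter-a D in γ ++ δ , e

    -- The word starts with a, and `aDead` stops every leftward reading there at the latest.
    leftDead : ∀ D c U₁ {U₂} z → length z ≡ p → iterM φ D (a ∷ []) ≡ (c ∷ U₁) ++ U₂ → Dead z (reverse (W* 0 (c ∷ U₁)))
    leftDead D c U₁ z l e with ∷-injective (trans (sym (proj₂ (iter-head D))) e)
    ... | refl , _ with alive? z (reverse (W* 0 (a ∷ U₁)))
    ...   | inj₂ d = d
    ...   | inj₁ (z′ , r) with run-++⁻ z (reverse (W* 0 U₁)) (trans (cong (run z) (sym (reverse-++ (W 0 a) (W* 0 U₁)))) r)
    ...     | z₁ , r₁ , r₂ = ⊥-elim (alive≢dead z₁ (reverse (W 0 a)) (z′ , r₂) (aDead z₁ (trans (run-length z (reverse (W* 0 U₁)) r₁) l)))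

    -- The run through the boundary exceeds L, so either it never breaks to the right or it has
    -- length at least n. As w₁ and w₂ have n letters together, it covers one of them.
    halfPeriodic : ∀ D U₁ U₂ z {X} w₁ w₂ {Y} → 1 ≤ length U₁ → length z ≡ p → iterM φ D (a ∷ []) ≡ U₁ ++ U₂ →
      X ++ w₁ ≡ W* M U₁ → w₂ ++ Y ≡ W* M U₂ → length w₁ + length w₂ ≡ n → L < hd z (W* M U₂) → OK w₁ ⊎ OK w₂
    halfPeriodic D (c ∷ U₁) U₂ z {X} w₁ w₂ {Y} _ l e e₁ e₂ len lt with alive? z (W* 0 U₂)
    ... | inj₁ (z′ , r) = inj₂ (OK-infix (W* M U₂) [] w₂ {Y} (sym e₂) (z , l , z′ , trans (runʳ-const M U₂ z l) r))
    ... | inj₂ d with runGap D M a (c ∷ U₁) U₂ z ≤-refl e (l , leftDead D c U₁ (reverse z) (length-rev z l) e , d)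
    ...   | inj₁ le = ⊥-elim (<⇒≱ lt (≤-trans (m≤n+m _ _) le))
    ...   | inj₂ ge with ≤-split {length w₁} {length w₂} (≤-trans (≤-reflexive len) ge)
    ...     | inj₁ le₁ = inj₁ (OK-reverse⁻ w₁ (reverse z , length-rev z l , hd≤⇒alive (reverse z) (reverse w₁) {reverse X}
                (subst₂ _≤_ (sym (length-reverse w₁)) (cong (hd (reverse z)) (trans (cong reverse (sym e₁)) (reverse-++ X w₁))) le₁)))
    ...     | inj₂ le₂ = inj₂ (z , l , hd≤⇒alive z w₂ {Y} (subst (λ x → length w₂ ≤ hd z x) (sym e₂) le₂))

-- Shapes of windows and their number

module Windows {s : ℕ} {β : InfWord s} (N : NSys β) (L : ℕ) where
  open NSys N
  open Runs N
  open Letters base using (∣W∣)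
  open LongBounded N L

  OK-[] : OK []
  OK-[] = replicate p a , length-replicate p , _ , refl

  lefts rights : ℕ → ℕ → List (Word s)
  lefts  J x = periodicWords x ++ map (λ e → drop (length (W J e) ∸ x) (W J e)) (allFin s)
  rights J x = periodicWords x ++ map (λ e → take x (W J e)) (allFin s)

  -- The length n forces the length of the right end once the left length x and the middle u are
  -- chosen. As u ranges over a fixed finite set, x is the only parameter depending on n, and one
  -- level yields O(n) words.
  forms₃ : ℕ → ℕ → ℕ → Word s → Word s → List (Word s)
  forms₃ n J x A u = map (λ C → A ++ W* J u ++ C) (rights J (n ∸ x ∸ length (W* J u)))

  forms₂ : ℕ → ℕ → ℕ → Word s → List (Word s)
  forms₂ n J x A = concatMap (forms₃ n J x A) (words≤ s (suc K))

  forms₁ : ℕ → ℕ → ℕ → List (Word s)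
  forms₁ n J x = concatMap (forms₂ n J x) (lefts J x)

  forms : ℕ → ℕ → List (Word s)
  forms n J = concatMap (forms₁ n J) (upTo (suc n))

  Form : ℕ → Word s → Set
  Form J w = ∃[ A ] ∃[ u ] ∃[ C ] w ≡ A ++ W* J u ++ C × length u ≤ suc K ×
    (OK A ⊎ SuffixOfLetter (W J) (allFin s) A) × (OK C ⊎ PrefixOfLetter (W J) (allFin s) C)

  ∈-lefts : ∀ J A → OK A ⊎ SuffixOfLetter (W J) (allFin s) A → A ∈ lefts J (length A)
  ∈-lefts J A (inj₁ o) = ∈-++⁺ˡ (OK⇒∈ A o)
  ∈-lefts J .[] (inj₂ (inj₁ refl)) = ∈-++⁺ˡ (OK⇒∈ [] OK-[])
  ∈-lefts J A (inj₂ (inj₂ (e , m , x , eq))) = ∈-++⁺ʳ (periodicWords (length A))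
    (subst (_∈ map (λ e → drop (length (W J e) ∸ length A) (W J e)) (allFin s)) suffix (∈-map⁺ (λ e → drop (length (W J e) ∸ length A) (W J e)) m))
    where
    suffix : drop (length (W J e) ∸ length A) (W J e) ≡ A
    suffix rewrite eq = trans (cong (λ k → drop k (x ++ A)) (trans (cong (_∸ length A) (length-++ x)) (m+n∸n≡m (length x) (length A)))) (drop-length x)

  ∈-rights : ∀ J C → OK C ⊎ PrefixOfLetter (W J) (allFin s) C → C ∈ rights J (length C)
  ∈-rights J C (inj₁ o) = ∈-++⁺ˡ (OK⇒∈ C o)
  ∈-rights J .[] (inj₂ (inj₁ refl)) = ∈-++⁺ˡ (OK⇒∈ [] OK-[])
  ∈-rights J C (inj₂ (inj₂ (e , m , y , eq))) = ∈-++⁺ʳ (periodicWords (length C))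
    (subst (_∈ map (λ e → take (length C) (W J e)) (allFin s)) (trans (cong (take (length C)) eq) (take-length C)) (∈-map⁺ (λ e → take (length C) (W J e)) m))

  ∈-forms : ∀ n J w → length w ≡ n → Form J w → w ∈ forms n J
  ∈-forms n J w len (A , u , C , refl , l , a₁ , c₁) =
    ∈-concatMap⁺ (forms₁ n J) (lose (∈-upTo⁺ (s≤s (subst (length A ≤_) len (length-++-≤ˡ A))))
      (∈-concatMap⁺ (forms₂ n J (length A)) (lose (∈-lefts J A a₁) (∈-concatMap⁺ (forms₃ n J (length A) A) (lose (∈-words≤ u l)
        (∈-map⁺ (λ C → A ++ W* J u ++ C) (subst (λ k → C ∈ rights J k) lenC (∈-rights J C c₁))))))))
    where
    lenC : length C ≡ n ∸ length A ∸ length (W* J u)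
    lenC = sym (trans (cong (λ k → k ∸ length A ∸ length (W* J u)) (trans (sym len) (length-++₃ A (W* J u) C)))
      (trans (cong (_∸ length (W* J u)) (m+n∸m≡n (length A) _)) (m+n∸m≡n (length (W* J u)) (length C))))

  Q F : ℕ
  Q = length (words s p) + s
  F = Q * (length (words≤ s (suc K)) * Q)

  ∣lefts∣ : ∀ J x → length (lefts J x) ≡ Q
  ∣lefts∣ J x = trans (length-++ (periodicWords x)) (cong₂ _+_ (length-map _ (words s p)) (trans (length-map _ (allFin s)) (length-tabulate {n = s} (λ i → i))))

  ∣rights∣ : ∀ J x → length (rights J x) ≡ Q
  ∣rights∣ J x = trans (length-++ (periodicWords x)) (cong₂ _+_ (length-map _ (words s p)) (trans (length-map _ (allFin s)) (length-tabulate {n = s} (λ i → i))))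

  ∣forms∣ : ∀ n J → length (forms n J) ≤ suc n * F
  ∣forms∣ n J = ≤-trans (length-concatMap≤ (forms₁ n J) F (upTo (suc n)) bound₁) (≤-reflexive (cong (_* F) (length-upTo (suc n))))
    where
    bound₃ : ∀ x A u → length (forms₃ n J x A u) ≤ Q
    bound₃ x A u = ≤-reflexive (trans (length-map _ (rights J (n ∸ x ∸ length (W* J u)))) (∣rights∣ J _))
    bound₂ : ∀ x A → length (forms₂ n J x A) ≤ length (words≤ s (suc K)) * Q
    bound₂ x A = length-concatMap≤ (forms₃ n J x A) Q (words≤ s (suc K)) (bound₃ x A)
    bound₁ : ∀ x → length (forms₁ n J x) ≤ F
    bound₁ x = ≤-trans (length-concatMap≤ (forms₂ n J x) _ (lefts J x) (bound₂ x)) (≤-reflexive (cong (_* (length (words≤ s (suc K)) * Q)) (∣lefts∣ J x)))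

  Kw-bound : ∃[ K ] ∀ c → length (W 0 c) ≤ K
  Kw-bound = uniformFin {P = λ c K → length (W 0 c) ≤ K} (λ l p → ≤-trans p l) (λ c → _ , ≤-refl)

  Kw : ℕ
  Kw = proj₁ Kw-bound

  base₁ : ℕ → Fin s → List (Word s)
  base₁ n e = map (λ i → take n (drop i (W 0 e))) (upTo (suc Kw))

  base₀ : ℕ → List (Word s)
  base₀ n = concatMap (base₁ n) (allFin s)

  allForms : ℕ → ℕ → List (Word s)
  allForms n J = base₀ n ++ concatMap (forms n) (upTo (suc J))

  F₀ : ℕ
  F₀ = s * suc Kw

  ∣base₀∣ : ∀ n → length (base₀ n) ≤ F₀
  ∣base₀∣ n = ≤-trans (length-concatMap≤ (base₁ n) (suc Kw) (allFin s) (λ e → ≤-reflexive (trans (length-map _ (upTo (suc Kw))) (length-upTo (suc Kw)))))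
      (≤-reflexive (cong (_* suc Kw) (length-tabulate {n = s} (λ i → i))))

  ∣allForms∣ : ∀ n J → length (allForms n J) ≤ F₀ + suc J * (suc n * F)
  ∣allForms∣ n J = ≤-trans (≤-reflexive (length-++ (base₀ n))) (+-mono-≤ (∣base₀∣ n)
    (≤-trans (length-concatMap≤ (forms n) (suc n * F) (upTo (suc J)) (∣forms∣ n)) (≤-reflexive (cong (_* (suc n * F)) (length-upTo (suc J))))))

  ∈-level : ∀ n J j w → j ≤ J → w ∈ forms n j → w ∈ allForms n J
  ∈-level n J j w le m = ∈-++⁺ʳ (base₀ n) (∈-concatMap⁺ (forms n) (lose (∈-upTo⁺ (s≤s le)) m))

  widenˡ : ∀ {J U A} → SuffixOfLetter (W J) U A → SuffixOfLetter (W J) (allFin s) A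
  widenˡ (inj₁ x) = inj₁ x
  widenˡ (inj₂ (e , _ , x)) = inj₂ (e , ∈-allFin e , x)

  widenʳ : ∀ {J U A} → PrefixOfLetter (W J) U A → PrefixOfLetter (W J) (allFin s) A
  widenʳ (inj₁ x) = inj₁ x
  widenʳ (inj₂ (e , _ , x)) = inj₂ (e , ∈-allFin e , x)

  ∣φ∣≤K : ∀ c → length (φ c) ≤ K
  ∣φ∣≤K c = ≤-trans (length≤concatMap (W 0) (W≥1 0) (φ c)) (≤-trans (proj₂ Kc-bound c) (≤-trans (m≤m+n Kc G) (m≤n+m _ G)))

  -- Descend until the window is cut by children; between its ends lie at most as many whole letters
  -- as φ e has. The level where this happens is arbitrary, which is the source of the factor J + 1
  -- in the count.
  inLetter : ∀ n J j e w {x y} → j ≤ suc J → length w ≡ n → W j e ≡ x ++ w ++ y → w ∈ allForms n J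
  inLetter n J zero e w {x} {y} _ len eq = ∈-++⁺ˡ (∈-concatMap⁺ (base₁ n) (lose (∈-allFin e)
    (subst (_∈ base₁ n e) got
      (∈-map⁺ (λ i → take n (drop i (W 0 e))) (∈-upTo⁺ (s≤s (≤-trans (≤-trans (length-++-≤ˡ x) (≤-reflexive (cong length (sym eq)))) (proj₂ Kw-bound e))))))))
    where
    got : take n (drop (length x) (W 0 e)) ≡ w
    got = trans (cong (λ z → take n (drop (length x) z)) eq) (trans (cong (take n) (drop-length x)) (trans (cong (λ k → take k (w ++ y)) (sym len)) (take-length w)))
  inLetter n J (suc j) e w {x} {y} le len eq with cut (W j) (φ e) {x} w {y} (trans (sym (stepW j e)) eq)
  ... | inj₁ (e′ , _ , x′ , y′ , eq′) = inLetter n J j e′ w {x′} {y′} (≤-trans (n≤1+n j) le) len eq′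
  ... | inj₂ (mkCut U₁ v U₂ q t eU ew _ _ qO tO) = ∈-level n J j w (s≤s⁻¹ le) (∈-forms n j w len
        (q , v , t , ew , ≤-trans (≤-trans (≤-trans (m≤m+n _ _) (≤-trans (m≤n+m _ (length U₁)) (≤-reflexive (sym (length-++₃ U₁ v U₂))))) (≤-trans (≤-reflexive (cong length (sym eU))) (∣φ∣≤K e))) (n≤1+n K) ,
          inj₂ (widenˡ qO) , inj₂ (widenʳ tO)))

  module _ (n M : ℕ) (jump : ∀ {τ} → τ ∈ types → ∀ m → M ≤ m → Jump τ L n m)
    (ready : LogReady I (suc n) M) (aDead : ∀ z → length z ≡ p → Dead z (reverse (W 0 a))) where
    open RunGap N L n M jump

    -- The letters of the window show their periodic blocks I levels further down, and that level
    -- has to be M, from which on `jump` applies.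
    J : ℕ
    J = I + M

    module _ (D : ℕ) {X w Y : Word s} (len : length w ≡ n) (U₁ v U₂ q t : Word s) (eU : iterM φ D (a ∷ []) ≡ U₁ ++ v ++ U₂)
      (ew : w ≡ q ++ W* J v ++ t) (eX : X ++ q ≡ W* J U₁) (eY : t ++ Y ≡ W* J U₂) where

      -- A fast letter would spell at least n + 1 letters inside a window of n; for this `ready` is
      -- stated with `suc n`.
      allSlow : All (Slow I) v
      allSlow = All.tabulate slow
        where
        slow : ∀ {c} → c ∈ v → Slow I c
        slow {c} m with proj₂ dichotomy c
        ... | inj₂ sl = sl
        ... | inj₁ fast with concatMap-∈ (W J) m
        ...   | x , y , eq = ⊥-elim (<⇒≱ (fast (suc n) J (≤-trans ready (m≤n+m M I))) (begin
                length (W J c)                          ≤⟨ ≤-trans (m≤m+n _ (length y)) (m≤n+m _ (length x)) ⟩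
                length x + (length (W J c) + length y)  ≡⟨ length-++₃ x (W J c) y ⟨
                length (x ++ W J c ++ y)                ≡⟨ cong length eq ⟨
                length (W* J v)                         ≤⟨ ≤-trans (m≤m+n _ (length t)) (m≤n+m _ (length q)) ⟩
                length q + (length (W* J v) + length t) ≡⟨ length-++₃ q (W* J v) t ⟨
                length (q ++ W* J v ++ t)               ≡⟨ cong length ew ⟨
                length w                                ≡⟨ len ⟩
                n                                       ∎))
          where open ≤-Reasoning

      W*-J : ∀ u → W* J u ≡ W* M (iterM φ I u)
      W*-J u = W*-iter I M u

      -- After I generations v′ contains a periodic block g₁g₂ with more than L letters in g₂.
      -- `halfPeriodic` at the boundary between g₁ and g₂ makes one half of the window periodic, and
      -- that half includes everything on its side of v′.
      claim : ∀ v₀ v′ v₃ → v ≡ v₀ ++ v′ ++ v₃ → K ≤ length v′ → OK (q ++ W* J v₀) ⊎ OK (W* J v₃ ++ t)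
      claim v₀ v′ v₃ ev lK with slowWord D a {U₁ ++ v₀} v′ {v₃ ++ U₂} (infix-trans v₀ v₃ {U₁} {U₂} ev eU) (All-infix v₀ v′ v₃ ev allSlow) lK
      ... | x , [] , y , eg , () , o , bg
      ... | x , g₁ ∷ g₂ , y , eg , s≤s lg , (z₀ , l₀ , z₁ , r₀) , b₁ ∷ b₂ with run-++⁻ z₀ (W 0 g₁) r₀
      ...   | z , r₁ , r₂ with halfPeriodic aDead (I + D) V₁ V₂ z {X} w₁ w₂ {Y} V₁≥1 lz eV e₁ e₂ lenw big
        where
        P = W* J v₀
        Q₁ = W* M (x ++ g₁ ∷ [])
        R = W* M (g₂ ++ y)
        S = W* J v₃
        A₀ = iterM φ I (U₁ ++ v₀)
        C₀ = iterM φ I (v₃ ++ U₂)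
        V₁ = A₀ ++ (x ++ g₁ ∷ [])
        V₂ = (g₂ ++ y) ++ C₀
        w₁ = q ++ P ++ Q₁
        w₂ = R ++ S ++ t
        lz : length z ≡ p
        lz = trans (run-length z₀ (W 0 g₁) r₁) l₀
        V₁≥1 : 1 ≤ length V₁
        V₁≥1 = ≤-trans (≤-trans (m≤n+m 1 (length x)) (≤-reflexive (sym (length-++ x)))) (length-++-≤ʳ (x ++ g₁ ∷ []) {A₀})
        eV : iterM φ (I + D) (a ∷ []) ≡ V₁ ++ V₂
        eV = begin
          iterM φ (I + D) (a ∷ [])                       ≡⟨ iterM-+ φ I D (a ∷ []) ⟩
          iterM φ I (iterM φ D (a ∷ []))                 ≡⟨ iterM-infix φ I (U₁ ++ v₀) v′ (v₃ ++ U₂) (infix-trans v₀ v₃ {U₁} {U₂} ev eU) ⟩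
          A₀ ++ iterM φ I v′ ++ C₀                       ≡⟨ cong (λ k → A₀ ++ k ++ C₀) eg ⟩
          A₀ ++ (x ++ g₁ ∷ g₂ ++ y) ++ C₀                ≡⟨ cong (A₀ ++_) (trans (++-assoc x (g₁ ∷ g₂ ++ y) C₀) (sym (++-assoc x (g₁ ∷ []) V₂))) ⟩
          A₀ ++ (x ++ g₁ ∷ []) ++ V₂                     ≡⟨ ++-assoc A₀ (x ++ g₁ ∷ []) V₂ ⟨
          V₁ ++ V₂                                       ∎
          where open ≡-Reasoning
        e₁ : X ++ w₁ ≡ W* M V₁
        e₁ = begin
          X ++ q ++ P ++ Q₁                ≡⟨ ++-assoc X q (P ++ Q₁) ⟨
          (X ++ q) ++ P ++ Q₁              ≡⟨ cong (_++ (P ++ Q₁)) eX ⟩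
          W* J U₁ ++ P ++ Q₁               ≡⟨ ++-assoc (W* J U₁) P Q₁ ⟨
          (W* J U₁ ++ P) ++ Q₁             ≡⟨ cong (_++ Q₁) (concatMap-++ (W J) U₁ v₀) ⟨
          W* J (U₁ ++ v₀) ++ Q₁            ≡⟨ cong (_++ Q₁) (W*-J (U₁ ++ v₀)) ⟩
          W* M A₀ ++ Q₁                    ≡⟨ concatMap-++ (W M) A₀ (x ++ g₁ ∷ []) ⟨
          W* M V₁                          ∎
          where open ≡-Reasoning
        e₂ : w₂ ++ Y ≡ W* M V₂
        e₂ = begin
          (R ++ S ++ t) ++ Y               ≡⟨ ++-assoc₃ R S t ⟩
          R ++ S ++ t ++ Y                 ≡⟨ cong (λ k → R ++ S ++ k) eY ⟩
          R ++ S ++ W* J U₂                ≡⟨ cong (R ++_) (concatMap-++ (W J) v₃ U₂) ⟨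
          R ++ W* J (v₃ ++ U₂)             ≡⟨ cong (R ++_) (W*-J (v₃ ++ U₂)) ⟩
          R ++ W* M C₀                     ≡⟨ concatMap-++ (W M) (g₂ ++ y) C₀ ⟨
          W* M V₂                          ∎
          where open ≡-Reasoning
        eQR : W* J v′ ≡ Q₁ ++ R
        eQR = trans (W*-J v′) (trans (cong (W* M) (trans eg (sym (++-assoc x (g₁ ∷ []) (g₂ ++ y))))) (concatMap-++ (W M) (x ++ g₁ ∷ []) (g₂ ++ y)))
        w≡ : w ≡ w₁ ++ w₂
        w≡ = begin
          w                                ≡⟨ ew ⟩
          q ++ W* J v ++ t                 ≡⟨ cong (λ k → q ++ k ++ t) (concatMap-infix (W J) v₀ v′ v₃ ev) ⟩
          q ++ (P ++ W* J v′ ++ S) ++ t    ≡⟨ cong (λ k → q ++ (P ++ k ++ S) ++ t) eQR ⟩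
          q ++ (P ++ (Q₁ ++ R) ++ S) ++ t  ≡⟨ cong (q ++_) (++-assoc₃ P (Q₁ ++ R) S) ⟩
          q ++ P ++ (Q₁ ++ R) ++ S ++ t    ≡⟨ cong (λ k → q ++ P ++ k) (++-assoc Q₁ R (S ++ t)) ⟩
          q ++ P ++ Q₁ ++ R ++ S ++ t      ≡⟨ ++-assoc₃ q P Q₁ ⟨
          w₁ ++ w₂                         ∎
          where open ≡-Reasoning
        lenw : length w₁ + length w₂ ≡ n
        lenw = trans (sym (length-++ w₁)) (trans (cong length (sym w≡)) len)
        big : L < hd z (W* M V₂)
        big = begin-strict
          L                                              <⟨ lg ⟩
          length g₂                                      ≤⟨ length≤concatMap (W M) (W≥1 M) g₂ ⟩
          length (W* M g₂)                               ≤⟨ m≤m+n _ _ ⟩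
          length (W* M g₂) + hd z₁ (W* M (y ++ C₀))      ≡⟨ hd-++-just z (W* M g₂) (trans (runʳ-const M g₂ z lz) r₂) ⟨
          hd z (W* M g₂ ++ W* M (y ++ C₀))               ≡⟨ cong (hd z) (concatMap-++ (W M) g₂ (y ++ C₀)) ⟨
          hd z (W* M (g₂ ++ y ++ C₀))                    ≡⟨ cong (λ k → hd z (W* M k)) (++-assoc g₂ y C₀) ⟨
          hd z (W* M V₂)                                 ∎
          where open ≤-Reasoning
      ...     | inj₁ o = inj₁ (OK-infix _ [] (q ++ W* J v₀) (sym (++-assoc q (W* J v₀) _)) o)
      ...     | inj₂ o = inj₂ (OK-infix _ (W* M (g₂ ++ y)) (W* J v₃ ++ t) (cong (W* M (g₂ ++ y) ++_) (sym (++-identityʳ _))) o)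

      qOf : Set
      qOf = SuffixOfLetter (W J) (allFin s) q
      tOf : Set
      tOf = PrefixOfLetter (W J) (allFin s) t

      module _ (qO : qOf) (tO : tOf) where

        split-at : ∀ (rest : Word s) → K ≤ length rest → K ≤ length (take K rest)
        split-at rest l = ≤-reflexive (sym (trans (length-take K rest) (m≤n⇒m⊓n≡m l)))

        take≤ : ∀ (rest : Word s) → length (take K rest) ≤ K
        take≤ rest = ≤-trans (≤-reflexive (length-take K rest)) (m⊓n≤m K _)

        -- Slide a block of K letters to the right, one letter at a time, as long as the claim
        -- yields a periodic left side. When it yields the right side, the last periodic left side
        -- and the new right side are separated by the block and one more letter.
        go : ∀ pre rest → v ≡ pre ++ rest → OK (q ++ W* J pre) → Form J w
        go pre rest ev o with length rest ≤? K
        ... | yes l = q ++ W* J pre , rest , t , trans ew (trans (cong (λ k → q ++ k ++ t) (trans (cong (W* J) ev) (concatMap-++ (W J) pre rest)))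
                (trans (cong (q ++_) (++-assoc (W* J pre) _ t)) (sym (++-assoc q (W* J pre) _)))) , ≤-trans l (n≤1+n K) , inj₁ o , inj₂ tO
        go pre [] ev o | no ¬l = ⊥-elim (¬l z≤n)
        go pre (c ∷ rest) ev o | no ¬l with claim (pre ++ c ∷ []) (take K rest) (drop K rest)
            (trans ev (trans (sym (++-assoc pre (c ∷ []) rest)) (cong ((pre ++ c ∷ []) ++_) (sym (take++drop≡id K rest))))) (split-at rest (s≤s⁻¹ (≰⇒> ¬l)))
        ...   | inj₁ o′ = go (pre ++ c ∷ []) rest (trans ev (sym (++-assoc pre (c ∷ []) rest))) o′
        ...   | inj₂ o′ = q ++ W* J pre , c ∷ take K rest , W* J (drop K rest) ++ t , eq , s≤s (take≤ rest) , inj₁ o , inj₁ o′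
          where
          eq : w ≡ (q ++ W* J pre) ++ W* J (c ∷ take K rest) ++ W* J (drop K rest) ++ t
          eq = trans ew (trans (cong (λ k → q ++ k ++ t) (concatMap-infix (W J) pre (c ∷ take K rest) (drop K rest) (trans ev (cong (λ k → pre ++ c ∷ k) (sym (take++drop≡id K rest))))))
            (trans (cong (q ++_) (++-assoc₃ (W* J pre) (W* J (c ∷ take K rest)) (W* J (drop K rest)))) (sym (++-assoc q (W* J pre) _))))

        form : Form J w
        form with length v ≤? K
        ... | yes l = q , v , t , ew , ≤-trans l (n≤1+n K) , inj₂ qO , inj₂ tO
        ... | no ¬l with claim [] (take K v) (drop K v) (sym (take++drop≡id K v)) (split-at v (<⇒≤ (≰⇒> ¬l)))
        ...   | inj₁ o = go [] v refl o
        ...   | inj₂ o = q , take K v , W* J (drop K v) ++ t , trans ew (cong (q ++_) (trans (cong (_++ t) (trans (cong (W* J) (sym (take++drop≡id K v))) (concatMap-++ (W J) (take K v) (drop K v)))) (++-assoc (W* J (take K v)) _ t))) ,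
                  ≤-trans (take≤ v) (n≤1+n K) , inj₂ qO , inj₁ o

    window : ∀ D {X} w {Y} → length w ≡ n → W (D + J) a ≡ X ++ w ++ Y → w ∈ allForms n J
    window D {X} w {Y} len eq with cut (W J) (iterM φ D (a ∷ [])) {X} w {Y} (trans (sym (W-iter D J a)) eq)
    ... | inj₁ (e , _ , x , y , eq′) = inLetter n J J e w {x} {y} (n≤1+n J) len eq′
    ... | inj₂ (mkCut U₁ v U₂ q t eU ew eX eY qO tO) = ∈-level n J J w ≤-refl (∈-forms n J w len
            (form D {X} {w} {Y} len U₁ v U₂ q t eU ew eX eY (widenˡ qO) (widenʳ tO)))

-- Lower bound

complexity≥ : ∀ {s} {β : InfWord s} {p n} → IsSubwordComplexity β p → ∀ {K} (start : Fin K → ℕ) →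
  (∀ i j → (∀ k → k < n → β (start i + k) ≡ β (start j + k)) → i ≡ j) → K ≤ p n
complexity≥ {s} {β} {p} {n} pc {K} start inj with pc n
... | ws , len , _ , mem = subst (K ≤_) len (Fin.injective⇒≤ {f = λ i → Any.index (member i)} injective)
  where
  window : Fin K → Vec (Fin s) n
  window i = Vec.tabulate (λ j → β (start i + toℕ j))
  member : ∀ i → window i ∈ ws
  member i = proj₂ (mem (window i)) (start i , λ j → Vec.lookup∘tabulate (λ j → β (start i + toℕ j)) j)
  injective : ∀ {i j} → Any.index (member i) ≡ Any.index (member j) → i ≡ j
  injective {i} {j} e = inj i j λ k k<n → subst (λ x → β (start i + x) ≡ β (start j + x)) (Fin.toℕ-fromℕ< k<n)
    (trans (sym (Vec.lookup∘tabulate (λ j → β (start i + toℕ j)) (fromℕ< k<n)))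
      (trans (cong (λ w → Vec.lookup w (fromℕ< k<n)) weq) (Vec.lookup∘tabulate (λ i → β (start j + toℕ i)) (fromℕ< k<n))))
    where
    weq : window i ≡ window j
    weq = trans (Any.lookup-index (member i)) (trans (cong (lookup ws) e) (sym (Any.lookup-index (member j))))

root : ∀ (f : ℕ → ℕ) n N → f 0 ≤ n → n < f N → ∃[ T ] f T ≤ n × n < f (suc T)
root f n zero lo hi = ⊥-elim (<⇒≱ hi lo)
root f n (suc N) lo hi with n <? f N
... | yes q = root f n N lo q
... | no ¬q = N , ≮⇒≥ ¬q , hi

-- Runs are recorded by the positions i with β i = β (i + p): a stretch of them strictly between two
-- exceptions. `room` allows a window to start before the left exception by a fixed fraction of g t.
record Family {s : ℕ} (β : InfWord s) (p k : ℕ) : Set where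
  field
    C t₀ : ℕ
    l g : ℕ → ℕ
    breakˡ : ∀ t → t₀ ≤ t → β (l t) ≢ β (l t + p)
    match  : ∀ t → t₀ ≤ t → ∀ i → l t < i → i < l t + g t → β i ≡ β (i + p)
    breakʳ : ∀ t → t₀ ≤ t → β (l t + g t) ≢ β (l t + g t + p)
    lo     : ∀ t → t₀ ≤ t → suc t ^ k ≤ C * g t
    hi     : ∀ t → t₀ ≤ t → g t ≤ C * suc t ^ k
    strict : ∀ t → t₀ ≤ t → g t < g (suc t)
    room   : ∀ t → t₀ ≤ t → g t ≤ C * l t

module Lower {s : ℕ} {β : InfWord s} {p : ℕ → ℕ} (pc : IsSubwordComplexity β p) (d k : ℕ) (k≥1 : 1 ≤ k) (fam : Family β d k) where
  open Family fam

  g-strict : ∀ {t u} → t₀ ≤ t → t < u → g t < g u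
  g-strict {t} {u} l₀ t<u = subst (λ x → g t < g x) (m∸n+n≡m t<u) (go (u ∸ suc t))
    where
    go : ∀ k → g t < g (k + suc t)
    go zero = strict t l₀
    go (suc k) = <-trans (go k) (strict (k + suc t) (≤-trans l₀ (≤-trans (n≤1+n t) (m≤n+m (suc t) k))))

  g-injective : ∀ {t u} → t₀ ≤ t → t₀ ≤ u → g t ≡ g u → t ≡ u
  g-injective {t} {u} lt lu e with <-cmp t u
  ... | tri< q _ _ = ⊥-elim (<-irrefl e (g-strict lt q))
  ... | tri≈ _ q _ = q
  ... | tri> _ _ q = ⊥-elim (<-irrefl (sym e) (g-strict lu q))

  -- Which letters of a window agree with the letter d places further determines the offset and
  -- the length of the run.
  module Same (n t u o o′ : ℕ) (t≥ : t₀ ≤ t) (u≥ : t₀ ≤ u) (o≤ : o ≤ l t) (o′≤ : o′ ≤ l u)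
    (fit : o + g t + d < n) (fit′ : o′ + g u + d < n)
    (eq : ∀ k → k < n → β (l t ∸ o + k) ≡ β (l u ∸ o′ + k)) where

    pos : ∀ {a b} c → b ≤ a → a ∸ b + (b + c) ≡ a + c
    pos {a} {b} c b≤a = trans (sym (+-assoc (a ∸ b) b c)) (cong (_+ c) (m∸n+n≡m b≤a))

    transfer : ∀ x → x + d < n → β (l t ∸ o + x) ≡ β (l t ∸ o + x + d) → β (l u ∸ o′ + x) ≡ β (l u ∸ o′ + x + d)
    transfer x x<n e = trans (sym (eq x (≤-<-trans (m≤m+n x d) x<n))) (trans e
      (trans (cong β (+-assoc (l t ∸ o) x d)) (trans (eq (x + d) x<n) (cong β (sym (+-assoc (l u ∸ o′) x d))))))

    not-between : o < o′ → o′ < o + g t → ⊥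
    not-between lt gt = breakˡ u u≥ (subst (λ x → β x ≡ β (x + d)) (m∸n+n≡m o′≤)
      (transfer o′ (≤-<-trans (+-monoˡ-≤ d (m≤m+n o′ (g u))) fit′)
        (match t t≥ (l t ∸ o + o′) (subst (_< l t ∸ o + o′) (m∸n+n≡m o≤) (+-monoʳ-< (l t ∸ o) lt))
          (subst (l t ∸ o + o′ <_) (pos (g t) o≤) (+-monoʳ-< (l t ∸ o) gt)))))

    not-longer : o ≡ o′ → g u < g t → ⊥
    not-longer refl lt = breakʳ u u≥ (subst (λ x → β x ≡ β (x + d)) (pos (g u) o′≤)
      (transfer (o + g u) fit′ (match t t≥ (l t ∸ o + (o + g u))
        (subst (l t <_) (sym (pos (g u) o≤)) (m<m+n (l t) (≤-trans (s≤s z≤n) gu≥1)))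
        (subst (_< l t + g t) (sym (pos (g u) o≤)) (+-monoʳ-< (l t) lt)))))
      where
      gu≥1 : 1 ≤ g u
      gu≥1 with g u in e
      ... | suc _ = s≤s z≤n
      ... | zero = ⊥-elim (<⇒≱ (1≤^ u k) (≤-trans (lo u u≥) (≤-reflexive (trans (cong (C *_) e) (*-zeroʳ C)))))

  -- The windows are indexed by an offset below O and a run t in [T, 2T). Offsets below g t differ
  -- too little for one left exception to escape the other stretch, and the last condition keeps
  -- both exceptions, with the letters d further on, inside the window.
  count : ∀ n T O → t₀ ≤ T → (∀ t → T ≤ t → t < T + T → O ≤ g t × O ≤ l t × O + g t + d < n) → O * T ≤ p n
  count n T O T≥ cond = complexity≥ {β = β} pc start injective
    where
    off tm : Fin (O * T) → ℕ
    off i = toℕ (proj₁ (Fin.remQuot {O} T i))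
    tm i = T + toℕ (proj₂ (Fin.remQuot {O} T i))
    off< : ∀ i → off i < O
    off< i = Fin.toℕ<n (proj₁ (Fin.remQuot {O} T i))
    C′ : ∀ i → O ≤ g (tm i) × O ≤ l (tm i) × O + g (tm i) + d < n
    C′ i = cond (tm i) (m≤m+n T _) (+-monoʳ-< T (Fin.toℕ<n (proj₂ (Fin.remQuot {O} T i))))
    t≥ : ∀ i → t₀ ≤ tm i
    t≥ i = ≤-trans T≥ (m≤m+n T _)
    o≤ : ∀ i → off i ≤ l (tm i)
    o≤ i = ≤-trans (<⇒≤ (off< i)) (proj₁ (proj₂ (C′ i)))
    fit : ∀ i → off i + g (tm i) + d < n
    fit i = ≤-<-trans (+-monoˡ-≤ d (+-monoˡ-≤ (g (tm i)) (<⇒≤ (off< i)))) (proj₂ (proj₂ (C′ i)))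
    start : Fin (O * T) → ℕ
    start i = l (tm i) ∸ off i
    injective : ∀ i j → (∀ k → k < n → β (start i + k) ≡ β (start j + k)) → i ≡ j
    injective i j eq = trans (sym (Fin.combine-remQuot {O} T i)) (trans (cong₂ combine offs tms) (Fin.combine-remQuot {O} T j))
      where
      module A = Same n (tm i) (tm j) (off i) (off j) (t≥ i) (t≥ j) (o≤ i) (o≤ j) (fit i) (fit j) eq
      module B = Same n (tm j) (tm i) (off j) (off i) (t≥ j) (t≥ i) (o≤ j) (o≤ i) (fit j) (fit i) (λ k q → sym (eq k q))
      o≡ : off i ≡ off j
      o≡ with ≤-total (off i) (off j)
      ... | inj₁ q with m≤n⇒m<n∨m≡n q
      ...   | inj₂ e = e
      ...   | inj₁ lt = ⊥-elim (A.not-between lt (≤-trans (off< j) (≤-trans (proj₁ (C′ i)) (m≤n+m _ (off i)))))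
      o≡ | inj₂ q with m≤n⇒m<n∨m≡n q
      ...   | inj₂ e = sym e
      ...   | inj₁ lt = ⊥-elim (B.not-between lt (≤-trans (off< i) (≤-trans (proj₁ (C′ j)) (m≤n+m _ (off j)))))
      g≡ : g (tm i) ≡ g (tm j)
      g≡ = ≤-antisym (≮⇒≥ (A.not-longer o≡)) (≮⇒≥ (B.not-longer (sym o≡)))
      offs : proj₁ (Fin.remQuot {O} T i) ≡ proj₁ (Fin.remQuot {O} T j)
      offs = Fin.toℕ-injective o≡
      tms : proj₂ (Fin.remQuot {O} T i) ≡ proj₂ (Fin.remQuot {O} T j)
      tms = Fin.toℕ-injective (+-cancelˡ-≡ T _ _ (g-injective (t≥ i) (t≥ j) g≡))

  C≥1 : 1 ≤ C
  C≥1 with C | lo t₀ ≤-refl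
  ... | suc _ | _ = s≤s z≤n
  ... | zero | q = ⊥-elim (<⇒≱ (1≤^ t₀ k) q)

  -- T is chosen with n of order E·T^k, and O = T^k / Dv. The summands of E pay for O, g t and d; Dv
  -- is C² because O must be bounded first by g t through `lo` and then by l t through `room`.
  E Dv : ℕ
  E = suc (C * 2 ^ k) + suc d
  Dv = C * C

  private instance
    Dv≢0 : NonZero Dv
    Dv≢0 = >-nonZero (*-mono-≤ C≥1 C≥1)

  lower : ∃[ C′ ] ∃[ N ] ∀ n → N ≤ n → n ^ suc k ≤ C′ * p n ^ k
  lower = (E * 2 ^ k) ^ suc k * (2 * Dv) ^ k , E * suc (t₀ + Dv) ^ k , bound
    where
    open ≤-Reasoning
    bound : ∀ n → E * suc (t₀ + Dv) ^ k ≤ n → n ^ suc k ≤ (E * 2 ^ k) ^ suc k * (2 * Dv) ^ k * p n ^ k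
    bound n big with root (λ T → E * T ^ k) n (suc n) zeroCase topCase
      where
      zeroCase : E * 0 ^ k ≤ n
      zeroCase = ≤-trans (≤-reflexive (trans (cong (E *_) (0^k k k≥1)) (*-zeroʳ E))) z≤n
        where
        0^k : ∀ k → 1 ≤ k → 0 ^ k ≡ 0
        0^k (suc k) _ = refl
      topCase : n < E * suc n ^ k
      topCase = ≤-trans (≤-trans (≤-reflexive (sym (*-identityʳ (suc n)))) (^-monoʳ-≤ (suc n) k≥1)) (m≤n*m (suc n ^ k) E)
    ... | T , low , high = begin
        n ^ suc k                                        ≤⟨ ^-monoˡ-≤ (suc k) n≤ ⟩
        (E * 2 ^ k * T ^ k) ^ suc k                      ≡⟨ ^-distrib-* (E * 2 ^ k) (T ^ k) (suc k) ⟩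
        (E * 2 ^ k) ^ suc k * (T ^ k) ^ suc k            ≡⟨ cong ((E * 2 ^ k) ^ suc k *_) swapPow ⟩
        (E * 2 ^ k) ^ suc k * (T ^ k * T) ^ k            ≤⟨ *-monoʳ-≤ ((E * 2 ^ k) ^ suc k) (^-monoˡ-≤ k TO) ⟩
        (E * 2 ^ k) ^ suc k * (2 * Dv * p n) ^ k         ≡⟨ cong ((E * 2 ^ k) ^ suc k *_) (^-distrib-* (2 * Dv) (p n) k) ⟩
        (E * 2 ^ k) ^ suc k * ((2 * Dv) ^ k * p n ^ k)   ≡⟨ *-assoc ((E * 2 ^ k) ^ suc k) _ _ ⟨
        (E * 2 ^ k) ^ suc k * (2 * Dv) ^ k * p n ^ k     ∎
      where
      -- The threshold on n pushes T past t₀, and past Dv so that O is positive and rounding costs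
      -- at most a factor 2.
      T> : t₀ + Dv < T
      T> with suc (t₀ + Dv) ≤? T
      ... | yes q = q
      ... | no ¬q = ⊥-elim (<⇒≱ high (≤-trans (*-monoʳ-≤ E (^-monoˡ-≤ k (≰⇒> ¬q))) big))
      T≥1 : 1 ≤ T
      T≥1 = ≤-trans (s≤s z≤n) T>
      O = T ^ k / Dv
      O-hi : O * Dv ≤ T ^ k
      O-hi = m/n*n≤m (T ^ k) Dv
      T≤T^k : T ≤ T ^ k
      T≤T^k = ≤-trans (≤-reflexive (sym (*-identityʳ T))) (^-monoʳ-≤ T {{>-nonZero T≥1}} k≥1)
      O-lo : T ^ k ≤ 2 * Dv * O
      O-lo = begin
        T ^ k                        ≡⟨ m≡m%n+[m/n]*n (T ^ k) Dv ⟩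
        T ^ k Data.Nat.% Dv + O * Dv ≤⟨ +-monoˡ-≤ (O * Dv) (<⇒≤ (m%n<n (T ^ k) Dv)) ⟩
        Dv + O * Dv                  ≤⟨ +-monoˡ-≤ (O * Dv) (≤-trans (≤-reflexive (sym (*-identityˡ Dv))) (*-monoˡ-≤ Dv O≥1)) ⟩
        O * Dv + O * Dv              ≡⟨ cong (O * Dv +_) (sym (+-identityʳ (O * Dv))) ⟩
        2 * (O * Dv)                 ≡⟨ cong (2 *_) (*-comm O Dv) ⟩
        2 * (Dv * O)                 ≡⟨ *-assoc 2 Dv O ⟨
        2 * Dv * O                   ∎
        where
        O≥1 : 1 ≤ O
        O≥1 with O in e
        ... | suc _ = s≤s z≤n
        ... | zero = ⊥-elim (<⇒≱ (m%n<n (T ^ k) Dv) (≤-trans (≤-trans (≤-trans (m≤n+m Dv t₀) (<⇒≤ T>)) T≤T^k)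
                (≤-reflexive (trans (m≡m%n+[m/n]*n (T ^ k) Dv) (trans (cong (λ x → T ^ k Data.Nat.% Dv + x * Dv) e) (+-identityʳ _))))))
      cond : ∀ t → T ≤ t → t < T + T → O ≤ g t × O ≤ l t × O + g t + d < n
      cond t T≤t t<2T = O≤g , O≤l , fits
        where
        t≥t₀ : t₀ ≤ t
        t≥t₀ = ≤-trans (≤-trans (m≤m+n t₀ Dv) (<⇒≤ T>)) T≤t
        CCO≤Cg : C * (C * O) ≤ C * g t
        CCO≤Cg = begin
          C * (C * O)   ≡⟨ *-assoc C C O ⟨
          Dv * O        ≡⟨ *-comm Dv O ⟩
          O * Dv        ≤⟨ O-hi ⟩
          T ^ k         ≤⟨ ^-monoˡ-≤ k (≤-trans T≤t (n≤1+n t)) ⟩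
          suc t ^ k     ≤⟨ lo t t≥t₀ ⟩
          C * g t       ∎
        CO≤g : C * O ≤ g t
        CO≤g = *-cancelˡ-≤ C {{>-nonZero C≥1}} CCO≤Cg
        O≤g : O ≤ g t
        O≤g = ≤-trans (m≤n*m O C {{>-nonZero C≥1}}) CO≤g
        O≤l : O ≤ l t
        O≤l = *-cancelˡ-≤ C {{>-nonZero C≥1}} (≤-trans CO≤g (room t t≥t₀))
        fits : O + g t + d < n
        fits = begin-strict
          O + g t + d                              <⟨ +-mono-≤-< (+-mono-≤ O≤T gT) dT ⟩
          T ^ k + C * 2 ^ k * T ^ k + suc d * T ^ k ≡⟨ cong (_+ suc d * T ^ k) (cong (_+ C * 2 ^ k * T ^ k) (sym (*-identityˡ (T ^ k)))) ⟩
          1 * T ^ k + C * 2 ^ k * T ^ k + suc d * T ^ k ≡⟨ cong (_+ suc d * T ^ k) (sym (*-distribʳ-+ (T ^ k) 1 (C * 2 ^ k))) ⟩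
          suc (C * 2 ^ k) * T ^ k + suc d * T ^ k  ≡⟨ *-distribʳ-+ (T ^ k) (suc (C * 2 ^ k)) (suc d) ⟨
          E * T ^ k                                ≤⟨ low ⟩
          n                                        ∎
          where
          O≤T : O ≤ T ^ k
          O≤T = ≤-trans (m≤m*n O Dv) O-hi
          gT : g t ≤ C * 2 ^ k * T ^ k
          gT = begin
            g t                   ≤⟨ hi t t≥t₀ ⟩
            C * suc t ^ k         ≤⟨ *-monoʳ-≤ C (^-monoˡ-≤ k (≤-trans t<2T (≤-reflexive (cong (T +_) (sym (+-identityʳ T)))))) ⟩
            C * (2 * T) ^ k       ≡⟨ cong (C *_) (^-distrib-* 2 T k) ⟩
            C * (2 ^ k * T ^ k)   ≡⟨ *-assoc C (2 ^ k) (T ^ k) ⟨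
            C * 2 ^ k * T ^ k     ∎
          dT : d < suc d * T ^ k
          dT = ≤-trans (≤-reflexive (sym (*-identityʳ (suc d)))) (*-monoʳ-≤ (suc d) (≤-trans T≥1 T≤T^k))
      TO : T ^ k * T ≤ 2 * Dv * p n
      TO = begin
        T ^ k * T            ≤⟨ *-monoˡ-≤ T O-lo ⟩
        2 * Dv * O * T       ≡⟨ *-assoc (2 * Dv) O T ⟩
        2 * Dv * (O * T)     ≤⟨ *-monoʳ-≤ (2 * Dv) (count n T O (≤-trans (m≤m+n t₀ Dv) (<⇒≤ T>)) cond) ⟩
        2 * Dv * p n         ∎
      n≤ : n ≤ E * 2 ^ k * T ^ k
      n≤ = begin
        n                          ≤⟨ <⇒≤ high ⟩
        E * suc T ^ k              ≤⟨ *-monoʳ-≤ E (^-monoˡ-≤ k (≤-trans (+-monoˡ-≤ T T≥1) (≤-reflexive (cong (T +_) (sym (+-identityʳ T)))))) ⟩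
        E * (2 * T) ^ k            ≡⟨ cong (E *_) (^-distrib-* 2 T k) ⟩
        E * (2 ^ k * T ^ k)        ≡⟨ *-assoc E (2 ^ k) (T ^ k) ⟨
        E * 2 ^ k * T ^ k          ∎
      swapPow : (T ^ k) ^ suc k ≡ (T ^ k * T) ^ k
      swapPow = begin-equality
        (T ^ k) ^ suc k            ≡⟨ *-comm (T ^ k) _ ⟩
        (T ^ k) ^ k * T ^ k        ≡⟨ ^-distrib-* (T ^ k) T k ⟨
        (T ^ k * T) ^ k            ∎

-- Maximal runs seen as stretches of agreement in β

nth : ∀ {A : Set} → List A → ℕ → Maybe A
nth []      i       = nothing
nth (x ∷ u) zero    = just x
nth (x ∷ u) (suc i) = nth u i

nth-++ˡ : ∀ {A : Set} (u : List A) {v} i → i < length u → nth (u ++ v) i ≡ nth u i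
nth-++ˡ (x ∷ u) zero    _       = refl
nth-++ˡ (x ∷ u) (suc i) (s≤s p) = nth-++ˡ u i p

nth-++ʳ : ∀ {A : Set} (u : List A) {v} i → nth (u ++ v) (length u + i) ≡ nth v i
nth-++ʳ []      i = refl
nth-++ʳ (x ∷ u) i = nth-++ʳ u i

nth-prefix : ∀ {s} (u : Word s) {σ : InfWord s} → PrefixOf u σ → ∀ i → i < length u → nth u i ≡ just (σ i)
nth-prefix (x ∷ u) h zero    _       = cong just (h Fin.zero)
nth-prefix (x ∷ u) {σ} h (suc i) (s≤s p) = nth-prefix u {σ ∘ suc} (λ j → h (Fin.suc j)) i p

prefix-++ʳ : ∀ {s} (u : Word s) {v} {σ : InfWord s} → PrefixOf (u ++ v) σ → PrefixOf v (λ j → σ (length u + j))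
prefix-++ʳ [] h = h
prefix-++ʳ (x ∷ u) {v} {σ} h = prefix-++ʳ u {v} {σ ∘ suc} (λ j → h (Fin.suc j))

prefix-++ˡ : ∀ {s} (u : Word s) {v} {σ : InfWord s} → PrefixOf (u ++ v) σ → PrefixOf u σ
prefix-++ˡ (x ∷ u) h Fin.zero = h Fin.zero
prefix-++ˡ (x ∷ u) {v} {σ} h (Fin.suc i) = prefix-++ˡ u {v} {σ ∘ suc} (λ j → h (Fin.suc j)) i

record Isolated {s : ℕ} (β : InfWord s) (p l g : ℕ) : Set where
  field
    breakˡ : β l ≢ β (l + p)
    match  : ∀ i → l < i → i < l + g → β i ≡ β (i + p)
    breakʳ : β (l + g) ≢ β (l + g + p)

-- The last letter y′ of the initial state is the p-th letter of G and what the period demands in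
-- place of x′; y is what it demands in place of x. Inside G there are |G| - p agreements at
-- distance p, hence the right exception lies |G| - p + 1 after the left one.
isolated : ∀ {s} {β : InfWord s} p (X : Word s) x′ G x X₂ ζ y t₁ r y′ → PrefixOf (X ++ x′ ∷ G ++ x ∷ X₂) β →
  run ζ G ≡ just (y ∷ t₁) → x ≢ y → ζ ≡ r ++ y′ ∷ [] → x′ ≢ y′ → length ζ ≡ p → p ≤ length G →
  Isolated β p (length X) (suc (length G ∸ p))
isolated {s} {β} p X x′ G x X₂ ζ y t₁ r y′ pre run≡ x≢y ζ≡ x′≢y′ lζ p≤ = record
  { breakˡ = λ e → x′≢y′ (trans x′≡ (trans e (sym y′≡)))
  ; match = matches
  ; breakʳ = λ e → x≢y (trans x≡ (trans (cong β idx) (trans (sym e) (sym y≡)))) }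
  where
  l = length X
  L = length G
  τ : InfWord s
  τ j = β (l + j)
  σ : InfWord s
  σ j = β (l + suc j)
  preτ : PrefixOf (x′ ∷ G ++ x ∷ X₂) τ
  preτ = prefix-++ʳ X {x′ ∷ G ++ x ∷ X₂} {β} pre
  preσ : PrefixOf (G ++ x ∷ X₂) σ
  preσ j = preτ (Fin.suc j)
  preG : PrefixOf G σ
  preG = prefix-++ˡ G {x ∷ X₂} {σ} preσ
  rot : ζ ++ G ≡ G ++ y ∷ t₁
  rot = run-rotate ζ G run≡
  shift : ∀ i → nth G i ≡ nth (G ++ y ∷ t₁) (p + i)
  shift i = trans (sym (nth-++ʳ ζ i)) (trans (cong (λ k → nth (ζ ++ G) (k + i)) lζ) (cong (λ u → nth u (p + i)) rot))
  x′≡ : x′ ≡ β l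
  x′≡ = trans (preτ Fin.zero) (cong β (+-identityʳ l))
  x≡ : x ≡ σ L
  x≡ = just-injective (trans (sym (trans (cong (nth (G ++ x ∷ X₂)) (sym (+-identityʳ L))) (nth-++ʳ G 0)))
    (nth-prefix (G ++ x ∷ X₂) {σ} preσ L (≤-trans (≤-reflexive (+-comm 1 L)) (≤-trans (+-monoʳ-≤ L (s≤s z≤n)) (≤-reflexive (sym (length-++ G)))))))
  p≡ : p ≡ suc (length r)
  p≡ = trans (sym lζ) (trans (cong length ζ≡) (trans (length-++ r) (+-comm (length r) 1)))
  r<L : length r < L
  r<L = subst (_≤ L) p≡ p≤
  y′≡ : y′ ≡ β (l + p)
  y′≡ = just-injective (begin
    just y′                              ≡⟨ nth-++ʳ r {y′ ∷ []} 0 ⟨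
    nth (r ++ y′ ∷ []) (length r + 0)    ≡⟨ cong (λ u → nth u (length r + 0)) ζ≡ ⟨
    nth ζ (length r + 0)                 ≡⟨ cong (nth ζ) (+-identityʳ (length r)) ⟩
    nth ζ (length r)                     ≡⟨ nth-++ˡ ζ (length r) (≤-reflexive (sym (trans lζ p≡))) ⟨
    nth (ζ ++ G) (length r)              ≡⟨ cong (λ u → nth u (length r)) rot ⟩
    nth (G ++ y ∷ t₁) (length r)         ≡⟨ nth-++ˡ G (length r) r<L ⟩
    nth G (length r)                     ≡⟨ nth-prefix G {σ} preG (length r) r<L ⟩
    just (σ (length r))                  ≡⟨ cong (λ k → just (β (l + k))) p≡ ⟨
    just (β (l + p))                     ∎)
    where open ≡-Reasoning
  L∸p<L : L ∸ p < L
  L∸p<L = ∸-monoʳ-< {L} {p} {0} (subst (0 <_) (sym p≡) (s≤s z≤n)) p≤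
  y≡ : y ≡ β (l + suc (L ∸ p))
  y≡ = just-injective (begin
    just y                               ≡⟨ nth-++ʳ G {y ∷ t₁} 0 ⟨
    nth (G ++ y ∷ t₁) (L + 0)            ≡⟨ cong (nth (G ++ y ∷ t₁)) (trans (+-identityʳ L) (sym (m+[n∸m]≡n p≤))) ⟩
    nth (G ++ y ∷ t₁) (p + (L ∸ p))      ≡⟨ shift (L ∸ p) ⟨
    nth G (L ∸ p)                        ≡⟨ nth-prefix G {σ} preG (L ∸ p) L∸p<L ⟩
    just (σ (L ∸ p))                     ∎)
    where open ≡-Reasoning
  idx : l + suc L ≡ l + suc (L ∸ p) + p
  idx = trans (cong (λ k → l + suc k) (sym (m∸n+n≡m p≤))) (sym (+-assoc l (suc (L ∸ p)) p))
  matches : ∀ i → l < i → i < l + suc (L ∸ p) → β i ≡ β (i + p)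
  matches i l<i i< = subst (λ k → β k ≡ β (k + p)) (trans (+-suc l j) (m+[n∸m]≡n l<i))
    (just-injective (begin
      just (σ j)                     ≡⟨ nth-prefix G {σ} preG j (≤-<-trans (m≤m+n j p) j+p<) ⟨
      nth G j                        ≡⟨ shift j ⟩
      nth (G ++ y ∷ t₁) (p + j)      ≡⟨ cong (nth (G ++ y ∷ t₁)) (+-comm p j) ⟩
      nth (G ++ y ∷ t₁) (j + p)      ≡⟨ nth-++ˡ G (j + p) j+p< ⟩
      nth G (j + p)                  ≡⟨ nth-prefix G {σ} preG (j + p) j+p< ⟩
      just (σ (j + p))               ≡⟨ cong (λ k → just (β k)) (sym (+-assoc l (suc j) p)) ⟩
      just (β (l + suc j + p))       ∎))
    where
    open ≡-Reasoning
    j = i ∸ suc l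
    j<L∸p : j < L ∸ p
    j<L∸p = +-cancelˡ-< (suc l) j (L ∸ p) (subst₂ _<_ (sym (m+[n∸m]≡n l<i)) (+-suc l (L ∸ p)) i<)
    j+p< : j + p < L
    j+p< = subst (j + p <_) (m∸n+n≡m p≤) (+-monoˡ-< p j<L∸p)

hd≤length : ∀ {s} (z X : Word s) → hd z X ≤ length X
hd≤length z [] = z≤n
hd≤length z (x ∷ X) with step z x
... | just z′ = s≤s (hd≤length z′ X)
... | nothing = z≤n

-- Placing the runs of one type in β

module BuildFamily {s : ℕ} {β : InfWord s} (N : NSys β) (τ : Runs.Type N) (dead : Runs.DeadT N τ)
  (k : ℕ) (k≥1 : 1 ≤ k) (ℓ-poly : Poly (Runs.lenOf N τ) k) where
  open NSys N
  open Runs N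
  open Poly ℓ-poly renaming (C to C₁; m₀ to m₁)

  e = proj₁ τ
  z = code τ
  u₀ = left τ
  u₁ = right τ
  lz = proj₁ dead
  ℓ = lenOf τ

  φe≡ : φ e ≡ u₀ ++ u₁
  φe≡ = sym (take++drop≡id (proj₁ (proj₂ τ)) (φ e))

  W-split : ∀ t → W (suc t) e ≡ W* t u₀ ++ W* t u₁
  W-split t = trans (stepW t e) (trans (cong (W* t) φe≡) (concatMap-++ (W t) u₀ u₁))

  tl : ℕ → ℕ
  tl t = hd (reverse z) (reverse (W* t u₀))

  g : ℕ → ℕ
  g t = suc (ℓ t ∸ p)

  record Occurrence (t m : ℕ) (A : Word s) : Set where
    field
      l    : ℕ
      iso  : Isolated β p l (g t)
      mid  : l + suc (tl t) ≡ length A + length (W* t u₀)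
      final : l + g t + p < length A + length (W (suc t) e)

  -- Both readings break off inside `W (suc t) e`, so each occurrence of this word contains the
  -- whole run with its two mismatches, whatever surrounds it.
  occurrence : ∀ t m A B → p ≤ ℓ t → W m a ≡ A ++ W (suc t) e ++ B → Occurrence t m A
  occurrence t m A B p≤ℓ eq
    with hd-stop z (W* t u₁) (len≥1 z lz) (trans (runʳ-const t u₁ z lz) (proj₂ (proj₂ dead)))
       | hd-stop (reverse z) (reverse (W* t u₀)) (len≥1 (reverse z) lz̄) (trans (runˡ-const t u₀ (reverse z) lz̄) (proj₁ (proj₂ dead)))
    where lz̄ = trans (length-reverse z) lz
  ... | X₁ , x , X₂ , y , t₁ , eX , lX , rX , x≢y | Z₁ , x′ , Z₂ , y′ , t′ , eZ , lZ , rZ , x′≢y′ = record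
    { l = length P
    ; iso = subst (λ k → Isolated β p (length P) (suc (k ∸ p))) lG
        (isolated p P x′ G x (X₂ ++ B) (reverse (y′ ∷ t′)) y t₁ (reverse t′) y′ (subst (λ u → PrefixOf u β) eqW (pre m)) runG x≢y (unfold-reverse y′ t′) x′≢y′
          (trans (length-reverse (y′ ∷ t′)) (trans (run-length (reverse z) Z₁ rZ) lz̄)) (subst (p ≤_) (sym lG) p≤ℓ))
    ; mid = trans (cong (_+ suc (tl t)) (trans (length-++ A) (cong (length A +_) (length-reverse Z₂)))) (trans (+-assoc (length A) (length Z₂) _)
        (cong (length A +_) (trans (+-comm (length Z₂) _) (trans (cong (λ k → suc k + length Z₂) (sym lZ)) (trans (sym (+-suc (length Z₁) (length Z₂)))
          (trans (sym (length-++ Z₁)) (trans (cong length (sym eZ)) (length-reverse (W* t u₀)))))))))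
    ; final = subst₂ _<_ (sym lastEq) (length-++ A) (subst (λ u → length P + suc (length G) < length (A ++ u)) (sym We)
        (subst (λ u → length P + suc (length G) < length u) (++-assoc A (reverse Z₂) _)
          (subst (length P + suc (length G) <_) (sym (length-++ P)) (+-monoʳ-< (length P) (s≤s (subst (length G <_) (sym (length-++ G)) (m<m+n (length G) (s≤s z≤n)))))))) }
    where
    lz̄ = trans (length-reverse z) lz
    G = reverse Z₁ ++ X₁
    P = A ++ reverse Z₂
    lG : length G ≡ ℓ t
    lG = trans (length-++ (reverse Z₁)) (cong₂ _+_ (trans (length-reverse Z₁) lZ) lX)
    u₀≡ : W* t u₀ ≡ reverse Z₂ ++ x′ ∷ reverse Z₁
    u₀≡ = trans (sym (reverse-involutive (W* t u₀))) (trans (cong reverse eZ) (trans (reverse-++ Z₁ (x′ ∷ Z₂))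
      (trans (cong (_++ reverse Z₁) (unfold-reverse x′ Z₂)) (++-assoc (reverse Z₂) (x′ ∷ []) (reverse Z₁)))))
    We : W (suc t) e ≡ reverse Z₂ ++ x′ ∷ G ++ x ∷ X₂
    We = trans (W-split t) (trans (cong₂ _++_ u₀≡ eX) (trans (++-assoc (reverse Z₂) (x′ ∷ reverse Z₁) _)
      (cong (λ u → reverse Z₂ ++ x′ ∷ u) (sym (++-assoc (reverse Z₁) X₁ (x ∷ X₂))))))
    eqW : W m a ≡ P ++ x′ ∷ G ++ x ∷ X₂ ++ B
    eqW = trans eq (trans (cong (λ u → A ++ u ++ B) We) (trans (cong (A ++_) (trans (++-assoc (reverse Z₂) (x′ ∷ G ++ x ∷ X₂) B)
      (cong (λ u → reverse Z₂ ++ x′ ∷ u) (++-assoc G (x ∷ X₂) B)))) (sym (++-assoc A (reverse Z₂) _))))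
    runG : run (reverse (y′ ∷ t′)) G ≡ just (y ∷ t₁)
    runG = trans (run-++-just (reverse (y′ ∷ t′)) (reverse Z₁)
      (trans (run-reverse (reverse z) Z₁ (len≥1 (reverse z) lz̄) rZ) (cong just (reverse-involutive z)))) rX
    lastEq : length P + g t + p ≡ length P + suc (length G)
    lastEq = trans (+-assoc (length P) (g t) p) (cong (λ k → length P + suc k) (trans (m∸n+n≡m p≤ℓ) (sym lG)))

  ℓ≤W : ∀ t → ℓ t ≤ length (W (suc t) e)
  ℓ≤W t = ≤-trans (+-mono-≤ (≤-trans (hd≤length (reverse z) (reverse (W* t u₀))) (≤-reflexive (length-reverse (W* t u₀)))) (hd≤length z (W* t u₁)))
    (≤-reflexive (trans (sym (length-++ (W* t u₀))) (cong length (sym (W-split t)))))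

  C₁≥1 : 1 ≤ C₁
  C₁≥1 with C₁ | lo m₁ ≤-refl
  ... | suc _ | _ = s≤s z≤n
  ... | zero | q = ⊥-elim (<⇒≱ (1≤^ m₁ k) q)

  t₁ : ℕ
  t₁ = m₁ + C₁ * p

  p≤ℓ : ∀ t → t₁ ≤ t → p ≤ ℓ t
  p≤ℓ t q = *-cancelˡ-≤ C₁ {{>-nonZero C₁≥1}} (≤-trans (≤-trans (m≤n+m (C₁ * p) m₁) (≤-trans q (n≤1+n t)))
    (≤-trans (≤-trans (≤-reflexive (sym (*-identityʳ (suc t)))) (^-monoʳ-≤ (suc t) k≥1)) (lo t (≤-trans (m≤m+n m₁ _) q))))

  growthStep : ∀ t → t₁ ≤ t → ℓ (suc t) ≤ C₁ * 2 ^ k * C₁ * ℓ t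
  growthStep t q = begin
    ℓ (suc t)                        ≤⟨ hi (suc t) ⟩
    C₁ * suc (suc t) ^ k             ≤⟨ *-monoʳ-≤ C₁ (suc-suc-^ t k) ⟩
    C₁ * (2 ^ k * suc t ^ k)         ≤⟨ *-monoʳ-≤ C₁ (*-monoʳ-≤ (2 ^ k) (lo t (≤-trans (m≤m+n m₁ _) q))) ⟩
    C₁ * (2 ^ k * (C₁ * ℓ t))        ≡⟨ trans (sym (*-assoc C₁ (2 ^ k) _)) (sym (*-assoc (C₁ * 2 ^ k) C₁ (ℓ t))) ⟩
    C₁ * 2 ^ k * C₁ * ℓ t            ∎
    where open ≤-Reasoning

  g≤ℓ : ∀ t → t₁ ≤ t → g t ≤ ℓ t
  g≤ℓ t q = ≤-trans (≤-reflexive (sym (+-∸-assoc 1 (p≤ℓ t q)))) (≤-trans (∸-monoʳ-≤ (suc (ℓ t)) p≥1) ≤-refl)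

  ℓ≤pg : ∀ t → t₁ ≤ t → ℓ t ≤ p * g t
  ℓ≤pg t q = begin
    ℓ t                   ≡⟨ m+[n∸m]≡n (p≤ℓ t q) ⟨
    p + (ℓ t ∸ p)         ≤⟨ +-monoʳ-≤ p (m≤n*m (ℓ t ∸ p) p {{>-nonZero p≥1}}) ⟩
    p + p * (ℓ t ∸ p)     ≡⟨ *-suc p (ℓ t ∸ p) ⟨
    p * g t               ∎
    where open ≤-Reasoning

  -- One constant for all bounds of the family: the ratio of consecutive lengths from `growthStep`,
  -- plus C₁, times p for the loss in passing from ℓ to g.
  Cᶠ : ℕ
  Cᶠ = (C₁ * 2 ^ k * C₁ + C₁) * p

  C₂≤ : C₁ * 2 ^ k * C₁ ≤ Cᶠ
  C₂≤ = ≤-trans (m≤m+n _ C₁) (m≤m*n _ p {{>-nonZero p≥1}})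

  C₁≤ : C₁ ≤ Cᶠ
  C₁≤ = ≤-trans (m≤n+m C₁ (C₁ * 2 ^ k * C₁)) (m≤m*n _ p {{>-nonZero p≥1}})

  lo′ : ∀ t → t₁ ≤ t → suc t ^ k ≤ Cᶠ * g t
  lo′ t q = begin
    suc t ^ k           ≤⟨ lo t (≤-trans (m≤m+n m₁ _) q) ⟩
    C₁ * ℓ t            ≤⟨ *-monoʳ-≤ C₁ (ℓ≤pg t q) ⟩
    C₁ * (p * g t)      ≡⟨ *-assoc C₁ p (g t) ⟨
    C₁ * p * g t        ≤⟨ *-monoˡ-≤ (g t) (*-monoˡ-≤ p (m≤n+m C₁ (C₁ * 2 ^ k * C₁))) ⟩
    Cᶠ * g t            ∎
    where open ≤-Reasoning

  module Assemble (m : ℕ → ℕ) (A B : ℕ → Word s) (occurs : ∀ t → W (m t) a ≡ A t ++ W (suc t) e ++ B t)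
    (room : ∀ t → t₁ ≤ t → (o : Occurrence t (m t) (A t)) (o′ : Occurrence (suc t) (m (suc t)) (A (suc t))) → g (suc t) ≤ Cᶠ * Occurrence.l o′) where

    pick : ∀ t → Dec (p ≤ ℓ t) → ℕ
    pick t (yes q) = Occurrence.l (occurrence t (m t) (A t) (B t) q (occurs t))
    -- A default for runs shorter than p, which occur only below t₁.
    pick t (no _) = 0

    picked : ∀ t (d : Dec (p ≤ ℓ t)) → p ≤ ℓ t → Σ (Occurrence t (m t) (A t)) λ o → pick t d ≡ Occurrence.l o
    picked t (yes q) _ = occurrence t (m t) (A t) (B t) q (occurs t) , refl
    picked t (no ¬q) q = ⊥-elim (¬q q)

    pos : ℕ → ℕ
    pos t = pick t (p ≤? ℓ t)

    found : ∀ t → t₁ ≤ t → Σ (Occurrence t (m t) (A t)) λ o → pos t ≡ Occurrence.l o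
    found t q = picked t (p ≤? ℓ t) (p≤ℓ t q)

    iso′ : ∀ t → t₁ ≤ t → Isolated β p (pos t) (g t)
    iso′ t q = let o , e = found t q in subst (λ x → Isolated β p x (g t)) (sym e) (Occurrence.iso o)

    family : Family β p k
    family = record
      { C = Cᶠ ; t₀ = suc t₁ ; l = pos ; g = g
      ; breakˡ = λ t q → Isolated.breakˡ (iso′ t (<⇒≤ q))
      ; match = λ t q → Isolated.match (iso′ t (<⇒≤ q))
      ; breakʳ = λ t q → Isolated.breakʳ (iso′ t (<⇒≤ q))
      ; lo = λ t q → lo′ t (<⇒≤ q)
      ; hi = λ t q → ≤-trans (g≤ℓ t (<⇒≤ q)) (≤-trans (hi t) (*-monoˡ-≤ (suc t ^ k) C₁≤))
      ; strict = λ t q → s≤s (∸-monoˡ-< (strict k≥1 t (≤-trans (m≤m+n m₁ _) (<⇒≤ q))) (p≤ℓ t (<⇒≤ q)))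
      ; room = λ { (suc t) (s≤s q) → subst (λ x → g (suc t) ≤ Cᶠ * x) (sym (proj₂ (found (suc t) (≤-trans q (n≤1+n t)))))
          (room t q (proj₁ (found t q)) (proj₁ (found (suc t) (≤-trans q (n≤1+n t))))) } }

  W-a : ∀ t → W (suc t) a ≡ W t a ++ W* t γ
  W-a t = trans (stepW t a) (cong (W* t) φa)

  -- A copy of run t + 1 lies behind `W (suc (suc t)) a`, which is at least as long as run t, and
  -- consecutive runs have lengths of bounded ratio.
  fromγ : e ∈ γ → Family β p k
  fromγ e∈ = Assemble.family (λ t → suc (suc t)) (λ t → W (suc t) a ++ X t) Y
      (λ t → trans (W-a (suc t)) (trans (cong (W (suc t) a ++_) (eq (suc t))) (sym (++-assoc (W (suc t) a) (X t) _))))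
      room
    where
    X Y : ℕ → Word s
    X t = proj₁ (concatMap-∈ (W (suc t)) e∈)
    Y t = proj₁ (proj₂ (concatMap-∈ (W (suc t)) e∈))
    eq : ∀ t → W* t γ ≡ proj₁ (concatMap-∈ (W t) e∈) ++ W t e ++ proj₁ (proj₂ (concatMap-∈ (W t) e∈))
    eq t = proj₂ (proj₂ (concatMap-∈ (W t) e∈))
    We≤Wa : ∀ t → length (W t e) ≤ length (W (suc t) a)
    We≤Wa t = begin
      length (W t e)            ≤⟨ ≤-trans (m≤m+n _ _) (m≤n+m _ (length (proj₁ (concatMap-∈ (W t) e∈)))) ⟩
      _                         ≡⟨ length-++₃ (proj₁ (concatMap-∈ (W t) e∈)) (W t e) (proj₁ (proj₂ (concatMap-∈ (W t) e∈))) ⟨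
      _                         ≡⟨ cong length (eq t) ⟨
      length (W* t γ)           ≤⟨ length-++-≤ʳ (W* t γ) {W t a} ⟩
      length (W t a ++ W* t γ)  ≡⟨ cong length (W-a t) ⟨
      length (W (suc t) a)      ∎
      where open ≤-Reasoning
    tl≤ : ∀ t → suc (tl t) ≤ length (W* t u₀)
    tl≤ t with hd-stop (reverse z) (reverse (W* t u₀)) (len≥1 (reverse z) lz̄) (trans (runˡ-const t u₀ (reverse z) lz̄) (proj₁ (proj₂ dead)))
      where lz̄ = trans (length-reverse z) lz
    ... | Z₁ , x′ , Z₂ , _ , _ , eZ , lZ , _ = ≤-trans (≤-reflexive (cong suc (sym lZ))) (≤-trans (≤-trans (s≤s (m≤m+n (length Z₁) (length Z₂))) (≤-reflexive (sym (+-suc (length Z₁) (length Z₂)))))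
          (≤-reflexive (trans (sym (length-++ Z₁)) (trans (cong length (sym eZ)) (length-reverse (W* t u₀))))))
    room : ∀ t → t₁ ≤ t → Occurrence t (suc (suc t)) (W (suc t) a ++ X t) →
      (o′ : Occurrence (suc t) (suc (suc (suc t))) (W (suc (suc t)) a ++ X (suc t))) → g (suc t) ≤ Cᶠ * Occurrence.l o′
    room t q _ o′ = begin
      g (suc t)                              ≤⟨ g≤ℓ (suc t) (≤-trans q (n≤1+n t)) ⟩
      ℓ (suc t)                              ≤⟨ growthStep t q ⟩
      C₁ * 2 ^ k * C₁ * ℓ t                  ≤⟨ *-mono-≤ C₂≤ (≤-trans (ℓ≤W t) (≤-trans (We≤Wa (suc t)) (≤-trans (length-++-≤ˡ (W (suc (suc t)) a)) A≤l))) ⟩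
      Cᶠ * Occurrence.l o′                   ∎
      where
      open ≤-Reasoning
      A≤l : length (W (suc (suc t)) a ++ X (suc t)) ≤ Occurrence.l o′
      A≤l = +-cancelʳ-≤ (suc (tl (suc t))) _ _ (≤-trans (+-monoʳ-≤ (length (W (suc (suc t)) a ++ X (suc t))) (tl≤ (suc t))) (≤-reflexive (sym (Occurrence.mid o′))))

  -- Here the runs lie in the prefixes of β, and the room before a run comes from its predecessor.
  -- Run t ends within `W (suc t) a`, before the boundary that run t + 1 crosses. Its right
  -- exception cannot lie in the stretch of run t + 1, so that run begins at or after it.
  fromClone : φ e ≡ φ a → (∀ m → W m e ≡ W m a) → Family β p k
  fromClone φ≡ W≡ = Assemble.family suc (λ _ → []) (λ _ → []) (λ t → trans (sym (W≡ (suc t))) (sym (++-identityʳ _))) room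
    where
    Wa≤u₀ : ∀ t → length (W t a) ≤ length (W* t u₀)
    Wa≤u₀ t with u₀ | trans (sym φe≡) (trans φ≡ φa) | proj₁ (proj₂ dead)
    ... | [] | _ | ()
    ... | c ∷ u | eq | _ with refl , _ ← ∷-injective eq = length-++-≤ˡ (W t a)
    room : ∀ t → t₁ ≤ t → (o : Occurrence t (suc t) []) (o′ : Occurrence (suc t) (suc (suc t)) []) → g (suc t) ≤ Cᶠ * Occurrence.l o′
    room t q o o′ = begin
      g (suc t)                        ≤⟨ g≤ℓ (suc t) (≤-trans q (n≤1+n t)) ⟩
      ℓ (suc t)                        ≤⟨ growthStep t q ⟩
      C₁ * 2 ^ k * C₁ * ℓ t            ≤⟨ *-monoʳ-≤ (C₁ * 2 ^ k * C₁) (ℓ≤pg t q) ⟩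
      C₁ * 2 ^ k * C₁ * (p * g t)      ≡⟨ *-assoc (C₁ * 2 ^ k * C₁) p (g t) ⟨
      C₁ * 2 ^ k * C₁ * p * g t        ≤⟨ *-mono-≤ (*-monoˡ-≤ p (m≤m+n (C₁ * 2 ^ k * C₁) C₁)) (≤-trans (m≤n+m (g t) (Occurrence.l o)) (≮⇒≥ notInside)) ⟩
      Cᶠ * l′                          ∎
      where
      open ≤-Reasoning
      l = Occurrence.l o
      l′ = Occurrence.l o′
      ℓ′ = ℓ (suc t)
      beyond : l + g t < l′ + g (suc t)
      beyond = +-cancelʳ-< p _ _ (begin-strict
        l + g t + p                          <⟨ Occurrence.final o ⟩
        length (W (suc t) e)                 ≡⟨ cong length (W≡ (suc t)) ⟩
        length (W (suc t) a)                 ≤⟨ Wa≤u₀ (suc t) ⟩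
        length (W* (suc t) u₀)               ≡⟨ Occurrence.mid o′ ⟨
        l′ + suc (tl (suc t))                ≤⟨ +-monoʳ-≤ l′ (s≤s (m≤m+n (tl (suc t)) _)) ⟩
        l′ + suc ℓ′                          ≡⟨ cong (λ x → l′ + suc x) (m∸n+n≡m (p≤ℓ (suc t) (≤-trans q (n≤1+n t)))) ⟨
        l′ + suc (ℓ′ ∸ p + p)                ≡⟨ +-assoc l′ (g (suc t)) p ⟨
        l′ + g (suc t) + p                   ∎)
      notInside : ¬ l′ < l + g t
      notInside lt = Isolated.breakʳ (Occurrence.iso o) (Isolated.match (Occurrence.iso o′) (l + g t) lt beyond)

  family : Family β p k
  family with reach e
  ... | inj₁ (φ≡ , W≡) = fromClone φ≡ W≡
  ... | inj₂ e∈ = fromγ e∈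

-- Removing the mortal letters

prefix-map : ∀ {s} (ψ : Coding s) (u : Word s) (σ : InfWord s) → PrefixOf u σ → PrefixOf (map ψ u) (ψ ∘ σ)
prefix-map ψ (x ∷ u) σ h Fin.zero = cong ψ (h Fin.zero)
prefix-map ψ (x ∷ u) σ h (Fin.suc i) = prefix-map ψ u (σ ∘ suc) (λ j → h (Fin.suc j)) i

nonempty⇒∈ : ∀ {A : Set} {u : List A} → 1 ≤ length u → ∃[ x ] x ∈ u
nonempty⇒∈ {u = x ∷ u} _ = x , here refl

∈⇒nonempty : ∀ {A : Set} {u : List A} {x} → x ∈ u → 1 ≤ length u
∈⇒nonempty {u = x ∷ u} _ = s≤s z≤n

module Raw {s : ℕ} (φ₀ : Morphism s) (a : Fin s) (γ₀ : Word s) (φa : φ₀ a ≡ a ∷ γ₀) (γ₀≢ : ∀ n → iterM φ₀ n γ₀ ≢ [])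
  (α : InfWord s) (lim : IsFixedPointLimit φ₀ a α) (ψ : Coding s) where
  open import Data.List.Membership.DecPropositional (Fin._≟_ {s}) using (_∈?_)

  bit : ∀ {P : Set} → Dec P → Fin 2
  bit (yes _) = Fin.suc Fin.zero
  bit (no _)  = Fin.zero

  bit-cong : ∀ {P Q : Set} (d : Dec P) (e : Dec Q) → (P → Q) → (Q → P) → bit d ≡ bit e
  bit-cong (yes p) (yes q) f g = refl
  bit-cong (yes p) (no ¬q) f g = ⊥-elim (¬q (f p))
  bit-cong (no ¬p) (yes q) f g = ⊥-elim (¬p (g q))
  bit-cong (no ¬p) (no ¬q) f g = refl

  bit-to : ∀ {P Q : Set} (d : Dec P) (e : Dec Q) → bit d ≡ bit e → P → Q
  bit-to _ (yes q) _ _ = q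
  bit-to (yes p) (no ¬q) ()
  bit-to (no ¬p) (no ¬q) _ p = ⊥-elim (¬p p)

  occ : ℕ → Fin s → Fin s → Fin 2
  occ m c d = bit (d ∈? iterM φ₀ m (c ∷ []))

  st : ℕ → Fin ((2 ^ s) ^ s)
  st m = funToFin (λ c → funToFin (occ m c))

  st-to : ∀ m m′ → st m ≡ st m′ → ∀ {c d} → d ∈ iterM φ₀ m (c ∷ []) → d ∈ iterM φ₀ m′ (c ∷ [])
  st-to m m′ e {c} {d} = bit-to (d ∈? iterM φ₀ m (c ∷ [])) (d ∈? iterM φ₀ m′ (c ∷ []))
    (funToFin-injective (occ m c) (occ m′ c) (funToFin-injective (λ c → funToFin (occ m c)) (λ c → funToFin (occ m′ c)) e c) d)

  occ-suc : ∀ m m′ → st m ≡ st m′ → ∀ {c d} → d ∈ iterM φ₀ (suc m) (c ∷ []) → d ∈ iterM φ₀ (suc m′) (c ∷ [])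
  occ-suc m m′ e m∈ with find (∈-concatMap⁻ φ₀ m∈)
  ... | x , x∈ , d∈ = ∈-concatMap⁺ φ₀ (lose (st-to m m′ e x∈) d∈)

  det : ∀ m m′ → st m ≡ st m′ → st (suc m) ≡ st (suc m′)
  det m m′ e = funToFin-cong (λ c → funToFin (occ (suc m) c)) (λ c → funToFin (occ (suc m′) c)) (λ c → funToFin-cong (occ (suc m) c) (occ (suc m′) c) (λ d →
    bit-cong (d ∈? iterM φ₀ (suc m) (c ∷ [])) (d ∈? iterM φ₀ (suc m′) (c ∷ [])) (occ-suc m m′ e) (occ-suc m′ m (sym e))))

  module WithIndex (n : ℕ) (same : ∀ j → st (suc j * suc n) ≡ st (suc n)) where

    N : ℕ
    N = suc n

    φ₁ : Morphism s
    φ₁ = power φ₀ N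

    occ⁻ : ∀ j {c d} → d ∈ iterM φ₀ (suc j * N) (c ∷ []) → d ∈ φ₁ c
    occ⁻ j = st-to (suc j * N) N (same j)

    occ⁺ : ∀ j {c d} → d ∈ φ₁ c → d ∈ iterM φ₀ (suc j * N) (c ∷ [])
    occ⁺ j = st-to N (suc j * N) (sym (same j))

    -- The letters of φ₀^(jN) c are the same for all j ≥ 1, so one power decides whether c ever dies
    -- out.
    Live : Fin s → Set
    Live c = 1 ≤ length (φ₁ c)

    live? : Decidable Live
    live? c = 1 ≤? length (φ₁ c)

    twice : ∀ c → iterM φ₀ (2 * N) (c ∷ []) ≡ concatMap φ₁ (φ₁ c)
    twice c = trans (cong (λ k → iterM φ₀ (N + k) (c ∷ [])) (+-identityʳ N)) (trans (iterM-+ φ₀ N N (c ∷ [])) (sym (applyM-power φ₀ N (φ₁ c))))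

    compose : ∀ {c d e} → d ∈ φ₁ c → e ∈ φ₁ d → e ∈ φ₁ c
    compose {c} {d} {e} m m′ = occ⁻ 1 (subst (e ∈_) (sym (twice c)) (∈-concatMap⁺ φ₁ (lose m m′)))

    decompose : ∀ {c e} → e ∈ φ₁ c → ∃[ d ] d ∈ φ₁ c × e ∈ φ₁ d
    decompose {c} {e} m = find (∈-concatMap⁻ φ₁ {xs = φ₁ c} (subst (e ∈_) (twice c) (occ⁺ 1 m)))

    headIter : ∀ n → ∃[ δ ] iterM φ₀ (suc n) (a ∷ []) ≡ a ∷ γ₀ ++ δ
    headIter zero = [] , cong (_++ []) φa
    headIter (suc n) with headIter n
    ... | δ , eq = applyM φ₀ (γ₀ ++ δ) , trans (cong (applyM φ₀) eq) (cong (_++ applyM φ₀ (γ₀ ++ δ)) φa)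

    γ₁ : Word s
    γ₁ = γ₀ ++ proj₁ (headIter n)

    φ₁a : φ₁ a ≡ a ∷ γ₁
    φ₁a = proj₂ (headIter n)

    a∈ : a ∈ φ₁ a
    a∈ = subst (a ∈_) (sym φ₁a) (here refl)

    good? : ∀ c → Dec (c ∈ φ₁ a × Live c)
    good? c with c ∈? φ₁ a | live? c
    ... | yes m | yes l = yes (m , l)
    ... | no ¬m | _ = no λ (m , _) → ¬m m
    ... | _ | no ¬l = no λ (_ , l) → ¬l l

    -- Letters that are mortal or do not occur in α behave as copies of a.
    rep : Fin s → Fin s
    rep c with good? c
    ... | yes _ = c
    ... | no _ = a

    rep-good : ∀ c → c ∈ φ₁ a → Live c → rep c ≡ c
    rep-good c m l with good? c
    ... | yes _ = refl
    ... | no ¬g = ⊥-elim (¬g (m , l))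

    a-live : Live a
    a-live = ∈⇒nonempty a∈

    rep-prop : ∀ c → rep c ∈ φ₁ a × Live (rep c)
    rep-prop c with good? c
    ... | yes g = g
    ... | no _ = a∈ , a-live

    φ₂ : Morphism s
    φ₂ c = filter live? (φ₁ (rep c))

    -- The exponent starts at N rather than 0: mortal letters then spell nothing at every level, and
    -- filtering them out of images does not change what is spelled.
    V : ℕ → Fin s → Word s
    V m d = map ψ (iterM φ₀ (suc m * N) (d ∷ []))

    W₂ : ℕ → Fin s → Word s
    W₂ m c = V m (rep c)

    V-dead : ∀ m d → ¬ Live d → V m d ≡ []
    V-dead m d ¬l = cong (map ψ) (trans (cong (λ k → iterM φ₀ k (d ∷ [])) (+-comm N (m * N))) (trans (iterM-+ φ₀ (m * N) N (d ∷ []))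
      (trans (cong (iterM φ₀ (m * N)) (empty (φ₁ d) ¬l)) (iterM-[] φ₀ (m * N)))))
      where
      empty : ∀ (u : Word s) → ¬ 1 ≤ length u → u ≡ []
      empty [] _ = refl
      empty (x ∷ u) ¬l = ⊥-elim (¬l (s≤s z≤n))

    V-filter : ∀ m u → All (_∈ φ₁ a) u → concatMap (V m) u ≡ concatMap (W₂ m) (filter live? u)
    V-filter m [] [] = refl
    V-filter m (d ∷ u) (p ∷ ps) = go (live? d)
      where
      go : Dec (Live d) → concatMap (V m) (d ∷ u) ≡ concatMap (W₂ m) (filter live? (d ∷ u))
      go (yes l) = trans (cong₂ _++_ (cong (V m) (sym (rep-good d p l))) (V-filter m u ps))
        (cong (concatMap (W₂ m)) (sym (filter-accept live? l)))
      go (no ¬l) = trans (cong (_++ concatMap (V m) u) (V-dead m d ¬l)) (trans (V-filter m u ps)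
        (cong (concatMap (W₂ m)) (sym (filter-reject live? ¬l))))

    φ₁-closed : ∀ c → All (_∈ φ₁ a) (φ₁ (rep c))
    φ₁-closed c = All.tabulate (λ m → compose (proj₁ (rep-prop c)) m)

    step₂ : ∀ m c → W₂ (suc m) c ≡ concatMap (W₂ m) (φ₂ c)
    step₂ m c = trans (cong (map ψ) (trans (cong (λ k → iterM φ₀ k (rep c ∷ [])) (+-comm N (suc m * N))) (trans (iterM-+ φ₀ (suc m * N) N (rep c ∷ [])) (iterM-letters φ₀ (suc m * N) _))))
      (trans (map-concatMap ψ (λ d → iterM φ₀ (suc m * N) (d ∷ [])) (φ₁ (rep c))) (V-filter m (φ₁ (rep c)) (φ₁-closed c)))

    φ₂≥1 : ∀ c → 1 ≤ length (φ₂ c)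
    φ₂≥1 c with nonempty⇒∈ (proj₂ (rep-prop c))
    ... | e , e∈ with decompose e∈
    ... | d , d∈ , e∈d = ∈⇒nonempty (∈-filter⁺ live? d∈ (∈⇒nonempty e∈d))

    W₂≥1 : ∀ m c → 1 ≤ length (W₂ m c)
    W₂≥1 m c with nonempty⇒∈ (proj₂ (rep-prop c))
    ... | e , e∈ = subst (1 ≤_) (sym (length-map ψ (iterM φ₀ (suc m * N) (rep c ∷ [])))) (∈⇒nonempty (occ⁺ m e∈))

    rep-a : rep a ≡ a
    rep-a = rep-good a a∈ a-live

    γ₂ : Word s
    γ₂ = filter live? γ₁

    φ₂a : φ₂ a ≡ a ∷ γ₂
    φ₂a = trans (cong (λ c → filter live? (φ₁ c)) rep-a) (trans (cong (filter live?) φ₁a) (filter-accept live? a-live))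

    γ₂≥1 : 1 ≤ length γ₂
    γ₂≥1 with iterM φ₀ N γ₀ in eq
    ... | [] = ⊥-elim (γ₀≢ N eq)
    ... | e ∷ _ with find (∈-concatMap⁻ φ₁ {xs = γ₀} (subst (e ∈_) (trans (sym eq) (sym (applyM-power φ₀ N γ₀))) (here refl)))
    ...   | d , d∈ , e∈ = ∈⇒nonempty (∈-filter⁺ live? (∈-++⁺ˡ d∈) (∈⇒nonempty e∈))

    star₂⁻ : ∀ {c d} → d ∈ applyM φ₂ (φ₂ c) → d ∈ φ₂ c
    star₂⁻ {c} {d} m with find (∈-concatMap⁻ φ₂ m)
    ... | e , e∈ , d∈ with ∈-filter⁻ live? {xs = φ₁ (rep c)} e∈ | ∈-filter⁻ live? {xs = φ₁ (rep e)} d∈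
    ... | e∈₁ , le | d∈₁ , ld = ∈-filter⁺ live? (compose e∈₁ (subst (λ x → d ∈ φ₁ x) (rep-good e (compose (proj₁ (rep-prop c)) e∈₁) le) d∈₁)) ld

    star₂⁺ : ∀ {c d} → d ∈ φ₂ c → d ∈ applyM φ₂ (φ₂ c)
    star₂⁺ {c} {d} m with ∈-filter⁻ live? {xs = φ₁ (rep c)} m
    ... | d∈ , ld with decompose d∈
    ... | e , e∈ , d∈e = ∈-concatMap⁺ φ₂ (lose (∈-filter⁺ live? e∈ le)
            (∈-filter⁺ live? (subst (λ x → d ∈ φ₁ x) (sym (rep-good e (compose (proj₁ (rep-prop c)) e∈) le)) d∈e) ld))
      where le = ∈⇒nonempty d∈e

    clone : ∀ {c} → rep c ≡ a → φ₂ c ≡ φ₂ a × (∀ m → W₂ m c ≡ W₂ m a)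
    clone e = cong (λ c → filter live? (φ₁ c)) (trans e (sym rep-a)) , λ m → cong (V m) (trans e (sym rep-a))

    reach₂ : ∀ c → (φ₂ c ≡ φ₂ a × (∀ m → W₂ m c ≡ W₂ m a)) ⊎ c ∈ γ₂
    reach₂ c = go (good? c)
      where
      go : Dec (c ∈ φ₁ a × Live c) → (φ₂ c ≡ φ₂ a × (∀ m → W₂ m c ≡ W₂ m a)) ⊎ c ∈ γ₂
      go (yes (m , l)) with subst (c ∈_) φ₁a m
      ... | here refl = inj₁ (clone rep-a)
      ... | there c∈ = inj₂ (∈-filter⁺ live? c∈ l)
      go (no ¬g) = inj₁ (clone (rep-bad ¬g))
        where
        rep-bad : ¬ (c ∈ φ₁ a × Live c) → rep c ≡ a
        rep-bad ¬g with good? c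
        ... | yes g = ⊥-elim (¬g g)
        ... | no _ = refl

    base : Base (λ i → ψ (α i))
    base = record
      { φ = φ₂ ; W = W₂ ; stepW = step₂ ; φ≥1 = φ₂≥1 ; W≥1 = W₂≥1 ; a = a ; γ = γ₂ ; φa = φ₂a ; γ≥1 = γ₂≥1
      ; star⁻ = star₂⁻ ; star⁺ = star₂⁺ ; reach = reach₂
      ; pre = λ m → subst (λ c → PrefixOf (V m c) (λ i → ψ (α i))) (sym rep-a) (prefix-map ψ (iterM φ₀ (suc m * N) (a ∷ [])) α (lim (suc m * N))) }

  base : Base (λ i → ψ (α i))
  base = go (idempotentIndex st det)
    where
    go : (∃[ N ] 1 ≤ N × ∀ j → st (suc j * N) ≡ st N) → Base (λ i → ψ (α i))
    go (suc n , _ , same) = WithIndex.base n same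

-- Counting windows

toList-injective : ∀ {A : Set} {n} (v w : Vec A n) → Vec.toList v ≡ Vec.toList w → v ≡ w
toList-injective Vec.[] Vec.[] _ = refl
toList-injective (x Vec.∷ v) (y Vec.∷ w) e = cong₂ Vec._∷_ (proj₁ (∷-injective e)) (toList-injective v w (proj₂ (∷-injective e)))

length-toList : ∀ {A : Set} {n} (v : Vec A n) → length (Vec.toList v) ≡ n
length-toList Vec.[] = refl
length-toList (x Vec.∷ v) = cong suc (length-toList v)

prefix-toList : ∀ {s n} (w : Vec (Fin s) n) {σ : InfWord s} → (∀ j → Vec.lookup w j ≡ σ (toℕ j)) → PrefixOf (Vec.toList w) σ
prefix-toList (x Vec.∷ w) h Fin.zero = h Fin.zero
prefix-toList (x Vec.∷ w) {σ} h (Fin.suc i) = prefix-toList w {σ ∘ suc} (λ j → h (Fin.suc j)) i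

complexity≤ : ∀ {s} {β : InfWord s} {p n} → IsSubwordComplexity β p → (Ls : List (Word s)) →
  (∀ i w → length w ≡ n → PrefixOf w (λ j → β (i + j)) → w ∈ Ls) → p n ≤ length Ls
complexity≤ {s} {β} {p} {n} pc Ls h with pc n
... | ws , len , uniq , mem = subst (_≤ length Ls) (trans (length-map Vec.toList ws) len)
    (unique⇒length≤ (Unique.map⁺ (λ {v} {w} → toList-injective v w) uniq) sub)
  where
  sub : ∀ {x} → x ∈ map Vec.toList ws → x ∈ Ls
  sub m with ∈-map⁻ Vec.toList m
  ... | w , w∈ , refl = let i , e = proj₁ (mem w) w∈ in h i (Vec.toList w) (length-toList w) (prefix-toList w {λ j → β (i + j)} e)

prefix-unique : ∀ {s} (u v : Word s) {σ : InfWord s} → PrefixOf u σ → PrefixOf v σ → length v ≤ length u → ∃[ y ] u ≡ v ++ y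
prefix-unique u [] _ _ _ = u , refl
prefix-unique (x ∷ u) (y ∷ v) {σ} h h′ (s≤s l) with prefix-unique u v {σ ∘ suc} (λ j → h (Fin.suc j)) (λ j → h′ (Fin.suc j)) l
... | r , e = r , cong₂ _∷_ (trans (h Fin.zero) (sym (h′ Fin.zero))) e

locate : ∀ {s} {β : InfWord s} (u : Word s) i w → PrefixOf u β → i + length w ≤ length u → PrefixOf w (λ j → β (i + j)) →
  ∃[ x ] ∃[ y ] u ≡ x ++ w ++ y
locate {s} {β} u i w h l hw with prefix-unique (drop i u) w {λ j → β (i + j)} h′ hw
    (+-cancelˡ-≤ i _ _ (≤-trans l (≤-reflexive (sym (trans (cong (i +_) (length-drop i u)) (m+[n∸m]≡n (≤-trans (m≤m+n i _) l)))))))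
  where
  li : length (take i u) ≡ i
  li = trans (length-take i u) (m≤n⇒m⊓n≡m (≤-trans (m≤m+n i _) l))
  h′ : PrefixOf (drop i u) (λ j → β (i + j))
  h′ = subst (λ k → PrefixOf (drop i u) (λ j → β (k + j))) li (prefix-++ʳ (take i u) {drop i u} {β} (subst (λ x → PrefixOf x β) (sym (take++drop≡id i u)) h))
... | y , e = take i u , y , trans (sym (take++drop≡id i u)) (cong (take i u ++_) e)

-- Elementary estimates

pow-+ : ∀ x y k → (x + y) ^ k ≤ 2 ^ k * (x ^ k + y ^ k)
pow-+ x y k with ≤-total x y
... | inj₁ le = ≤-trans (^-monoˡ-≤ k (≤-trans (+-monoˡ-≤ y le) (≤-reflexive (double y))))
      (≤-trans (≤-reflexive (^-distrib-* 2 y k)) (*-monoʳ-≤ (2 ^ k) (m≤n+m (y ^ k) (x ^ k))))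
... | inj₂ le = ≤-trans (^-monoˡ-≤ k (≤-trans (+-monoʳ-≤ x le) (≤-reflexive (double x))))
      (≤-trans (≤-reflexive (^-distrib-* 2 x k)) (*-monoʳ-≤ (2 ^ k) (m≤m+n (x ^ k) (y ^ k))))

suc≤2^ : ∀ t → suc t ≤ 2 ^ t
suc≤2^ zero = s≤s z≤n
suc≤2^ (suc t) = ≤-trans (+-mono-≤ (≤-trans (s≤s z≤n) (suc≤2^ t)) (suc≤2^ t)) (≤-reflexive (double (2 ^ t)))

-- With r the integer part of t / k, t + 1 ≤ k(r + 1) ≤ k·2^r, and the k-th power of 2^r is at most
-- 2^t.
poly≤exp : ∀ t k → 1 ≤ k → suc t ^ k ≤ k ^ k * 2 ^ t
poly≤exp t k k≥1 = begin
  suc t ^ k                ≤⟨ ^-monoˡ-≤ k le ⟩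
  (k * 2 ^ r) ^ k          ≡⟨ ^-distrib-* k (2 ^ r) k ⟩
  k ^ k * (2 ^ r) ^ k      ≡⟨ cong (k ^ k *_) (^-*-assoc 2 r k) ⟩
  k ^ k * 2 ^ (r * k)      ≤⟨ *-monoʳ-≤ (k ^ k) (^-monoʳ-≤ 2 (m/n*n≤m t k)) ⟩
  k ^ k * 2 ^ t            ∎
  where
  open ≤-Reasoning
  instance
    k≢0 : NonZero k
    k≢0 = >-nonZero k≥1
  r = t / k
  le : suc t ≤ k * 2 ^ r
  le = begin
    suc t                          ≡⟨ cong suc (m≡m%n+[m/n]*n t k) ⟩
    suc (t Data.Nat.% k) + r * k   ≤⟨ +-monoˡ-≤ (r * k) (m%n<n t k) ⟩
    k + r * k                      ≡⟨ *-comm (suc r) k ⟩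
    k * suc r                      ≤⟨ *-monoʳ-≤ k (suc≤2^ r) ⟩
    k * 2 ^ r                      ∎

log-suc≤ : ∀ n → 1 ≤ n → ⌊log₂ suc n ⌋ ≤ suc ⌊log₂ n ⌋
log-suc≤ n n≥1 = ≤-trans (⌊log₂⌋-mono-≤ (≤-trans (+-monoˡ-≤ n n≥1) (≤-reflexive (double n))))
  (≤-reflexive (⌊log₂[2*b]⌋≡1+⌊log₂b⌋ n {{>-nonZero n≥1}}))

1≤log′ : ∀ n → 2 ≤ n → 1 ≤ ⌊log₂ n ⌋
1≤log′ (suc (suc n)) _ = 1≤log n
1≤log′ (suc zero) (s≤s ())

-- Periodic case, estimates for large n, and conclusion

module Main {s : ℕ} {β : InfWord s} (N : NSys β) {f : ℕ → ℕ} (pc : IsSubwordComplexity β f) where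
  open NSys N
  open Runs N

  length-Wa : ∀ t → t ≤ length (W t a)
  length-Wa zero = z≤n
  length-Wa (suc t) = begin
    suc t                               ≤⟨ +-mono-≤ {1} (≤-trans γ≥1 (length≤concatMap (W t) (W≥1 t) γ)) (length-Wa t) ⟩
    length (W* t γ) + length (W t a)    ≡⟨ +-comm (length (W* t γ)) _ ⟩
    length (W t a) + length (W* t γ)    ≡⟨ length-++ (W t a) ⟨
    length (W t a ++ W* t γ)            ≡⟨ cong length (trans (stepW t a) (cong (W* t) φa)) ⟨
    length (W (suc t) a)                ∎
    where open ≤-Reasoning

  place : ∀ J i w → PrefixOf w (λ j → β (i + j)) → ∃[ x ] ∃[ y ] W (i + length w + J) a ≡ x ++ w ++ y
  place J i w h = locate {β = β} (W (i + length w + J) a) i w (pre (i + length w + J)) (≤-trans (m≤m+n (i + length w) J) (length-Wa (i + length w + J))) h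

  -- By `constˡ` a reading that survives level 0 survives all levels, so β has period p and its
  -- complexity is bounded by the number of states.
  periodic : ∀ z → length z ≡ p → Alive z (reverse (W 0 a)) → IsBigONLogN f
  periodic z l (z′ , r) = length (words s p) , 2 , λ n n≥2 → ≤-trans (bound n)
      (≤-trans (m≤m*n _ n {{>-nonZero (≤-trans (s≤s z≤n) n≥2)}}) (m≤m*n _ ⌊log₂ n ⌋ {{>-nonZero (1≤log′ n n≥2)}}))
    where
    all : ∀ m → OK (W m a)
    all m = OK-reverse⁻ (W m a) (z , l , z′ , trans (constˡ m a z l) r)
    bound : ∀ n → f n ≤ length (words s p)
    bound n = ≤-trans (complexity≤ {β = β} pc (periodicWords n) (λ i w lw h → let x , y , e = place 0 i w h in
        subst (λ k → w ∈ periodicWords k) lw (OK⇒∈ w (OK-infix (W (i + length w + 0) a) x w {y} e (all (i + length w + 0))))))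
      (≤-reflexive (length-map (λ z → periodicPrefix z n) (words s p)))

  module Aperiodic (aDead : ∀ z → length z ≡ p → Dead z (reverse (W 0 a))) where

    module Bound (L : ℕ) where
      open LongBounded N L using (I)
      open Windows N L using (F; F₀; allForms; ∣allForms∣; window)

      bound : ∀ n M → (∀ {τ} → τ ∈ types → ∀ m → M ≤ m → Jump τ L n m) → LogReady I (suc n) M →
        f n ≤ F₀ + suc (I + M) * (suc n * F)
      bound n M jump ready = ≤-trans (complexity≤ {β = β} pc (allForms n (I + M)) (λ i w lw h → let x , y , e = place (I + M) i w h in
          window n M jump ready aDead (i + length w) {x} w {y} lw e)) (∣allForms∣ n (I + M))

      lg : ℕ → ℕ
      lg n = suc ⌊log₂ suc n ⌋

      A : ℕ
      A = suc (I + (L + I))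

      B₁ : ℕ
      B₁ = F₀ + A * (2 * F)

      -- Every estimate is brought to the form n · (R + lg n) with lg n ≥ 1.
      bound′ : ∀ n R → 1 ≤ n → (∀ {τ} → τ ∈ types → ∀ m → R + (L + I) * lg n ≤ m → Jump τ L n m) → f n ≤ B₁ * (n * (R + lg n))
      bound′ n R n≥1 jump = begin
        f n                                                   ≤⟨ bound n (R + (L + I) * lg n) jump (≤-trans (*-monoˡ-≤ (lg n) (m≤n+m I L)) (m≤n+m _ R)) ⟩
        F₀ + suc (I + (R + (L + I) * lg n)) * (suc n * F)     ≤⟨ +-mono-≤ small (*-mono-≤ levels (*-monoˡ-≤ F (≤-trans (+-monoˡ-≤ n n≥1) (≤-reflexive (double n))))) ⟩
        F₀ * X + A * (R + lg n) * (2 * n * F)                 ≡⟨ cong (F₀ * X +_) rearrange ⟩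
        F₀ * X + A * (2 * F) * X                              ≡⟨ *-distribʳ-+ X F₀ (A * (2 * F)) ⟨
        B₁ * X                                                ∎
        where
        open ≤-Reasoning
        X = n * (R + lg n)
        X≥1 : 1 ≤ X
        X≥1 = *-mono-≤ n≥1 (≤-trans (s≤s z≤n) (m≤n+m (lg n) R))
        small : F₀ ≤ F₀ * X
        small = ≤-trans (≤-reflexive (sym (*-identityʳ F₀))) (*-monoʳ-≤ F₀ X≥1)
        levels : suc (I + (R + (L + I) * lg n)) ≤ A * (R + lg n)
        levels = begin
          suc I + (R + (L + I) * lg n)                  ≤⟨ +-mono-≤ (≤-trans (≤-reflexive (sym (*-identityʳ (suc I)))) (*-monoʳ-≤ (suc I) {1} {lg n} (s≤s z≤n))) (+-monoˡ-≤ ((L + I) * lg n) (m≤n*m R A)) ⟩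
          suc I * lg n + (A * R + (L + I) * lg n)       ≡⟨ cong (suc I * lg n +_) (+-comm (A * R) _) ⟩
          suc I * lg n + ((L + I) * lg n + A * R)       ≡⟨ +-assoc (suc I * lg n) _ _ ⟨
          (suc I * lg n + (L + I) * lg n) + A * R       ≡⟨ cong (_+ A * R) (*-distribʳ-+ (lg n) (suc I) (L + I)) ⟨
          A * lg n + A * R                              ≡⟨ +-comm (A * lg n) _ ⟩
          A * R + A * lg n                              ≡⟨ *-distribˡ-+ A R (lg n) ⟨
          A * (R + lg n)                                ∎
        rearrange : A * (R + lg n) * (2 * n * F) ≡ A * (2 * F) * X
        rearrange = begin-equality
          A * (R + lg n) * (2 * n * F)     ≡⟨ *-assoc A (R + lg n) _ ⟩
          A * ((R + lg n) * (2 * n * F))   ≡⟨ cong (λ x → A * ((R + lg n) * x)) (trans (*-assoc 2 n F) (trans (cong (2 *_) (*-comm n F)) (sym (*-assoc 2 F n)))) ⟩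
          A * ((R + lg n) * (2 * F * n))   ≡⟨ cong (A *_) (*-swap (R + lg n) (2 * F) n) ⟩
          A * (2 * F * ((R + lg n) * n))   ≡⟨ cong (λ x → A * (2 * F * x)) (*-comm (R + lg n) n) ⟩
          A * (2 * F * X)                  ≡⟨ *-assoc A (2 * F) X ⟨
          A * (2 * F) * X                  ∎

      lgReady : ∀ n m R → R + (L + I) * lg n ≤ m → LogReady L n m
      lgReady n m R le = ≤-trans (*-mono-≤ (m≤m+n L I) (s≤s (⌊log₂⌋-mono-≤ (n≤1+n n)))) (≤-trans (m≤n+m _ R) le)

      logBound : (∀ {τ} → τ ∈ types → ∀ n m → LogReady L n m → Jump τ L n m) → IsBigONLogN f
      logBound h = B₁ * 3 , 2 , λ n n≥2 → begin
        f n                              ≤⟨ bound′ n 0 (≤-trans (s≤s z≤n) n≥2) (λ τ∈ m le → h τ∈ n m (lgReady n m 0 le)) ⟩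
        B₁ * (n * lg n)                  ≤⟨ *-monoʳ-≤ B₁ (*-monoʳ-≤ n (lg≤ n n≥2)) ⟩
        B₁ * (n * (3 * ⌊log₂ n ⌋))       ≡⟨ cong (B₁ *_) (*-swap n 3 _) ⟩
        B₁ * (3 * (n * ⌊log₂ n ⌋))       ≡⟨ *-assoc B₁ 3 _ ⟨
        B₁ * 3 * (n * ⌊log₂ n ⌋)         ≡⟨ *-assoc (B₁ * 3) n _ ⟨
        B₁ * 3 * n * ⌊log₂ n ⌋           ∎
        where
        open ≤-Reasoning
        lg≤ : ∀ n → 2 ≤ n → lg n ≤ 3 * ⌊log₂ n ⌋
        lg≤ n n≥2 = begin
          suc ⌊log₂ suc n ⌋                           ≤⟨ s≤s (log-suc≤ n (≤-trans (s≤s z≤n) n≥2)) ⟩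
          1 + (1 + ⌊log₂ n ⌋)                         ≤⟨ +-mono-≤ l≥1 (+-mono-≤ l≥1 (≤-reflexive (sym (+-identityʳ ⌊log₂ n ⌋)))) ⟩
          3 * ⌊log₂ n ⌋                               ∎
          where l≥1 = 1≤log′ n n≥2

      -- R is the integer k-th root of L·n, and the level is R plus a multiple of the logarithm. In
      -- the k-th power of R + lg n both terms contribute O(n), the second by `poly≤exp`.
      powBound : ∀ k → 1 ≤ k → (∀ {τ} → τ ∈ types → ∀ n m → PowReady k L n m → Jump τ L n m) →
        ∃[ C ] ∀ n → 1 ≤ n → f n ^ k ≤ C * n ^ suc k
      powBound k k≥1 h = C , λ n n≥1 → go n n≥1 (root (_^ k) (L * n) (suc (L * n)) (zeroPow k k≥1) (topPow (L * n)))
        where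
        open ≤-Reasoning
        zeroPow : ∀ k → 1 ≤ k → ∀ {m} → 0 ^ k ≤ m
        zeroPow (suc k) _ = z≤n
        topPow : ∀ m → m < suc m ^ k
        topPow m = ≤-trans (≤-reflexive (sym (*-identityʳ (suc m)))) (^-monoʳ-≤ (suc m) k≥1)
        C = B₁ ^ k * (2 ^ k * (L + k ^ k * 2))
        go : ∀ n → 1 ≤ n → (∃[ R ] R ^ k ≤ L * n × L * n < suc R ^ k) → f n ^ k ≤ C * n ^ suc k
        go n n≥1 (R , low , high) = begin
          f n ^ k                                             ≤⟨ ^-monoˡ-≤ k (bound′ n R n≥1 (λ τ∈ m le → h τ∈ n m
                                                                   (≤-trans (<⇒≤ high) (^-monoˡ-≤ k (s≤s (≤-trans (m≤m+n R _) le))) , lgReady n m R le))) ⟩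
          (B₁ * (n * (R + lg n))) ^ k                         ≡⟨ trans (^-distrib-* B₁ _ k) (cong (B₁ ^ k *_) (^-distrib-* n _ k)) ⟩
          B₁ ^ k * (n ^ k * (R + lg n) ^ k)                   ≤⟨ *-monoʳ-≤ (B₁ ^ k) (*-monoʳ-≤ (n ^ k) (≤-trans (pow-+ R (lg n) k) (*-monoʳ-≤ (2 ^ k) (+-mono-≤ low lgk)))) ⟩
          B₁ ^ k * (n ^ k * (2 ^ k * (L * n + k ^ k * 2 * n))) ≡⟨ cong (λ x → B₁ ^ k * (n ^ k * (2 ^ k * x))) (sym (*-distribʳ-+ n L (k ^ k * 2))) ⟩
          B₁ ^ k * (n ^ k * (2 ^ k * ((L + k ^ k * 2) * n)))  ≡⟨ cong (λ x → B₁ ^ k * (n ^ k * x)) (*-assoc (2 ^ k) (L + k ^ k * 2) n) ⟨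
          B₁ ^ k * (n ^ k * (2 ^ k * (L + k ^ k * 2) * n))    ≡⟨ cong (B₁ ^ k *_) (*-swap (n ^ k) (2 ^ k * (L + k ^ k * 2)) n) ⟩
          B₁ ^ k * (2 ^ k * (L + k ^ k * 2) * (n ^ k * n))    ≡⟨ *-assoc (B₁ ^ k) _ _ ⟨
          C * (n ^ k * n)                                     ≡⟨ cong (C *_) (*-comm (n ^ k) n) ⟩
          C * n ^ suc k                                       ∎
          where
          lgk : lg n ^ k ≤ k ^ k * 2 * n
          lgk = begin
            lg n ^ k                        ≤⟨ poly≤exp ⌊log₂ suc n ⌋ k k≥1 ⟩
            k ^ k * 2 ^ ⌊log₂ suc n ⌋       ≤⟨ *-monoʳ-≤ (k ^ k) (≤-trans (2^log≤n (suc n) (s≤s z≤n)) (≤-trans (+-monoˡ-≤ n n≥1) (≤-reflexive (double n)))) ⟩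
            k ^ k * (2 * n)                 ≡⟨ *-assoc (k ^ k) 2 n ⟨
            k ^ k * 2 * n                   ∎

    conclude : Verdict → (∃[ k ] (1 ≤ k × IsThetaPow f k)) ⊎ IsBigONLogN f
    conclude (log-case (L , h)) = inj₂ (Bound.logBound L h)
    conclude (power-case k τ k≥1 dead ell-poly (L , h)) = inj₁ (k , k≥1 , C ⊔ C′ , N₀ ⊔ 1 , λ n n≥ →
        ≤-trans (proj₂ (proj₂ low) n (≤-trans (m≤m⊔n N₀ 1) n≥)) (*-monoˡ-≤ (f n ^ k) (m≤m⊔n C C′)) ,
        ≤-trans (proj₂ up n (≤-trans (m≤n⊔m N₀ 1) n≥)) (*-monoˡ-≤ (n ^ suc k) (m≤n⊔m C C′)))
      where
      low = Lower.lower {β = β} pc p k k≥1 (BuildFamily.family N τ dead k k≥1 ell-poly)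
      C = proj₁ low
      N₀ = proj₁ (proj₂ low)
      up = Bound.powBound L k k≥1 h
      C′ = proj₁ up

  decide : (zs : List (Word s)) → (∃[ z ] z ∈ zs × Alive z (reverse (W 0 a))) ⊎ (∀ z → z ∈ zs → Dead z (reverse (W 0 a)))
  decide [] = inj₂ λ _ ()
  decide (z ∷ zs) with alive? z (reverse (W 0 a)) | decide zs
  ... | inj₁ al | _ = inj₁ (z , here refl , al)
  ... | inj₂ _ | inj₁ (z′ , m , al) = inj₁ (z′ , there m , al)
  ... | inj₂ d | inj₂ h = inj₂ λ { _ (here refl) → d ; z′ (there m) → h z′ m }

  main : (∃[ k ] (1 ≤ k × IsThetaPow f k)) ⊎ IsBigONLogN f
  main with decide (words s p)
  ... | inj₁ (z , m , al) = inj₂ (periodic z (words-length s p m) al)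
  ... | inj₂ h = Aperiodic.conclude (λ z l → h z (subst (λ k → z ∈ words s k) l (∈-words z))) verdict

theorem1 : (s : ℕ) (φ : Morphism s) (a : Fin s) (γ : Word s) →
    φ a ≡ a ∷ γ →
    (∀ n → iterM φ n γ ≢ []) →
    (α : InfWord s) → IsFixedPointLimit φ a α →
    (ψ : Coding s) →
    (p : ℕ → ℕ) → IsSubwordComplexity (λ i → ψ (α i)) p →
    (∃[ k ] (1 ≤ k × IsThetaPow p k)) ⊎ IsBigONLogN p
theorem1 s φ a γ φa γ≢ α lim ψ p pc =
  Main.main (toNSys (toCSys (toPSys (Bounded.toBSys (Raw.base φ a γ φa γ≢ α lim ψ))))) pc
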